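{- Fix integers $r,s$ with $0\le s<r$. For $n>r$ let $G(n,r,s)$ be the generalized Johnson graph, let $N=\binom{n}{r}$ be its number of vertices and $N_1=\binom{r}{s}\binom{n-r}{r-s}$ its vertex degree. Let $t=t(n)\ge 3$ be an integer-valued function of $n$. Then, as $n\to\infty$, $$\operatorname{mono}(C_t,G(n,r,s))\sim \operatorname{hom}(C_t,G(n,r,s))$$ if and only if $t=o\bigl(\min\{\sqrt{N},N_1\}\bigr)$.
   Context: For integers $0\le s<r<n$, the generalized Johnson graph $G(n,r,s)$ is the simple graph whose vertex set is the set of all $r$-element subsets of $[n]=\{1,\dots,n\}$, two vertices $x,y$ being adjacent iff $|x\cap y|=s$. It is $N_1$-regular with $N_1=\binom{r}{s}\binom{n-r}{r-s}$ and has $N=\binom{n}{r}$ vertices. $C_t$ denotes the cycle on $t$ vertices. For graphs $H,G$, a homomorphism is a map $\varphi:V(H)\to V(G)$ sending edges to edges; a monomorphism is an injective homomorphism. $\operatorname{hom}(H,G)$ and $\operatorname{mono}(H,G)$ denote the numbers of homomorphisms and monomorphisms from $H$ to $G$. Here $r,s$ are constants and $n\to\infty$. -}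

module Defs where

open import Data.Nat using (ℕ; zero; suc; _*_; _∸_; _^_; _≤_; _≥_; _<_; ∣_-_∣)
import Data.Nat as ℕ
open import Data.Nat.Combinatorics using (_C_)
open import Data.Bool using (true; false)
open import Data.Fin using (Fin; toℕ)
import Data.Fin.Properties as FinP
open import Data.Fin.Subset using (Subset; _∩_; ∣_∣)
open import Data.List using (List; []; _∷_; concatMap; map; filter; length)
open import Data.Vec using (Vec; []; _∷_; lookup)
import Data.Vec.Properties as VecP
open import Data.Bool.Properties using () renaming (_≟_ to _≟B_)
open import Data.Product using (_×_; ∃)
open import Data.Sum using (_⊎_)
open import Relation.Nullary using (Dec)
open import Relation.Nullary.Decidable using (_×-dec_; _⊎-dec_; _→-dec_)
open import Relation.Binary.PropositionalEquality using (_≡_)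

allSubsets : (n : ℕ) → List (Subset n)
allSubsets zero    = [] ∷ []
allSubsets (suc n) = concatMap (λ x → (true ∷ x) ∷ (false ∷ x) ∷ []) (allSubsets n)

allVecs : {A : Set} → List A → (t : ℕ) → List (Vec A t)
allVecs xs zero    = [] ∷ []
allVecs xs (suc t) = concatMap (λ x → map (x ∷_) (allVecs xs t)) xs

JVertices : (n r : ℕ) → List (Subset n)
JVertices n r = filter (λ x → ∣ x ∣ ℕ.≟ r) (allSubsets n)

JAdj : {n : ℕ} → (s : ℕ) → Subset n → Subset n → Set
JAdj s x y = ∣ x ∩ y ∣ ≡ s

Next : (t : ℕ) → Fin t → Fin t → Set
Next t i j = (suc (toℕ i) ≡ toℕ j) ⊎ (suc (toℕ i) ≡ t × toℕ j ≡ 0)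

CycleEdge : (t : ℕ) → Fin t → Fin t → Set
CycleEdge t i j = Next t i j ⊎ Next t j i

next? : (t : ℕ) → (i j : Fin t) → Dec (Next t i j)
next? t i j = (suc (toℕ i) ℕ.≟ toℕ j) ⊎-dec ((suc (toℕ i) ℕ.≟ t) ×-dec (toℕ j ℕ.≟ 0))

cycleEdge? : (t : ℕ) → (i j : Fin t) → Dec (CycleEdge t i j)
cycleEdge? t i j = next? t i j ⊎-dec next? t j i

IsHom : (n s t : ℕ) → Vec (Subset n) t → Set
IsHom n s t φ = ∀ i j → CycleEdge t i j → JAdj s (lookup φ i) (lookup φ j)

isHom? : (n s t : ℕ) → (φ : Vec (Subset n) t) → Dec (IsHom n s t φ)
isHom? n s t φ = FinP.all? λ i → FinP.all? λ j →
  cycleEdge? t i j →-dec (∣ lookup φ i ∩ lookup φ j ∣ ℕ.≟ s)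

IsInjective : {n t : ℕ} → Vec (Subset n) t → Set
IsInjective {n} {t} φ = ∀ (i j : Fin t) → lookup φ i ≡ lookup φ j → i ≡ j

isInjective? : {n t : ℕ} → (φ : Vec (Subset n) t) → Dec (IsInjective φ)
isInjective? φ = FinP.all? λ i → FinP.all? λ j →
  VecP.≡-dec _≟B_ (lookup φ i) (lookup φ j) →-dec (i FinP.≟ j)

homC : (t n r s : ℕ) → ℕ
homC t n r s = length (filter (isHom? n s t) (allVecs (JVertices n r) t))

monoC : (t n r s : ℕ) → ℕ
monoC t n r s =
  length (filter (λ φ → isHom? n s t φ ×-dec isInjective? φ) (allVecs (JVertices n r) t))

Nv : (n r : ℕ) → ℕ
Nv n r = n C r

N₁ : (n r s : ℕ) → ℕ
N₁ n r s = (r C s) * ((n ∸ r) C (r ∸ s))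

-- Asymptotic notions (n → ∞), expressed with ε = 1/k, k ≥ 1

Eventually : (ℕ → Set) → Set
Eventually P = ∃ λ n₀ → ∀ n → n ≥ n₀ → P n

-- a(n) ~ b(n):  |a(n)/b(n) - 1| ≤ 1/k eventually, for every k ≥ 1
_∼_ : (ℕ → ℕ) → (ℕ → ℕ) → Set
a ∼ b = ∀ k → 1 ≤ k → Eventually λ n → k * ∣ a n - b n ∣ ≤ b n

-- t(n) = o(min{√N, N₁}):  for every k ≥ 1, eventually k·t ≤ N₁ and k·t ≤ √N (i.e. (k·t)² ≤ N)
LittleOMinSqrtN-N₁ : (r s : ℕ) → (ℕ → ℕ) → Set
LittleOMinSqrtN-N₁ r s t = ∀ k → 1 ≤ k → Eventually λ n →
  (k * t n ≤ N₁ n r s) × ((k * t n) ^ 2 ≤ Nv n r)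

{-# OPTIONS --safe #-}

-- Let f_d(i) be the number of walks of length d between vertices u, v with |u ∩ v| = i; it satisfies a linear
-- recursion in d, and hom(C_t) = N f_t(r). For X proportional to n, one step maps X^|u ∩ v| to at most
-- N₁ (2 + (q-1) X^|u ∩ v|)/q with q = 2r - 1, because a kept s-subset contains a given element with probability s/r < 1 and new
-- elements are rarely useful. Iterating, f_d(r) = O(N₁^d (1/N + ((q-1)/q)^d / N₁)); conversely f_d(i) ≥ c N₁^d / N for d ≥ s + 2.
--
-- If t = o(min(√N, N₁)): hom - mono is at most the sum over pairs of positions of N f_d(r) f_{t-d}(r). For t of order at least √n
-- the walk is mixed and the two bounds on f turn this into O(t²/N + t/N₁) hom; for shorter t it is enough that
-- f_d(r) f_{t-d}(r) = O(f_t(r)/n), which follows by replacing the visited vertex by any of its neighbours.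
--
-- Conversely, closing up a free walk with s + 2 further steps costs only a factor c/N, so it suffices that a free walk of
-- length about t meets itself with probability bounded below. A self-avoiding walk must not step back, which costs a factor
-- 1 - 1/N₁ per step, and s + 2 steps hit each of the vertices visited before with probability at least c/N, which costs a
-- factor 1 - c ℓ/N per s + 2 steps after time ℓ. Neither product stays close to 1 when t ≥ N₁/k or t ≥ √N/k.

module Submission where

open import Defs
open import Data.Nat hiding (_/_; _%_)
open import Data.Nat.Properties
open import Data.Nat.DivMod using (_/_; _%_; m/n*n≤m; m%n<n; m≡m%n+[m/n]*n)
open import Data.Nat.Combinatorics using (_C_; nCk≡nC[n∸k]; nCn≡1; nC1≡n; nCk+nC[k+1]≡[n+1]C[k+1])
open import Data.Nat.Tactic.RingSolver using (solve-∀)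
open import Data.Bool using (if_then_else_; true; false)
open import Data.Bool.Properties using () renaming (_≟_ to _≟B_)
open import Data.Fin using (Fin; zero; suc; toℕ)
open import Data.Fin.Properties using () renaming (suc-injective to sucF-injective)
open import Data.Fin.Subset using (Subset; _∩_; ∁; ∣_∣)
open import Data.List using (List; []; _∷_; map; concatMap; filter; length) renaming (_++_ to _++ᴸ_)
open import Data.List.Membership.Propositional using (_∈_)
open import Data.List.Membership.Propositional.Properties using (∈-filter⁻)
open import Data.List.Relation.Unary.Any using (here; there)
open import Data.Vec using (Vec; []; _∷_; _++_; lookup)
open import Data.Vec.Relation.Unary.All using (All; []; _∷_)
import Data.Vec.Properties as VecP
open import Data.Product using (_×_; _,_; proj₁; proj₂; ∃)
open import Data.Sum using (_⊎_; inj₁; inj₂)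
open import Data.Empty using (⊥; ⊥-elim)
open import Function using (_∘_)
open import Function.Bundles using (_⇔_; mk⇔)
open import Relation.Nullary using (Dec; yes; no; ¬_; does; contradiction)
open import Relation.Nullary.Decidable using (_×-dec_; decidable-stable)
open import Relation.Binary.PropositionalEquality hiding (J)

-- In units of N₁^t, the upper bound on return counts has a stationary term of order 1/N and a
-- transient one, whereas the lower bound is only of order 1/N. For short cycles the transient term
-- may dominate, so these two bounds say too little; this is why a second argument compares products
-- of return counts with each other and not with powers of N₁. As t is arbitrary and may oscillate,
-- the choice between the arguments is made for each n separately, by comparing n with a multiple of
-- t². If n is at most that multiple, N ≤ n^r is bounded by a polynomial in t, which the geometric
-- factor eventually beats. In the converse direction, failure of either condition already forces n
-- to be at most a multiple of t², so that only the mixed case occurs. X is proportional to n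
-- because X^s N₁ then has the order of N. All estimates are stated in ℕ with denominators cleared,
-- and their constants depend on s and e but not on g, so that they are uniform in n.

⟦_⟧ : {P : Set} → Dec P → ℕ
⟦ d ⟧ = if does d then 1 else 0

⟦⟧-yes : {P : Set} (d : Dec P) → P → ⟦ d ⟧ ≡ 1
⟦⟧-yes (yes _) _ = refl
⟦⟧-yes (no ¬p) p = contradiction p ¬p

⟦⟧-no : {P : Set} (d : Dec P) → ¬ P → ⟦ d ⟧ ≡ 0
⟦⟧-no (yes p) ¬p = contradiction p ¬p
⟦⟧-no (no _) _ = refl

⟦⟧-iff : {P Q : Set} (d : Dec P) (e : Dec Q) → (P → Q) → (Q → P) → ⟦ d ⟧ ≡ ⟦ e ⟧
⟦⟧-iff (yes p) e f _ = sym (⟦⟧-yes e (f p))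
⟦⟧-iff (no ¬p) e _ g = sym (⟦⟧-no e (¬p ∘ g))

⟦⟧-bit : {P : Set} (d : Dec P) → ⟦ d ⟧ ≡ 0 ⊎ (⟦ d ⟧ ≡ 1 × P)
⟦⟧-bit (yes p) = inj₂ (refl , p)
⟦⟧-bit (no _) = inj₁ refl

δ : ℕ → ℕ → ℕ
δ m n = ⟦ m ≟ n ⟧

δ-suc : ∀ m n → δ (suc m) (suc n) ≡ δ m n
δ-suc m n = ⟦⟧-iff (suc m ≟ suc n) (m ≟ n) suc-injective (cong suc)

-- Finite sums over lists, ranges and binomial weights.

∑ : {A : Set} → List A → (A → ℕ) → ℕ
∑ [] F = 0
∑ (x ∷ xs) F = F x + ∑ xs F

module _ {A : Set} where

  ∑-cong : ∀ (xs : List A) {F G : A → ℕ} → (∀ {x} → x ∈ xs → F x ≡ G x) → ∑ xs F ≡ ∑ xs G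
  ∑-cong [] h = refl
  ∑-cong (x ∷ xs) h = cong₂ _+_ (h (here refl)) (∑-cong xs (h ∘ there))

  ∑-ext : ∀ (xs : List A) {F G : A → ℕ} → (∀ x → F x ≡ G x) → ∑ xs F ≡ ∑ xs G
  ∑-ext xs h = ∑-cong xs (λ {x} _ → h x)

  ∑-mono : ∀ (xs : List A) {F G : A → ℕ} → (∀ {x} → x ∈ xs → F x ≤ G x) → ∑ xs F ≤ ∑ xs G
  ∑-mono [] h = z≤n
  ∑-mono (x ∷ xs) h = +-mono-≤ (h (here refl)) (∑-mono xs (h ∘ there))

  ∑-+ : ∀ (xs : List A) (F G : A → ℕ) → ∑ xs (λ x → F x + G x) ≡ ∑ xs F + ∑ xs G
  ∑-+ [] F G = refl
  ∑-+ (x ∷ xs) F G = trans (cong (F x + G x +_) (∑-+ xs F G)) (e (F x) (G x) (∑ xs F) (∑ xs G))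
    where e : ∀ a b c d → a + b + (c + d) ≡ a + c + (b + d)
          e = solve-∀

  ∑-*ˡ : ∀ (xs : List A) c (F : A → ℕ) → ∑ xs (λ x → c * F x) ≡ c * ∑ xs F
  ∑-*ˡ [] c F = sym (*-zeroʳ c)
  ∑-*ˡ (x ∷ xs) c F = trans (cong (c * F x +_) (∑-*ˡ xs c F)) (sym (*-distribˡ-+ c (F x) _))

  ∑-*ʳ : ∀ (xs : List A) c (F : A → ℕ) → ∑ xs (λ x → F x * c) ≡ ∑ xs F * c
  ∑-*ʳ xs c F = trans (∑-ext xs (λ x → *-comm (F x) c)) (trans (∑-*ˡ xs c F) (*-comm c _))

  ∑-const : ∀ (xs : List A) c → ∑ xs (λ _ → c) ≡ length xs * c
  ∑-const [] c = refl
  ∑-const (x ∷ xs) c = cong (c +_) (∑-const xs c)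

  ∑-0 : ∀ (xs : List A) → ∑ xs (λ _ → 0) ≡ 0
  ∑-0 xs = trans (∑-const xs 0) (*-zeroʳ (length xs))

  ∑-++ : ∀ (xs ys : List A) (F : A → ℕ) → ∑ (xs ++ᴸ ys) F ≡ ∑ xs F + ∑ ys F
  ∑-++ [] ys F = refl
  ∑-++ (x ∷ xs) ys F = trans (cong (F x +_) (∑-++ xs ys F)) (sym (+-assoc (F x) _ _))

  ∑-filter : ∀ {P : A → Set} (P? : ∀ x → Dec (P x)) (xs : List A) (F : A → ℕ) →
    ∑ (filter P? xs) F ≡ ∑ xs (λ x → ⟦ P? x ⟧ * F x)
  ∑-filter P? [] F = refl
  ∑-filter P? (x ∷ xs) F with does (P? x)
  ... | true = cong₂ _+_ (sym (+-identityʳ (F x))) (∑-filter P? xs F)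
  ... | false = ∑-filter P? xs F

  length-filter-∑ : ∀ {P : A → Set} (P? : ∀ x → Dec (P x)) (xs : List A) →
    length (filter P? xs) ≡ ∑ xs (λ x → ⟦ P? x ⟧)
  length-filter-∑ P? [] = refl
  length-filter-∑ P? (x ∷ xs) with does (P? x)
  ... | true = cong suc (length-filter-∑ P? xs)
  ... | false = length-filter-∑ P? xs

∑-map : ∀ {A B : Set} (f : A → B) (xs : List A) (F : B → ℕ) → ∑ (map f xs) F ≡ ∑ xs (F ∘ f)
∑-map f [] F = refl
∑-map f (x ∷ xs) F = cong (F (f x) +_) (∑-map f xs F)

∑-concatMap : ∀ {A B : Set} (f : A → List B) (xs : List A) (F : B → ℕ) →
  ∑ (concatMap f xs) F ≡ ∑ xs (λ x → ∑ (f x) F)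
∑-concatMap f [] F = refl
∑-concatMap f (x ∷ xs) F =
  trans (∑-++ (f x) (concatMap f xs) F) (cong (∑ (f x) F +_) (∑-concatMap f xs F))

∑-swap : ∀ {A B : Set} (xs : List A) (ys : List B) (F : A → B → ℕ) →
  ∑ xs (λ x → ∑ ys (F x)) ≡ ∑ ys (λ y → ∑ xs (λ x → F x y))
∑-swap [] ys F = sym (∑-0 ys)
∑-swap (x ∷ xs) ys F =
  trans (cong (∑ ys (F x) +_) (∑-swap xs ys F)) (sym (∑-+ ys (F x) (λ y → ∑ xs (λ x → F x y))))

∑< : ℕ → (ℕ → ℕ) → ℕ
∑< zero F = 0
∑< (suc n) F = F 0 + ∑< n (F ∘ suc)

∑<-cong : ∀ n {F G : ℕ → ℕ} → (∀ i → i < n → F i ≡ G i) → ∑< n F ≡ ∑< n G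
∑<-cong zero h = refl
∑<-cong (suc n) h = cong₂ _+_ (h 0 (s≤s z≤n)) (∑<-cong n (λ i i<n → h (suc i) (s≤s i<n)))

∑<-mono : ∀ n {F G : ℕ → ℕ} → (∀ i → i < n → F i ≤ G i) → ∑< n F ≤ ∑< n G
∑<-mono zero h = z≤n
∑<-mono (suc n) h = +-mono-≤ (h 0 (s≤s z≤n)) (∑<-mono n (λ i i<n → h (suc i) (s≤s i<n)))

∑<-+ : ∀ n (F G : ℕ → ℕ) → ∑< n (λ i → F i + G i) ≡ ∑< n F + ∑< n G
∑<-+ zero F G = refl
∑<-+ (suc n) F G = trans (cong (F 0 + G 0 +_) (∑<-+ n (F ∘ suc) (G ∘ suc))) (e (F 0) (G 0) _ _)
  where e : ∀ a b c d → a + b + (c + d) ≡ a + c + (b + d)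
        e = solve-∀

∑<-*ˡ : ∀ n c (F : ℕ → ℕ) → ∑< n (λ i → c * F i) ≡ c * ∑< n F
∑<-*ˡ zero c F = sym (*-zeroʳ c)
∑<-*ˡ (suc n) c F = trans (cong (c * F 0 +_) (∑<-*ˡ n c (F ∘ suc))) (sym (*-distribˡ-+ c (F 0) _))

∑<-const : ∀ n c → ∑< n (λ _ → c) ≡ n * c
∑<-const zero c = refl
∑<-const (suc n) c = cong (c +_) (∑<-const n c)

∑<-last : ∀ n (F : ℕ → ℕ) → ∑< (suc n) F ≡ ∑< n F + F n
∑<-last zero F = +-identityʳ (F 0)
∑<-last (suc n) F = trans (cong (F 0 +_) (∑<-last n (F ∘ suc))) (sym (+-assoc (F 0) _ _))

∑<-reverse : ∀ n (F : ℕ → ℕ) → ∑< n (λ i → F (n ∸ suc i)) ≡ ∑< n F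
∑<-reverse zero F = refl
∑<-reverse (suc n) F = trans (cong (F n +_) (∑<-reverse n F)) (trans (+-comm (F n) _) (sym (∑<-last n F)))

∑<-∑-swap : ∀ {A : Set} n (xs : List A) (F : ℕ → A → ℕ) →
  ∑ xs (λ x → ∑< n (λ i → F i x)) ≡ ∑< n (λ i → ∑ xs (F i))
∑<-∑-swap zero xs F = ∑-0 xs
∑<-∑-swap (suc n) xs F = trans (∑-+ xs (F 0) _) (cong (∑ xs (F 0) +_) (∑<-∑-swap n xs (F ∘ suc)))

-- ∑C p h = Σ_a C(p,a) h(a): the sum of h(|w|) over the subsets w of a p-element set.
∑C : ℕ → (ℕ → ℕ) → ℕ
∑C zero h = h 0
∑C (suc p) h = ∑C p h + ∑C p (h ∘ suc)

∑C-cong : ∀ p {h k : ℕ → ℕ} → (∀ a → a ≤ p → h a ≡ k a) → ∑C p h ≡ ∑C p k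
∑C-cong zero e = e 0 z≤n
∑C-cong (suc p) e =
  cong₂ _+_ (∑C-cong p (λ a a≤p → e a (m≤n⇒m≤1+n a≤p))) (∑C-cong p (λ a a≤p → e (suc a) (s≤s a≤p)))

∑C-ext : ∀ p {h k : ℕ → ℕ} → (∀ a → h a ≡ k a) → ∑C p h ≡ ∑C p k
∑C-ext p e = ∑C-cong p (λ a _ → e a)

∑C-mono : ∀ p {h k : ℕ → ℕ} → (∀ a → a ≤ p → h a ≤ k a) → ∑C p h ≤ ∑C p k
∑C-mono zero e = e 0 z≤n
∑C-mono (suc p) e =
  +-mono-≤ (∑C-mono p (λ a a≤p → e a (m≤n⇒m≤1+n a≤p))) (∑C-mono p (λ a a≤p → e (suc a) (s≤s a≤p)))

∑C-+ : ∀ p (h k : ℕ → ℕ) → ∑C p (λ a → h a + k a) ≡ ∑C p h + ∑C p k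
∑C-+ zero h k = refl
∑C-+ (suc p) h k = trans (cong₂ _+_ (∑C-+ p h k) (∑C-+ p (h ∘ suc) (k ∘ suc)))
    (e (∑C p h) (∑C p k) (∑C p (h ∘ suc)) (∑C p (k ∘ suc)))
  where e : ∀ a b c d → a + b + (c + d) ≡ a + c + (b + d)
        e = solve-∀

∑C-*ˡ : ∀ p c (h : ℕ → ℕ) → ∑C p (λ a → c * h a) ≡ c * ∑C p h
∑C-*ˡ zero c h = refl
∑C-*ˡ (suc p) c h =
  trans (cong₂ _+_ (∑C-*ˡ p c h) (∑C-*ˡ p c (h ∘ suc))) (sym (*-distribˡ-+ c (∑C p h) _))

∑C-*ʳ : ∀ p c (h : ℕ → ℕ) → ∑C p (λ a → h a * c) ≡ ∑C p h * c
∑C-*ʳ p c h = trans (∑C-ext p (λ a → *-comm (h a) c)) (trans (∑C-*ˡ p c h) (*-comm c _))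

∑C-∑C : ∀ p q (h : ℕ → ℕ) → ∑C p (λ a → ∑C q (λ b → h (a + b))) ≡ ∑C (p + q) h
∑C-∑C zero q h = refl
∑C-∑C (suc p) q h = cong₂ _+_ (∑C-∑C p q h) (∑C-∑C p q (h ∘ suc))

nC0≡1 : ∀ n → n C 0 ≡ 1
nC0≡1 n = trans (nCk≡nC[n∸k] {0} {n} z≤n) (nCn≡1 n)

∑C-0 : ∀ p → ∑C p (λ _ → 0) ≡ 0
∑C-0 zero = refl
∑C-0 (suc p) = cong₂ _+_ (∑C-0 p) (∑C-0 p)

∑C-δ : ∀ p k → ∑C p (λ a → δ a k) ≡ p C k
∑C-δ zero zero = refl
∑C-δ zero (suc k) = refl
∑C-δ (suc p) zero = trans (cong₂ _+_ (∑C-δ p zero) (∑C-0 p))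
  (trans (+-identityʳ _) (trans (nC0≡1 p) (sym (nC0≡1 (suc p)))))
∑C-δ (suc p) (suc k) = begin
  ∑C p (λ a → δ a (suc k)) + ∑C p (λ a → δ (suc a) (suc k))
    ≡⟨ cong₂ _+_ (∑C-δ p (suc k)) (trans (∑C-ext p (λ a → δ-suc a k)) (∑C-δ p k)) ⟩
  p C suc k + p C k ≡⟨ +-comm (p C suc k) _ ⟩
  p C k + p C suc k ≡⟨ nCk+nC[k+1]≡[n+1]C[k+1] p k ⟩
  suc p C suc k ∎
  where open ≡-Reasoning

∑C-δ+ : ∀ p q k → ∑C p (λ a → ∑C q (λ b → δ (a + b) k)) ≡ (p + q) C k
∑C-δ+ p q k = trans (∑C-∑C p q (λ a → δ a k)) (∑C-δ (p + q) k)

δ-* : ∀ a k (h : ℕ → ℕ) → δ a k * h k ≤ h a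
δ-* a k h with ⟦⟧-bit (a ≟ k)
... | inj₁ e rewrite e = z≤n
... | inj₂ (e , refl) rewrite e = ≤-reflexive (+-identityʳ (h a))

∑C-≥ : ∀ p k (h : ℕ → ℕ) → k ≤ p → h k ≤ ∑C p h
∑C-≥ zero .zero h z≤n = ≤-refl
∑C-≥ (suc p) zero h _ = ≤-trans (∑C-≥ p 0 h z≤n) (m≤m+n _ _)
∑C-≥ (suc p) (suc k) h (s≤s k≤p) = ≤-trans (∑C-≥ p k (h ∘ suc) k≤p) (m≤n+m _ _)

-- Sums over the subsets of a finite set.

∑-allSubsets-suc : ∀ n (G : Subset (suc n) → ℕ) →
  ∑ (allSubsets (suc n)) G ≡ ∑ (allSubsets n) (λ w → G (false ∷ w)) + ∑ (allSubsets n) (λ w → G (true ∷ w))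
∑-allSubsets-suc n G = begin
  ∑ (allSubsets (suc n)) G
    ≡⟨ ∑-concatMap (λ x → (true ∷ x) ∷ (false ∷ x) ∷ []) (allSubsets n) G ⟩
  ∑ (allSubsets n) (λ w → G (true ∷ w) + (G (false ∷ w) + 0))
    ≡⟨ ∑-ext (allSubsets n) (λ w → trans (cong (G (true ∷ w) +_) (+-identityʳ _)) (+-comm (G (true ∷ w)) _)) ⟩
  ∑ (allSubsets n) (λ w → G (false ∷ w) + G (true ∷ w))
    ≡⟨ ∑-+ (allSubsets n) _ _ ⟩
  ∑ (allSubsets n) (λ w → G (false ∷ w)) + ∑ (allSubsets n) (λ w → G (true ∷ w)) ∎
  where open ≡-Reasoning

-- Each coordinate lies in exactly one of the four regions cut out by u and v, and taking it or
-- leaving it is one step of the recursion of `∑C` for that region. `K` is arbitrary so that a taken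
-- coordinate can be absorbed as a shift of its arguments.
∑-allSubsets : ∀ n (u v : Subset n) (K : ℕ → ℕ → ℕ → ℕ) →
  ∑ (allSubsets n) (λ w → K (∣ w ∣) (∣ u ∩ w ∣) (∣ w ∩ v ∣)) ≡
  ∑C (∣ u ∩ v ∣) (λ a → ∑C (∣ u ∩ ∁ v ∣) (λ b → ∑C (∣ ∁ u ∩ v ∣) (λ c → ∑C (∣ ∁ u ∩ ∁ v ∣) (λ e →
    K (a + b + c + e) (a + b) (a + c)))))
∑-allSubsets zero [] [] K = +-identityʳ _
∑-allSubsets (suc n) (true ∷ u) (true ∷ v) K = trans (∑-allSubsets-suc n _)
  (cong₂ _+_ (∑-allSubsets n u v K) (∑-allSubsets n u v (λ x y z → K (suc x) (suc y) (suc z))))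
∑-allSubsets (suc n) (true ∷ u) (false ∷ v) K = trans (∑-allSubsets-suc n _)
  (trans (cong₂ _+_ (∑-allSubsets n u v K) (trans (∑-allSubsets n u v (λ x y z → K (suc x) (suc y) z))
      (∑C-ext (∣ u ∩ v ∣) (λ a → ∑C-ext (∣ u ∩ ∁ v ∣) (λ b → ∑C-ext (∣ ∁ u ∩ v ∣) (λ c → ∑C-ext (∣ ∁ u ∩ ∁ v ∣) (λ e →
        cong (λ z → K (z + c + e) z (a + c)) (sym (+-suc a b)))))))))
    (sym (∑C-+ (∣ u ∩ v ∣) _ _)))
∑-allSubsets (suc n) (false ∷ u) (true ∷ v) K = trans (∑-allSubsets-suc n _)
  (trans (cong₂ _+_ (∑-allSubsets n u v K) (trans (∑-allSubsets n u v (λ x y z → K (suc x) y (suc z)))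
      (∑C-ext (∣ u ∩ v ∣) (λ a → ∑C-ext (∣ u ∩ ∁ v ∣) (λ b → ∑C-ext (∣ ∁ u ∩ v ∣) (λ c → ∑C-ext (∣ ∁ u ∩ ∁ v ∣) (λ e →
        cong₂ (λ y z → K (y + e) (a + b) z) (sym (+-suc (a + b) c)) (sym (+-suc a c)))))))))
    (sym (trans (∑C-ext (∣ u ∩ v ∣) (λ a → ∑C-+ (∣ u ∩ ∁ v ∣) _ _)) (∑C-+ (∣ u ∩ v ∣) _ _))))
∑-allSubsets (suc n) (false ∷ u) (false ∷ v) K = trans (∑-allSubsets-suc n _)
  (trans (cong₂ _+_ (∑-allSubsets n u v K) (trans (∑-allSubsets n u v (λ x y z → K (suc x) y z))
      (∑C-ext (∣ u ∩ v ∣) (λ a → ∑C-ext (∣ u ∩ ∁ v ∣) (λ b → ∑C-ext (∣ ∁ u ∩ v ∣) (λ c → ∑C-ext (∣ ∁ u ∩ ∁ v ∣) (λ e →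
        cong (λ y → K y (a + b) (a + c)) (sym (+-suc (a + b + c) e)))))))))
    (sym (trans (∑C-ext (∣ u ∩ v ∣) (λ a → trans (∑C-ext (∣ u ∩ ∁ v ∣) (λ b → ∑C-+ (∣ ∁ u ∩ v ∣) _ _)) (∑C-+ (∣ u ∩ ∁ v ∣) _ _)))
      (∑C-+ (∣ u ∩ v ∣) _ _))))

∣u∩v∣+∣u∩∁v∣ : ∀ {n} (u v : Subset n) → ∣ u ∩ v ∣ + ∣ u ∩ ∁ v ∣ ≡ ∣ u ∣
∣u∩v∣+∣u∩∁v∣ [] [] = refl
∣u∩v∣+∣u∩∁v∣ (true ∷ u) (true ∷ v) = cong suc (∣u∩v∣+∣u∩∁v∣ u v)
∣u∩v∣+∣u∩∁v∣ (true ∷ u) (false ∷ v) = trans (+-suc _ _) (cong suc (∣u∩v∣+∣u∩∁v∣ u v))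
∣u∩v∣+∣u∩∁v∣ (false ∷ u) (true ∷ v) = ∣u∩v∣+∣u∩∁v∣ u v
∣u∩v∣+∣u∩∁v∣ (false ∷ u) (false ∷ v) = ∣u∩v∣+∣u∩∁v∣ u v

∩-comm-card : ∀ {n} (u v : Subset n) → ∣ u ∩ v ∣ ≡ ∣ v ∩ u ∣
∩-comm-card [] [] = refl
∩-comm-card (true ∷ u) (true ∷ v) = cong suc (∩-comm-card u v)
∩-comm-card (true ∷ u) (false ∷ v) = ∩-comm-card u v
∩-comm-card (false ∷ u) (true ∷ v) = ∩-comm-card u v
∩-comm-card (false ∷ u) (false ∷ v) = ∩-comm-card u v

∣u∣+∣∁u∣ : ∀ {n} (u : Subset n) → ∣ u ∣ + ∣ ∁ u ∣ ≡ n
∣u∣+∣∁u∣ [] = refl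
∣u∣+∣∁u∣ (true ∷ u) = cong suc (∣u∣+∣∁u∣ u)
∣u∣+∣∁u∣ (false ∷ u) = trans (+-suc _ _) (cong suc (∣u∣+∣∁u∣ u))

∩-idem-card : ∀ {n} (u : Subset n) → ∣ u ∩ u ∣ ≡ ∣ u ∣
∩-idem-card [] = refl
∩-idem-card (true ∷ u) = cong suc (∩-idem-card u)
∩-idem-card (false ∷ u) = ∩-idem-card u

_≟ₛ_ : ∀ {n} (x y : Subset n) → Dec (x ≡ y)
_≟ₛ_ = VecP.≡-dec _≟B_

∑-pick-allSubsets : ∀ {n} (u : Subset n) (G : Subset n → ℕ) → ∑ (allSubsets n) (λ w → ⟦ u ≟ₛ w ⟧ * G w) ≡ G u
∑-pick-allSubsets [] G = trans (+-identityʳ _) (+-identityʳ _)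
∑-pick-allSubsets {suc n} (b ∷ u) G = trans (∑-allSubsets-suc n _) (go b)
  where
  same : ∀ b w → ⟦ (b ∷ u) ≟ₛ (b ∷ w) ⟧ ≡ ⟦ u ≟ₛ w ⟧
  same b w = ⟦⟧-iff ((b ∷ u) ≟ₛ (b ∷ w)) (u ≟ₛ w) VecP.∷-injectiveʳ (cong (b ∷_))
  hit : ∀ b → ∑ (allSubsets n) (λ w → ⟦ (b ∷ u) ≟ₛ (b ∷ w) ⟧ * G (b ∷ w)) ≡ G (b ∷ u)
  hit b = trans (∑-ext (allSubsets n) (λ w → cong (_* G (b ∷ w)) (same b w)))
                (∑-pick-allSubsets u (λ w → G (b ∷ w)))
  miss : ∀ b c → b ≢ c → ∑ (allSubsets n) (λ w → ⟦ (b ∷ u) ≟ₛ (c ∷ w) ⟧ * G (c ∷ w)) ≡ 0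
  miss b c b≢c = trans (∑-ext (allSubsets n) (λ w →
    cong (_* G (c ∷ w)) (⟦⟧-no ((b ∷ u) ≟ₛ (c ∷ w)) (b≢c ∘ VecP.∷-injectiveˡ)))) (∑-0 (allSubsets n))
  go : ∀ b → ∑ (allSubsets n) (λ w → ⟦ (b ∷ u) ≟ₛ (false ∷ w) ⟧ * G (false ∷ w))
           + ∑ (allSubsets n) (λ w → ⟦ (b ∷ u) ≟ₛ (true ∷ w) ⟧ * G (true ∷ w)) ≡ G (b ∷ u)
  go true = cong₂ _+_ (miss true false (λ ())) (hit true)
  go false = trans (cong₂ _+_ (hit false) (miss false true (λ ()))) (+-identityʳ _)

-- el X p q k is the k-th elementary symmetric polynomial of p copies of X and q copies of 1.
el : ℕ → ℕ → ℕ → ℕ → ℕ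
el X p q k = ∑C p (λ a → ∑C q (λ b → δ (a + b) k * X ^ a))

∑-allVecs-suc : ∀ {A : Set} (V : List A) t (F : Vec A (suc t) → ℕ) →
  ∑ (allVecs V (suc t)) F ≡ ∑ V (λ x → ∑ (allVecs V t) (λ φ → F (x ∷ φ)))
∑-allVecs-suc V t F = trans (∑-concatMap (λ x → map (x ∷_) (allVecs V t)) V F)
  (∑-ext V (λ x → ∑-map (x ∷_) (allVecs V t) F))

∑-allVecs-++ : ∀ {A : Set} (V : List A) m k (F : Vec A (m + k) → ℕ) →
  ∑ (allVecs V (m + k)) F ≡ ∑ (allVecs V m) (λ φ → ∑ (allVecs V k) (λ ψ → F (φ ++ ψ)))
∑-allVecs-++ V zero k F = sym (+-identityʳ _)
∑-allVecs-++ V (suc m) k F = trans (∑-allVecs-suc V (m + k) F)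
  (trans (∑-ext V (λ x → ∑-allVecs-++ V m k (λ φ → F (x ∷ φ)))) (sym (∑-allVecs-suc V m _)))

∑-allVecs-mono : ∀ {A : Set} (V : List A) t {F G : Vec A t → ℕ} →
  (∀ φ → All (_∈ V) φ → F φ ≤ G φ) → ∑ (allVecs V t) F ≤ ∑ (allVecs V t) G
∑-allVecs-mono V zero h = +-monoˡ-≤ 0 (h [] [])
∑-allVecs-mono V (suc t) {F} {G} h = subst₂ _≤_ (sym (∑-allVecs-suc V t F)) (sym (∑-allVecs-suc V t G))
  (∑-mono V (λ {x} x∈ → ∑-allVecs-mono V t (λ φ φ∈ → h (x ∷ φ) (x∈ ∷ φ∈))))

-- Walks, coincidences and self-avoidance in a regular graph.

module Walks {A : Set} (_≟A_ : (x y : A) → Dec (x ≡ y)) (V : List A) (a : A → A → ℕ) (D : ℕ)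
  (a-bit : ∀ x y → a x y ≡ 0 ⊎ a x y ≡ 1)
  (a-sym : ∀ x y → a x y ≡ a y x)
  (degree : ∀ {x} → x ∈ V → ∑ V (a x) ≡ D)
  (pick : ∀ {y} → y ∈ V → (G : A → ℕ) → ∑ V (λ w → ⟦ y ≟A w ⟧ * G w) ≡ G y) where

  eq : A → A → ℕ
  eq x y = ⟦ x ≟A y ⟧

  eq-sym : ∀ x y → eq x y ≡ eq y x
  eq-sym x y = ⟦⟧-iff (x ≟A y) (y ≟A x) sym sym

  -- ch x φ z and path x φ are 1 if x, φ, z respectively x, φ is a walk and 0 otherwise; nd φ is 1 if the entries of φ are
  -- distinct, ni x φ is 1 if x is not an entry of φ, and coin φ is the number of pairs of equal entries.
  ch : ∀ {t} → A → Vec A t → A → ℕ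
  ch x [] z = a x z
  ch x (y ∷ φ) z = a x y * ch y φ z

  path : ∀ {t} → A → Vec A t → ℕ
  path x [] = 1
  path x (y ∷ φ) = a x y * path y φ

  final : ∀ {t} → A → Vec A t → A
  final x [] = x
  final x (y ∷ φ) = final y φ

  -- wlk d counts the walks with d + 1 edges.
  wlk : ℕ → A → A → ℕ
  wlk zero x z = a x z
  wlk (suc d) x z = ∑ V (λ y → a x y * wlk d y z)

  cnt : ∀ {t} → A → Vec A t → ℕ
  cnt x [] = 0
  cnt x (y ∷ φ) = eq x y + cnt x φ

  coin : ∀ {t} → Vec A t → ℕ
  coin [] = 0
  coin (x ∷ φ) = cnt x φ + coin φ

  ni : ∀ {t} → A → Vec A t → ℕ
  ni x [] = 1
  ni x (y ∷ φ) = (1 ∸ eq x y) * ni x φ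

  nd : ∀ {t} → Vec A t → ℕ
  nd [] = 1
  nd (x ∷ φ) = ni x φ * nd φ

  IsBit : ℕ → Set
  IsBit b = b ≡ 0 ⊎ b ≡ 1

  *-bit : ∀ {b c} → IsBit b → IsBit c → IsBit (b * c)
  *-bit (inj₁ refl) _ = inj₁ refl
  *-bit {c = c} (inj₂ refl) (inj₁ refl) = inj₁ refl
  *-bit (inj₂ refl) (inj₂ refl) = inj₂ refl

  ne-bit : ∀ x y → IsBit (1 ∸ eq x y)
  ne-bit x y with ⟦⟧-bit (x ≟A y)
  ... | inj₁ p rewrite p = inj₂ refl
  ... | inj₂ (p , _) rewrite p = inj₁ refl

  ni-bit : ∀ {t} x (φ : Vec A t) → IsBit (ni x φ)
  ni-bit x [] = inj₂ refl
  ni-bit x (y ∷ φ) = *-bit (ne-bit x y) (ni-bit x φ)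

  nd-bit : ∀ {t} (φ : Vec A t) → IsBit (nd φ)
  nd-bit [] = inj₂ refl
  nd-bit (x ∷ φ) = *-bit (ni-bit x φ) (nd-bit φ)

  bit≤1 : ∀ {b} → IsBit b → b ≤ 1
  bit≤1 (inj₁ refl) = z≤n
  bit≤1 (inj₂ refl) = ≤-refl

  bit*≤ : ∀ {b} c → IsBit b → b * c ≤ c
  bit*≤ c (inj₁ refl) = z≤n
  bit*≤ c (inj₂ refl) = ≤-reflexive (*-identityˡ c)

  ne+eq : ∀ x y → (1 ∸ eq x y) + eq x y ≡ 1
  ne+eq x y with ⟦⟧-bit (x ≟A y)
  ... | inj₁ p rewrite p = refl
  ... | inj₂ (p , _) rewrite p = refl

  1≤ni+cnt : ∀ {t} x (φ : Vec A t) → 1 ≤ ni x φ + cnt x φ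
  1≤ni+cnt x [] = ≤-refl
  1≤ni+cnt x (y ∷ φ) with ⟦⟧-bit (x ≟A y)
  ... | inj₁ p rewrite p = ≤-trans (1≤ni+cnt x φ) (≤-reflexive (cong (_+ cnt x φ) (sym (*-identityˡ (ni x φ)))))
  ... | inj₂ (p , _) rewrite p = s≤s z≤n

  1≤nd+coin : ∀ {t} (φ : Vec A t) → 1 ≤ nd φ + coin φ
  1≤nd+coin [] = ≤-refl
  1≤nd+coin (x ∷ φ) with ni-bit x φ
  ... | inj₂ p rewrite p = ≤-trans (1≤nd+coin φ) (+-mono-≤ (≤-reflexive (sym (*-identityˡ (nd φ)))) (m≤n+m (coin φ) (cnt x φ)))
  ... | inj₁ p with 1≤ni+cnt x φ
  ...   | q rewrite p = ≤-trans q (m≤m+n _ _)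

  ni-++ : ∀ {m k} x (φ : Vec A m) (ψ : Vec A k) → ni x (φ ++ ψ) ≡ ni x φ * ni x ψ
  ni-++ x [] ψ = sym (*-identityˡ _)
  ni-++ x (y ∷ φ) ψ = trans (cong ((1 ∸ eq x y) *_) (ni-++ x φ ψ)) (sym (*-assoc (1 ∸ eq x y) _ _))

  nd-++ˡ : ∀ {m k} (φ : Vec A m) (ψ : Vec A k) → nd (φ ++ ψ) ≤ nd φ
  nd-++ˡ [] ψ = bit≤1 (nd-bit ψ)
  nd-++ˡ (x ∷ φ) ψ = *-mono-≤ (≤-trans (≤-reflexive (trans (ni-++ x φ ψ) (*-comm (ni x φ) _))) (bit*≤ (ni x φ) (ni-bit x ψ))) (nd-++ˡ φ ψ)

  nd-++ʳ : ∀ {m k} (φ : Vec A m) (ψ : Vec A k) → nd (φ ++ ψ) ≤ nd ψ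
  nd-++ʳ [] ψ = ≤-refl
  nd-++ʳ (x ∷ φ) ψ = ≤-trans (bit*≤ _ (ni-bit x (φ ++ ψ))) (nd-++ʳ φ ψ)

  ch-++ : ∀ {m k} x (φ : Vec A m) (ψ : Vec A k) z → ch x (φ ++ ψ) z ≡ path x φ * ch (final x φ) ψ z
  ch-++ x [] ψ z = sym (*-identityˡ _)
  ch-++ x (y ∷ φ) ψ z = trans (cong (a x y *_) (ch-++ y φ ψ z)) (sym (*-assoc (a x y) _ _))

  path-++ : ∀ {m k} x (φ : Vec A m) y (ψ : Vec A k) → path x (φ ++ y ∷ ψ) ≡ ch x φ y * path y ψ
  path-++ x [] y ψ = refl
  path-++ x (w ∷ φ) y ψ = trans (cong (a x w *_) (path-++ w φ y ψ)) (sym (*-assoc (a x w) _ _))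

  final-∈ : ∀ {t x} {φ : Vec A t} → x ∈ V → All (_∈ V) φ → final x φ ∈ V
  final-∈ x∈ [] = x∈
  final-∈ x∈ (y∈ ∷ φ∈) = final-∈ y∈ φ∈

  ∑ch : ∀ d x z → ∑ (allVecs V d) (λ φ → ch x φ z) ≡ wlk d x z
  ∑ch zero x z = +-identityʳ _
  ∑ch (suc d) x z = trans (∑-allVecs-suc V d _) (∑-ext V (λ y → trans (∑-*ˡ (allVecs V d) (a x y) _) (cong (a x y *_) (∑ch d y z))))

  ∑path : ∀ d {x} → x ∈ V → ∑ (allVecs V d) (path x) ≡ D ^ d
  ∑path zero x∈ = refl
  ∑path (suc d) {x} x∈ = trans (∑-allVecs-suc V d _)
    (trans (∑-cong V (λ {y} y∈ → trans (∑-*ˡ (allVecs V d) (a x y) _) (cong (a x y *_) (∑path d y∈))))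
    (trans (∑-*ʳ V (D ^ d) (a x)) (cong (_* D ^ d) (degree x∈))))

  degreeʳ : ∀ {z} → z ∈ V → ∑ V (λ x → a x z) ≡ D
  degreeʳ {z} z∈ = trans (∑-ext V (λ x → a-sym x z)) (degree z∈)

  ∑wlk : ∀ d {z} → z ∈ V → ∑ V (λ x → wlk d x z) ≡ D ^ suc d
  ∑wlk zero z∈ = trans (degreeʳ z∈) (sym (*-identityʳ D))
  ∑wlk (suc d) {z} z∈ = trans (∑-swap V V _) (trans (∑-cong V (λ {y} y∈ →
    trans (∑-*ʳ V (wlk d y z) (λ x → a x y)) (cong (_* wlk d y z) (degreeʳ y∈))))
    (trans (∑-*ˡ V D _) (cong (D *_) (∑wlk d z∈))))

  wlk-++ : ∀ i j x z → wlk (suc (i + j)) x z ≡ ∑ V (λ y → wlk i x y * wlk j y z)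
  wlk-++ zero j x z = refl
  wlk-++ (suc i) j x z = begin
    ∑ V (λ w → a x w * wlk (suc (i + j)) w z)
      ≡⟨ ∑-ext V (λ w → trans (cong (a x w *_) (wlk-++ i j w z)) (sym (∑-*ˡ V (a x w) _))) ⟩
    ∑ V (λ w → ∑ V (λ y → a x w * (wlk i w y * wlk j y z)))
      ≡⟨ ∑-swap V V _ ⟩
    ∑ V (λ y → ∑ V (λ w → a x w * (wlk i w y * wlk j y z)))
      ≡⟨ ∑-ext V (λ y → trans (∑-ext V (λ w → sym (*-assoc (a x w) _ _))) (∑-*ʳ V (wlk j y z) _)) ⟩
    ∑ V (λ y → wlk (suc i) x y * wlk j y z) ∎
    where open ≡-Reasoning

  -- homS L sums over the closed walks with L + 1 vertices.
  homS monoS coinS : ℕ → ℕ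
  homS L = ∑ V (λ x → ∑ (allVecs V L) (λ φ → ch x φ x))
  monoS L = ∑ V (λ x → ∑ (allVecs V L) (λ φ → ch x φ x * nd (x ∷ φ)))
  coinS L = ∑ V (λ x → ∑ (allVecs V L) (λ φ → ch x φ x * coin (x ∷ φ)))

  homS≡ : ∀ L → homS L ≡ ∑ V (λ x → wlk L x x)
  homS≡ L = ∑-ext V (λ x → ∑ch L x x)

  -- Union bound: a closed walk that repeats a vertex has at least one pair of equal entries.
  homS≤ : ∀ L → homS L ≤ monoS L + coinS L
  homS≤ L = ≤-trans (∑-mono V (λ {x} _ → ≤-trans (∑-mono (allVecs V L) (λ {φ} _ → le x φ))
      (≤-reflexive (∑-+ (allVecs V L) _ _)))) (≤-reflexive (∑-+ V _ _))
    where
    le : ∀ x φ → ch x φ x ≤ ch x φ x * nd (x ∷ φ) + ch x φ x * coin (x ∷ φ)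
    le x φ = begin
      ch x φ x ≡⟨ *-identityʳ _ ⟨
      ch x φ x * 1 ≤⟨ *-monoʳ-≤ (ch x φ x) (1≤nd+coin (x ∷ φ)) ⟩
      ch x φ x * (nd (x ∷ φ) + coin (x ∷ φ)) ≡⟨ *-distribˡ-+ (ch x φ x) _ _ ⟩
      _ ∎
      where open ≤-Reasoning

  monoS≤homS : ∀ L → monoS L ≤ homS L
  monoS≤homS L = ∑-mono V (λ {x} _ → ∑-mono (allVecs V L) (λ {φ} _ →
    ≤-trans (≤-reflexive (*-comm (ch x φ x) _)) (bit*≤ (ch x φ x) (nd-bit (x ∷ φ)))))

  -- Each visit to y cuts the walk into a part from x to y with i + 1 edges and a part from y to z,
  -- which are chosen independently.
  ∑-ch*cnt : ∀ d x {y} z → y ∈ V →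
    ∑ (allVecs V d) (λ φ → ch x φ z * cnt y φ) ≡ ∑< d (λ i → wlk i x y * wlk (d ∸ suc i) y z)
  ∑-ch*cnt zero x z y∈ = trans (+-identityʳ _) (*-zeroʳ (a x z))
  ∑-ch*cnt (suc d) x {y} z y∈ = begin
    ∑ (allVecs V (suc d)) (λ φ → ch x φ z * cnt y φ)
      ≡⟨ ∑-allVecs-suc V d _ ⟩
    ∑ V (λ w → ∑ (allVecs V d) (λ φ → a x w * ch w φ z * (eq y w + cnt y φ)))
      ≡⟨ ∑-ext V (λ w → trans (∑-ext (allVecs V d) (λ φ → e' (a x w) (ch w φ z) (eq y w) (cnt y φ)))
           (trans (∑-+ (allVecs V d) _ _) (cong₂ _+_
             (trans (∑-*ˡ (allVecs V d) (eq y w) _) (cong (eq y w *_) (trans (∑-*ˡ (allVecs V d) (a x w) _) (cong (a x w *_) (∑ch d w z)))))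
             (trans (∑-*ˡ (allVecs V d) (a x w) _) (cong (a x w *_) (∑-ch*cnt d w z y∈)))))) ⟩
    ∑ V (λ w → eq y w * (a x w * wlk d w z) + a x w * ∑< d (λ i → wlk i w y * wlk (d ∸ suc i) y z))
      ≡⟨ ∑-+ V _ _ ⟩
    ∑ V (λ w → eq y w * (a x w * wlk d w z)) + ∑ V (λ w → a x w * ∑< d (λ i → wlk i w y * wlk (d ∸ suc i) y z))
      ≡⟨ cong₂ _+_ (pick y∈ _) (trans (∑-ext V (λ w → sym (∑<-*ˡ d (a x w) _))) (trans (∑<-∑-swap d V _)
           (∑<-cong d (λ i _ → trans (∑-ext V (λ w → sym (*-assoc (a x w) (wlk i w y) _))) (∑-*ʳ V (wlk (d ∸ suc i) y z) _))))) ⟩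
    a x y * wlk d y z + ∑< d (λ i → wlk (suc i) x y * wlk (d ∸ suc i) y z) ∎
    where
    open ≡-Reasoning
    e' : ∀ a c q k → a * c * (q + k) ≡ q * (a * c) + a * (c * k)
    e' = solve-∀

  module _ (ϕ : ℕ → ℕ) (diag : ∀ d {x} → x ∈ V → wlk d x x ≡ ϕ d) where

    -- A pair of equal entries encloses a closed segment, with i + 1 edges say; cutting it out
    -- leaves a walk from x to z with d - i edges. The factor d bounds the number of places where
    -- the segment can start.
    ∑-ch*coin : ∀ d {x} z → x ∈ V →
      ∑ (allVecs V d) (λ φ → ch x φ z * coin φ) ≤ d * ∑< d (λ i → ϕ i * wlk (d ∸ suc i) x z)
    ∑-ch*coin zero {x} z x∈ = ≤-reflexive (trans (+-identityʳ _) (*-zeroʳ (a x z)))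
    ∑-ch*coin (suc d) {x} z x∈ = begin
      ∑ (allVecs V (suc d)) (λ φ → ch x φ z * coin φ)
        ≡⟨ ∑-allVecs-suc V d _ ⟩
      ∑ V (λ y → ∑ (allVecs V d) (λ φ → a x y * ch y φ z * (cnt y φ + coin φ)))
        ≡⟨ ∑-ext V (λ y → trans (∑-ext (allVecs V d) (λ φ → e' (a x y) (ch y φ z) (cnt y φ) (coin φ)))
            (trans (∑-*ˡ (allVecs V d) (a x y) _) (cong (a x y *_) (∑-+ (allVecs V d) _ _)))) ⟩
      ∑ V (λ y → a x y * (∑ (allVecs V d) (λ φ → ch y φ z * cnt y φ) + ∑ (allVecs V d) (λ φ → ch y φ z * coin φ)))
        ≤⟨ ∑-mono V (λ {y} y∈ → *-monoʳ-≤ (a x y) (+-mono-≤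
             (≤-reflexive (trans (∑-ch*cnt d y z y∈) (∑<-cong d (λ i _ → cong (_* wlk (d ∸ suc i) y z) (diag i y∈)))))
             (∑-ch*coin d z y∈))) ⟩
      ∑ V (λ y → a x y * (suc d * ∑< d (λ i → ϕ i * wlk (d ∸ suc i) y z)))
        ≡⟨ ∑-ext V (λ y → trans (e'' (a x y) (suc d) _) (cong (suc d *_) (trans (sym (∑<-*ˡ d (a x y) _))
             (∑<-cong d (λ i _ → e'' (a x y) (ϕ i) _))))) ⟩
      ∑ V (λ y → suc d * ∑< d (λ i → ϕ i * (a x y * wlk (d ∸ suc i) y z)))
        ≡⟨ trans (∑-*ˡ V (suc d) _) (cong (suc d *_) (trans (∑<-∑-swap d V _) (∑<-cong d (λ i i<d → trans (∑-*ˡ V (ϕ i) _)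
             (cong (λ k → ϕ i * wlk k x z) (sym (+-∸-assoc 1 i<d))))))) ⟩
      suc d * ∑< d (λ i → ϕ i * wlk (suc d ∸ suc i) x z)
        ≤⟨ *-monoʳ-≤ (suc d) (≤-trans (m≤m+n _ _) (≤-reflexive (sym (∑<-last d (λ i → ϕ i * wlk (suc d ∸ suc i) x z))))) ⟩
      suc d * ∑< (suc d) (λ i → ϕ i * wlk (suc d ∸ suc i) x z) ∎
      where
      open ≤-Reasoning
      e' : ∀ a c k l → a * c * (k + l) ≡ a * (c * k + c * l)
      e' = solve-∀
      e'' : ∀ a c k → a * (c * k) ≡ c * (a * k)
      e'' = solve-∀

    coinS≤ : ∀ L → coinS L ≤ length V * (suc L * ∑< L (λ i → ϕ i * ϕ (L ∸ suc i)))
    coinS≤ L = ≤-trans (∑-mono V (λ {x} x∈ → le x x∈)) (≤-reflexive (∑-const V _))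
      where
      open ≤-Reasoning
      le : ∀ x → x ∈ V → ∑ (allVecs V L) (λ φ → ch x φ x * (cnt x φ + coin φ)) ≤ suc L * ∑< L (λ i → ϕ i * ϕ (L ∸ suc i))
      le x x∈ = begin
        ∑ (allVecs V L) (λ φ → ch x φ x * (cnt x φ + coin φ))
          ≡⟨ trans (∑-ext (allVecs V L) (λ φ → *-distribˡ-+ (ch x φ x) _ _)) (∑-+ (allVecs V L) _ _) ⟩
        ∑ (allVecs V L) (λ φ → ch x φ x * cnt x φ) + ∑ (allVecs V L) (λ φ → ch x φ x * coin φ)
          ≤⟨ +-mono-≤ (≤-reflexive (trans (∑-ch*cnt L x x x∈) (∑<-cong L (λ i _ → cong₂ _*_ (diag i x∈) (diag (L ∸ suc i) x∈)))))
               (≤-trans (∑-ch*coin L x x∈) (≤-reflexive (cong (L *_) (∑<-cong L (λ i _ → cong (ϕ i *_) (diag (L ∸ suc i) x∈)))))) ⟩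
        suc L * ∑< L (λ i → ϕ i * ϕ (L ∸ suc i)) ∎

  -- SA d is the number of self-avoiding walks with d edges.
  SA : ℕ → ℕ
  SA d = ∑ V (λ x → ∑ (allVecs V d) (λ φ → path x φ * nd (x ∷ φ)))

  SA≤ : ∀ d → SA d ≤ length V * D ^ d
  SA≤ d = ≤-trans (∑-mono V (λ {x} x∈ → ≤-trans (∑-mono (allVecs V d) (λ {φ} _ →
      ≤-trans (≤-reflexive (*-comm (path x φ) _)) (bit*≤ (path x φ) (nd-bit (x ∷ φ))))) (≤-reflexive (∑path d x∈))))
    (≤-reflexive (∑-const V _))

  -- A free walk with ℓ edges that already meets itself can be closed up in at least κ ways, and
  -- none of the resulting closed walks is injective. So hom - mono is at least κ times the number
  -- of such walks, written here without subtraction.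
  monoS+SA : ∀ ℓ m κ → (∀ {x z} → x ∈ V → z ∈ V → κ ≤ wlk m x z) →
    monoS (ℓ + m) + κ * (length V * D ^ ℓ) ≤ homS (ℓ + m) + κ * SA ℓ
  monoS+SA ℓ m κ κ≤ = begin
    monoS (ℓ + m) + κ * (length V * D ^ ℓ)
      ≡⟨ cong (λ z → monoS (ℓ + m) + κ * z) (trans (sym (∑-const V (D ^ ℓ))) (∑-cong V (λ x∈ → sym (∑path ℓ x∈)))) ⟩
    monoS (ℓ + m) + κ * ∑ V (λ x → ∑ (allVecs V ℓ) (path x))
      ≡⟨ glue (λ x φ → ch x φ x * nd (x ∷ φ)) path ⟩
    ∑ V (λ x → ∑ (allVecs V ℓ) (λ φ → ∑ (allVecs V m) (λ ψ → ch x (φ ++ ψ) x * nd (x ∷ (φ ++ ψ))) + κ * path x φ))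
      ≤⟨ ∑-mono V (λ {x} x∈ → ∑-allVecs-mono V ℓ (λ φ φ∈ → le x φ x∈ φ∈)) ⟩
    ∑ V (λ x → ∑ (allVecs V ℓ) (λ φ → ∑ (allVecs V m) (λ ψ → ch x (φ ++ ψ) x) + κ * (path x φ * nd (x ∷ φ))))
      ≡⟨ glue (λ x φ → ch x φ x) (λ x φ → path x φ * nd (x ∷ φ)) ⟨
    homS (ℓ + m) + κ * SA ℓ ∎
    where
    open ≤-Reasoning
    glue : (F : A → Vec A (ℓ + m) → ℕ) (G : A → Vec A ℓ → ℕ) →
      ∑ V (λ x → ∑ (allVecs V (ℓ + m)) (F x)) + κ * ∑ V (λ x → ∑ (allVecs V ℓ) (G x)) ≡
      ∑ V (λ x → ∑ (allVecs V ℓ) (λ φ → ∑ (allVecs V m) (λ ψ → F x (φ ++ ψ)) + κ * G x φ))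
    glue F G = trans (cong (∑ V (λ x → ∑ (allVecs V (ℓ + m)) (F x)) +_) (sym (∑-*ˡ V κ _)))
      (trans (sym (∑-+ V _ _)) (∑-ext V (λ x → trans (cong₂ _+_ (∑-allVecs-++ V ℓ m (F x)) (sym (∑-*ˡ (allVecs V ℓ) κ (G x))))
        (sym (∑-+ (allVecs V ℓ) _ _)))))
    arith : ∀ p {b} w → IsBit b → κ ≤ w → p * w * b + κ * p ≤ p * w + κ * (p * b)
    arith p w (inj₂ refl) κ≤w = ≤-reflexive (cong₂ _+_ (*-identityʳ (p * w)) (cong (κ *_) (sym (*-identityʳ p))))
    arith p w (inj₁ refl) κ≤w = begin
      p * w * 0 + κ * p ≡⟨ cong (_+ κ * p) (*-zeroʳ (p * w)) ⟩
      κ * p ≡⟨ *-comm κ p ⟩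
      p * κ ≤⟨ *-monoʳ-≤ p κ≤w ⟩
      p * w ≤⟨ m≤m+n _ _ ⟩
      p * w + κ * (p * 0) ∎
    le : ∀ x (φ : Vec A ℓ) → x ∈ V → All (_∈ V) φ →
      ∑ (allVecs V m) (λ ψ → ch x (φ ++ ψ) x * nd (x ∷ (φ ++ ψ))) + κ * path x φ ≤
      ∑ (allVecs V m) (λ ψ → ch x (φ ++ ψ) x) + κ * (path x φ * nd (x ∷ φ))
    le x φ x∈ φ∈ = begin
      ∑ (allVecs V m) (λ ψ → ch x (φ ++ ψ) x * nd (x ∷ (φ ++ ψ))) + κ * path x φ
        ≤⟨ +-monoˡ-≤ _ (≤-trans (∑-mono (allVecs V m) (λ {ψ} _ → *-monoʳ-≤ (ch x (φ ++ ψ) x) (nd-++ˡ (x ∷ φ) ψ)))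
             (≤-reflexive (trans (∑-*ʳ (allVecs V m) (nd (x ∷ φ)) _) (cong (_* nd (x ∷ φ)) tot)))) ⟩
      path x φ * wlk m (final x φ) x * nd (x ∷ φ) + κ * path x φ
        ≤⟨ arith (path x φ) (wlk m (final x φ) x) (nd-bit (x ∷ φ)) (κ≤ (final-∈ x∈ φ∈) x∈) ⟩
      path x φ * wlk m (final x φ) x + κ * (path x φ * nd (x ∷ φ))
        ≡⟨ cong (_+ _) tot ⟨
      _ ∎
      where
      tot : ∑ (allVecs V m) (λ ψ → ch x (φ ++ ψ) x) ≡ path x φ * wlk m (final x φ) x
      tot = trans (∑-ext (allVecs V m) (λ ψ → ch-++ x φ ψ x)) (trans (∑-*ˡ (allVecs V m) (path x φ) _)
        (cong (path x φ *_) (∑ch m (final x φ) x)))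

  sumv : ∀ {t} → (A → ℕ) → Vec A t → ℕ
  sumv f [] = 0
  sumv f (y ∷ φ) = f y + sumv f φ

  -- As the entries of φ are distinct, `pick` can remove them from the sum over `V` one after the
  -- other without removing any of them twice.
  avoid : ∀ {t} (f : A → ℕ) (φ : Vec A t) → All (_∈ V) φ → nd φ ≡ 1 →
    ∑ V (λ x → f x * ni x φ) + sumv f φ ≤ ∑ V f
  avoid f [] _ _ = ≤-reflexive (trans (+-identityʳ _) (∑-ext V (λ x → *-identityʳ (f x))))
  avoid f (y ∷ φ) (y∈ ∷ φ∈) nd1 = begin
    ∑ V (λ x → f x * ((1 ∸ eq x y) * ni x φ)) + (f y + sumv f φ)
      ≡⟨ +-assoc (∑ V (λ x → f x * ((1 ∸ eq x y) * ni x φ))) (f y) (sumv f φ) ⟨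
    ∑ V (λ x → f x * ((1 ∸ eq x y) * ni x φ)) + f y + sumv f φ
      ≡⟨ cong (_+ sumv f φ) step ⟩
    ∑ V (λ x → f x * ni x φ) + sumv f φ
      ≤⟨ avoid f φ φ∈ (m*n≡1⇒n≡1 (ni y φ) (nd φ) nd1) ⟩
    ∑ V f ∎
    where
    open ≤-Reasoning
    e' : ∀ f d n q → f * (d * n) + q * (f * n) ≡ (d + q) * (f * n)
    e' = solve-∀
    step : ∑ V (λ x → f x * ((1 ∸ eq x y) * ni x φ)) + f y ≡ ∑ V (λ x → f x * ni x φ)
    step = trans (cong (∑ V (λ x → f x * ((1 ∸ eq x y) * ni x φ)) +_) (trans (trans (sym (*-identityʳ (f y))) (cong (f y *_) (sym (m*n≡1⇒m≡1 (ni y φ) (nd φ) nd1))))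
        (sym (pick y∈ (λ x → f x * ni x φ)))))
      (trans (sym (∑-+ V _ _)) (∑-ext V (λ x → trans (e' (f x) (1 ∸ eq x y) (ni x φ) (eq y x))
        (trans (cong (λ z → (1 ∸ eq x y + z) * (f x * ni x φ)) (eq-sym y x))
          (trans (cong (_* (f x * ni x φ)) (ne+eq x y)) (*-identityˡ _))))))

  -- The walk is prolonged at its front, where vectors and `path` grow. Besides the self-avoidance
  -- of the old walk, only one condition is kept: the new front x is off the old walk. The vertices
  -- between x and y are then summed freely into `wlk`.
  SA-prepend : ∀ m d → SA (m + suc d) ≤
    ∑ V (λ y → ∑ (allVecs V d) (λ φ → ∑ V (λ x → wlk m x y * ni x (y ∷ φ)) * (path y φ * nd (y ∷ φ))))
  SA-prepend m d = begin
    SA (m + suc d)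
      ≡⟨ ∑-ext V (λ x → trans (∑-allVecs-++ V m (suc d) _) (∑-swap (allVecs V m) (allVecs V (suc d)) _)) ⟩
    ∑ V (λ x → ∑ (allVecs V (suc d)) (λ φ → ∑ (allVecs V m) (λ ψ → path x (ψ ++ φ) * nd (x ∷ (ψ ++ φ)))))
      ≡⟨ ∑-swap V (allVecs V (suc d)) _ ⟩
    ∑ (allVecs V (suc d)) (λ φ → ∑ V (λ x → ∑ (allVecs V m) (λ ψ → path x (ψ ++ φ) * nd (x ∷ (ψ ++ φ)))))
      ≡⟨ ∑-allVecs-suc V d _ ⟩
    ∑ V (λ y → ∑ (allVecs V d) (λ φ → ∑ V (λ x → ∑ (allVecs V m) (λ ψ → path x (ψ ++ y ∷ φ) * nd (x ∷ (ψ ++ y ∷ φ))))))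
      ≤⟨ ∑-mono V (λ {y} _ → ∑-mono (allVecs V d) (λ {φ} _ → ≤-trans (∑-mono V (λ {x} _ → le x y φ)) (≤-reflexive (∑-*ʳ V _ _)))) ⟩
    _ ∎
    where
    open ≤-Reasoning
    e' : ∀ c p n d → c * p * (n * d) ≡ c * (n * (p * d))
    e' = solve-∀
    le : ∀ x y (φ : Vec A d) → ∑ (allVecs V m) (λ ψ → path x (ψ ++ y ∷ φ) * nd (x ∷ (ψ ++ y ∷ φ))) ≤
      wlk m x y * ni x (y ∷ φ) * (path y φ * nd (y ∷ φ))
    le x y φ = begin
      ∑ (allVecs V m) (λ ψ → path x (ψ ++ y ∷ φ) * nd (x ∷ (ψ ++ y ∷ φ)))
        ≤⟨ ∑-mono (allVecs V m) (λ {ψ} _ → *-mono-≤ (≤-reflexive (path-++ x ψ y φ))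
            (*-mono-≤ (≤-trans (≤-reflexive (ni-++ x ψ (y ∷ φ))) (bit*≤ _ (ni-bit x ψ))) (nd-++ʳ ψ (y ∷ φ)))) ⟩
      ∑ (allVecs V m) (λ ψ → ch x ψ y * path y φ * (ni x (y ∷ φ) * nd (y ∷ φ)))
        ≡⟨ trans (∑-ext (allVecs V m) (λ ψ → e' (ch x ψ y) (path y φ) (ni x (y ∷ φ)) (nd (y ∷ φ)))) (∑-*ʳ (allVecs V m) _ _) ⟩
      ∑ (allVecs V m) (λ ψ → ch x ψ y) * (ni x (y ∷ φ) * (path y φ * nd (y ∷ φ)))
        ≡⟨ cong (_* _) (∑ch m x y) ⟩
      wlk m x y * (ni x (y ∷ φ) * (path y φ * nd (y ∷ φ)))
        ≡⟨ *-assoc (wlk m x y) _ _ ⟨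
      _ ∎

  -- Common form of the two decay estimates: c is a lower bound for the number of ways in which the prolongation of a
  -- self-avoiding walk by m + 1 steps can hit it.
  SA-decay : ∀ m d c →
    (∀ y (φ : Vec A d) → y ∈ V → All (_∈ V) φ → path y φ * c ≤ path y φ * sumv (λ x → wlk m x y) (y ∷ φ)) →
    SA (m + suc d) + c * SA d ≤ D ^ suc m * SA d
  SA-decay m d c hit = begin
    SA (m + suc d) + c * SA d
      ≤⟨ +-mono-≤ (SA-prepend m d) (≤-reflexive (trans (sym (∑-*ˡ V c _)) (∑-ext V (λ y → sym (∑-*ˡ (allVecs V d) c _))))) ⟩
    ∑ V (λ y → ∑ (allVecs V d) (λ φ → ∑ V (λ x → wlk m x y * ni x (y ∷ φ)) * (path y φ * nd (y ∷ φ))))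
      + ∑ V (λ y → ∑ (allVecs V d) (λ φ → c * (path y φ * nd (y ∷ φ))))
      ≡⟨ trans (sym (∑-+ V _ _)) (∑-ext V (λ y → sym (∑-+ (allVecs V d) _ _))) ⟩
    ∑ V (λ y → ∑ (allVecs V d) (λ φ → ∑ V (λ x → wlk m x y * ni x (y ∷ φ)) * (path y φ * nd (y ∷ φ)) + c * (path y φ * nd (y ∷ φ))))
      ≤⟨ ∑-mono V (λ {y} y∈ → ∑-allVecs-mono V d (λ φ φ∈ → le y φ y∈ φ∈ (nd-bit (y ∷ φ)))) ⟩
    ∑ V (λ y → ∑ (allVecs V d) (λ φ → D ^ suc m * (path y φ * nd (y ∷ φ))))
      ≡⟨ trans (∑-ext V (λ y → ∑-*ˡ (allVecs V d) (D ^ suc m) _)) (∑-*ˡ V (D ^ suc m) _) ⟩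
    D ^ suc m * SA d ∎
    where
    open ≤-Reasoning
    e' : ∀ s p c → s * p + p * c ≡ p * (s + c)
    e' = solve-∀
    le : ∀ y (φ : Vec A d) → y ∈ V → All (_∈ V) φ → IsBit (nd (y ∷ φ)) →
      ∑ V (λ x → wlk m x y * ni x (y ∷ φ)) * (path y φ * nd (y ∷ φ)) + c * (path y φ * nd (y ∷ φ)) ≤ D ^ suc m * (path y φ * nd (y ∷ φ))
    le y φ y∈ φ∈ (inj₁ nd0) rewrite nd0 | *-zeroʳ (path y φ) | *-zeroʳ (∑ V (λ x → wlk m x y * ni x (y ∷ φ))) | *-zeroʳ c = z≤n
    le y φ y∈ φ∈ (inj₂ nd1) = begin
      S * (P * nd (y ∷ φ)) + c * (P * nd (y ∷ φ)) ≡⟨ cong (λ z → S * z + c * z) (trans (cong (P *_) nd1) (*-identityʳ P)) ⟩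
      S * P + c * P ≡⟨ cong (S * P +_) (*-comm c P) ⟩
      S * P + P * c ≤⟨ +-monoʳ-≤ (S * P) (hit y φ y∈ φ∈) ⟩
      S * P + P * sumv (λ x → wlk m x y) (y ∷ φ) ≡⟨ e' S P _ ⟩
      P * (S + sumv (λ x → wlk m x y) (y ∷ φ)) ≤⟨ *-monoʳ-≤ P (avoid (λ x → wlk m x y) (y ∷ φ) (y∈ ∷ φ∈) nd1) ⟩
      P * ∑ V (λ x → wlk m x y) ≡⟨ cong (P *_) (∑wlk m y∈) ⟩
      P * D ^ suc m ≡⟨ *-comm P _ ⟩
      D ^ suc m * P ≡⟨ cong (D ^ suc m *_) (trans (cong (P *_) nd1) (*-identityʳ P)) ⟨
      D ^ suc m * (P * nd (y ∷ φ)) ∎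
      where
      S = ∑ V (λ x → wlk m x y * ni x (y ∷ φ))
      P = path y φ

  SA-collision : ∀ m d κ → (∀ {x z} → x ∈ V → z ∈ V → κ ≤ wlk m x z) →
    SA (m + suc d) + suc d * κ * SA d ≤ D ^ suc m * SA d
  SA-collision m d κ κ≤ = SA-decay m d (suc d * κ) (λ y φ y∈ φ∈ → *-monoʳ-≤ (path y φ) (bound y (y ∷ φ) y∈ (y∈ ∷ φ∈)))
    where
    bound : ∀ {t} y (φ : Vec A t) → y ∈ V → All (_∈ V) φ → t * κ ≤ sumv (λ x → wlk m x y) φ
    bound y [] y∈ _ = z≤n
    bound y (w ∷ φ) y∈ (w∈ ∷ φ∈) = +-mono-≤ (κ≤ w∈ y∈) (bound y φ y∈ φ∈)

  -- The second vertex w of the old walk is adjacent to its front y, so at least one of the D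
  -- choices for the new front is lost. The old walk must have an edge for this, hence `suc d`.
  SA-backtrack : ∀ d → SA (suc (suc d)) + SA (suc d) ≤ D * SA (suc d)
  SA-backtrack d = subst₂ _≤_ (cong (SA (suc (suc d)) +_) (*-identityˡ _)) (cong (_* SA (suc d)) (*-identityʳ D))
    (SA-decay 0 (suc d) 1 hit)
    where
    hit : ∀ y (φ : Vec A (suc d)) → y ∈ V → All (_∈ V) φ → path y φ * 1 ≤ path y φ * sumv (λ x → a x y) (y ∷ φ)
    hit y (w ∷ φ) _ _ with a-bit y w
    ... | inj₁ p rewrite p = z≤n
    ... | inj₂ p = *-monoʳ-≤ (a y w * path w φ) (≤-trans (≤-reflexive (sym (trans (a-sym w y) p)))
                     (≤-trans (m≤m+n _ _) (m≤n+m _ (a y y))))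

⟦×⟧ : ∀ {P Q : Set} (d : Dec P) (e : Dec Q) → ⟦ d ×-dec e ⟧ ≡ ⟦ d ⟧ * ⟦ e ⟧
⟦×⟧ (yes _) (yes _) = refl
⟦×⟧ (yes _) (no _) = refl
⟦×⟧ (no _) _ = refl

⟦⟧-bit-≡ : ∀ {P : Set} (d : Dec P) {b} → b ≡ 0 ⊎ b ≡ 1 → (P → b ≡ 1) → (b ≡ 1 → P) → ⟦ d ⟧ ≡ b
⟦⟧-bit-≡ d (inj₁ refl) f g = ⟦⟧-no d (λ p → contradiction (f p) λ ())
⟦⟧-bit-≡ d (inj₂ refl) f g = ⟦⟧-yes d (g refl)

-- Binomial coefficients and weighted subset sums.

absorption : ∀ m k → suc k * (suc m C suc k) ≡ suc m * (m C k)
absorption m zero = trans (*-identityˡ _) (trans (nC1≡n (suc m)) (sym (trans (cong (suc m *_) (nC0≡1 m)) (*-identityʳ (suc m)))))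
absorption zero (suc k) = *-zeroʳ (suc (suc k))
absorption (suc m) (suc k) = begin
  suc (suc k) * (suc (suc m) C suc (suc k))
    ≡⟨ cong (suc (suc k) *_) (nCk+nC[k+1]≡[n+1]C[k+1] (suc m) (suc k)) ⟨
  suc (suc k) * (suc m C suc k + suc m C suc (suc k))
    ≡⟨ e₁ (suc k) (suc m C suc k) (suc m C suc (suc k)) ⟩
  suc m C suc k + (suc k * (suc m C suc k) + suc (suc k) * (suc m C suc (suc k)))
    ≡⟨ cong (suc m C suc k +_) (cong₂ _+_ (absorption m k) (absorption m (suc k))) ⟩
  suc m C suc k + (suc m * (m C k) + suc m * (m C suc k))
    ≡⟨ cong (suc m C suc k +_) (trans (sym (*-distribˡ-+ (suc m) (m C k) _)) (cong (suc m *_) (nCk+nC[k+1]≡[n+1]C[k+1] m k))) ⟩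
  suc (suc m) * (suc m C suc k) ∎
  where
  open ≡-Reasoning
  e₁ : ∀ k x y → suc k * (x + y) ≡ x + (k * x + suc k * y)
  e₁ = solve-∀

module _ (B : ℕ) where

  private
    X = suc B

  el-sucˡ : ∀ p q k → el X (suc p) q (suc k) ≡ el X p q (suc k) + X * el X p q k
  el-sucˡ p q k = cong (el X p q (suc k) +_) (trans (∑C-ext p (λ a → trans (∑C-ext q (λ b →
      trans (cong (_* X ^ suc a) (δ-suc (a + b) k)) (e₁ (δ (a + b) k) X (X ^ a)))) (∑C-*ˡ q X _))) (∑C-*ˡ p X _))
    where e₁ : ∀ x y z → x * (y * z) ≡ y * (x * z)
          e₁ = solve-∀

  el-sucʳ : ∀ p q k → el X p (suc q) (suc k) ≡ el X p q (suc k) + el X p q k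
  el-sucʳ p q k = trans (∑C-ext p (λ a → cong (∑C q (λ b → δ (a + b) (suc k) * X ^ a) +_)
      (∑C-ext q (λ b → cong (_* X ^ a) (trans (cong (λ z → δ z (suc k)) (+-suc a b)) (δ-suc (a + b) k))))))
    (∑C-+ p _ _)

  -- `el X p q k` is the coefficient of z^k in (1 + X z)^p (1 + z)^q, and 1 + X z = (1 + z) + B z.
  el-trade : ∀ p q k → el X (suc p) q (suc k) ≡ el X p (suc q) (suc k) + B * el X p q k
  el-trade p q k = trans (el-sucˡ p q k) (trans (sym (+-assoc (el X p q (suc k)) _ _))
    (cong (_+ B * el X p q k) (sym (el-sucʳ p q k))))

  el-zeroˡ : ∀ q k → el X 0 q k ≡ q C k
  el-zeroˡ q k = trans (∑C-ext q (λ b → *-identityʳ (δ b k))) (∑C-δ q k)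

  el-0 : ∀ p q → el X p q 0 ≡ 1
  el-0 zero q = trans (el-zeroˡ q 0) (nC0≡1 q)
  el-0 (suc p) q = trans (cong₂ _+_ (el-0 p q) (trans (∑C-ext p (λ a → ∑C-0 q)) (∑C-0 p))) refl

  el≤ : ∀ p q k → el X p q k ≤ X ^ p * ((p + q) C k)
  el≤ p q k = begin
    el X p q k ≤⟨ ∑C-mono p (λ a a≤p → ∑C-mono q (λ b _ → *-monoʳ-≤ (δ (a + b) k) (^-monoʳ-≤ X a≤p))) ⟩
    ∑C p (λ a → ∑C q (λ b → δ (a + b) k * X ^ p)) ≡⟨ trans (∑C-ext p (λ a → ∑C-*ʳ q (X ^ p) _)) (∑C-*ʳ p (X ^ p) _) ⟩
    ∑C p (λ a → ∑C q (λ b → δ (a + b) k)) * X ^ p ≡⟨ trans (cong (_* X ^ p) (∑C-δ+ p q k)) (*-comm _ (X ^ p)) ⟩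
    X ^ p * ((p + q) C k) ∎
    where open ≤-Reasoning

  1≤X^ : ∀ i → 1 ≤ X ^ i
  1≤X^ i = m^n>0 X i

  -- This sums the convexity bound X^a - 1 ≤ (a/i) (X^i - 1) over the (k+1)-subsets of m + 1
  -- elements, each element lying in C(m,k) of them. The proof lowers the i weights X to 1 one at a
  -- time, at a cost of at most C(m,k) B X^j for j < i, and B X^j = X^(j+1) - X^j telescopes.
  el-convex : ∀ i q m k → i + q ≡ suc m →
    el X i q (suc k) + m C k ≤ suc m C suc k + (m C k) * X ^ i
  el-convex zero q m k refl = ≤-reflexive (cong₂ _+_ (el-zeroˡ q (suc k)) (sym (*-identityʳ (m C k))))
  el-convex (suc i) q m k eq = begin
    el X (suc i) q (suc k) + m C k
      ≡⟨ cong (_+ m C k) (el-trade i q k) ⟩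
    el X i (suc q) (suc k) + B * el X i q k + m C k
      ≡⟨ e₁ (el X i (suc q) (suc k)) (B * el X i q k) (m C k) ⟩
    el X i (suc q) (suc k) + m C k + B * el X i q k
      ≤⟨ +-mono-≤ (el-convex i (suc q) m k (trans (+-suc i q) eq))
           (*-monoʳ-≤ B (≤-trans (el≤ i q k) (≤-reflexive (cong (λ z → X ^ i * (z C k)) (suc-injective eq))))) ⟩
    suc m C suc k + (m C k) * X ^ i + B * (X ^ i * (m C k))
      ≡⟨ e₂ (suc m C suc k) (m C k) (X ^ i) B ⟩
    suc m C suc k + (m C k) * X ^ suc i ∎
    where
    open ≤-Reasoning
    e₁ : ∀ a b c → a + b + c ≡ a + c + b
    e₁ = solve-∀
    e₂ : ∀ a b x B → a + b * x + B * (x * b) ≡ a + b * (suc B * x)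
    e₂ = solve-∀

  -- A random s-subset keeps a given element with probability s/r ≤ (r - 1)/r; convexity of X^a does the rest.
  el-contract : ∀ s e i q → i + q ≡ suc (s + e) →
    suc (s + e) * el X i q s ≤ (suc (s + e) C s) * (1 + (s + e) * X ^ i)
  el-contract zero e i q eq = begin
    suc e * el X i q 0 ≡⟨ trans (cong (suc e *_) (el-0 i q)) (*-identityʳ (suc e)) ⟩
    suc e ≤⟨ s≤s (≤-trans (≤-reflexive (sym (*-identityʳ e))) (*-monoʳ-≤ e (1≤X^ i))) ⟩
    1 + e * X ^ i ≡⟨ trans (sym (*-identityˡ _)) (cong (_* (1 + e * X ^ i)) (sym (nC0≡1 (suc e)))) ⟩
    (suc e C 0) * (1 + e * X ^ i) ∎
    where open ≤-Reasoning
  el-contract (suc s) e i q eq = +-cancelʳ-≤ (suc s * c) _ _ (begin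
    suc m * el X i q (suc s) + suc s * c
      ≡⟨ cong (suc m * el X i q (suc s) +_) (absorption m s) ⟩
    suc m * el X i q (suc s) + suc m * (m C s)
      ≡⟨ *-distribˡ-+ (suc m) (el X i q (suc s)) (m C s) ⟨
    suc m * (el X i q (suc s) + m C s)
      ≤⟨ *-monoʳ-≤ (suc m) (el-convex i q m s eq) ⟩
    suc m * (c + (m C s) * X ^ i)
      ≡⟨ e₁ (suc m) c (m C s) (X ^ i) ⟩
    suc m * c + suc m * (m C s) * X ^ i
      ≡⟨ cong (λ z → suc m * c + z * X ^ i) (absorption m s) ⟨
    suc m * c + suc s * c * X ^ i
      ≡⟨ e₂ s e c (X ^ i) ⟩
    c * (1 + (suc s * X ^ i + e)) + suc s * c
      ≤⟨ +-monoˡ-≤ (suc s * c) (*-monoʳ-≤ c (+-monoʳ-≤ 1 (+-monoʳ-≤ (suc s * X ^ i)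
           (≤-trans (≤-reflexive (sym (*-identityʳ e))) (*-monoʳ-≤ e (1≤X^ i)))))) ⟩
    c * (1 + (suc s * X ^ i + e * X ^ i)) + suc s * c
      ≡⟨ cong (λ z → c * (1 + z) + suc s * c) (*-distribʳ-+ (X ^ i) (suc s) e) ⟨
    c * (1 + m * X ^ i) + suc s * c ∎)
    where
    open ≤-Reasoning
    m = suc s + e
    c = suc m C suc s
    e₁ : ∀ m c d x → m * (c + d * x) ≡ m * c + m * d * x
    e₁ = solve-∀
    e₂ : ∀ s e c x → suc (suc s + e) * c + suc s * c * x ≡ c * (1 + (suc s * x + e)) + suc s * c
    e₂ = solve-∀

  -- Few k-subsets contain one of the m weighted elements if the ground set is large. Each trade of
  -- a weight X for 1 raises z by one, so Y = m + z is the same throughout, and the growing gap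
  -- between Y/(z + 1) and Y/z absorbs the error of the trade.
  el-flat : ∀ m z l k → (B * (m + z) + 1) * k ≤ m + l → z * el X m l k ≤ (m + z) * ((m + l) C k)
  el-flat zero z l k h = ≤-reflexive (cong (z *_) (el-zeroˡ l k))
  el-flat (suc m) z l zero h = begin
    z * el X (suc m) l 0 ≡⟨ trans (cong (z *_) (el-0 (suc m) l)) (*-identityʳ z) ⟩
    z ≤⟨ m≤n+m z (suc m) ⟩
    suc m + z ≡⟨ *-identityʳ _ ⟨
    (suc m + z) * 1 ≡⟨ cong ((suc m + z) *_) (nC0≡1 (suc m + l)) ⟨
    (suc m + z) * ((suc m + l) C 0) ∎
    where open ≤-Reasoning
  el-flat (suc m) z l (suc k) h = *-cancelˡ-≤ (suc z) (begin
    suc z * (z * el X (suc m) l (suc k))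
      ≡⟨ cong (λ x → suc z * (z * x)) (el-trade m l k) ⟩
    suc z * (z * (el₁ + B * el₂))
      ≡⟨ e₁ z el₁ B el₂ ⟩
    z * (suc z * el₁) + z * (B * (suc z * el₂))
      ≤⟨ +-mono-≤ (*-monoʳ-≤ z ih₁) (*-monoʳ-≤ z (*-monoʳ-≤ B ih₂)) ⟩
    z * (Y * c) + z * (B * (Y * c⁻))
      -- This is where z ≤ Y enters; it is equivalent to (Y + 1)/(z + 1) ≤ Y/z.
      ≤⟨ +-monoʳ-≤ (z * (Y * c)) (*-mono-≤ (m≤n+m z (suc m)) small) ⟩
    z * (Y * c) + Y * c
      ≡⟨ +-comm (z * (Y * c)) _ ⟩
    suc z * (Y * c) ∎)
    where
    open ≤-Reasoning
    Y = suc m + z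
    el₁ = el X m (suc l) (suc k)
    el₂ = el X m l k
    c = suc (m + l) C suc k
    c⁻ = (m + l) C k
    e₁ : ∀ z x B y → suc z * (z * (x + B * y)) ≡ z * (suc z * x) + z * (B * (suc z * y))
    e₁ = solve-∀
    ih₁ : suc z * el₁ ≤ Y * c
    ih₁ = subst₂ (λ y w → suc z * el₁ ≤ y * (w C suc k)) (+-suc m z) (+-suc m l)
      (el-flat m (suc z) (suc l) (suc k) (subst₂ (λ y w → (B * y + 1) * suc k ≤ w) (sym (+-suc m z)) (sym (+-suc m l)) h))
    h' : (B * Y + 1) * k ≤ m + l
    h' = ≤-pred (begin
      suc ((B * Y + 1) * k) ≤⟨ +-monoˡ-≤ _ (m≤n+m 1 (B * Y)) ⟩
      (B * Y + 1) + (B * Y + 1) * k ≡⟨ *-suc (B * Y + 1) k ⟨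
      (B * Y + 1) * suc k ≤⟨ h ⟩
      suc (m + l) ∎)
    ih₂ : suc z * el₂ ≤ Y * c⁻
    ih₂ = subst (λ y → suc z * el₂ ≤ y * c⁻) (+-suc m z)
      (el-flat m (suc z) l k (subst (λ y → (B * y + 1) * k ≤ m + l) (sym (+-suc m z)) h'))
    -- By `absorption`, c⁻/c = (k + 1)/(m + l + 1), and the size hypothesis h says that B Y times
    -- this ratio is at most 1.
    small : B * (Y * c⁻) ≤ c
    small = *-cancelˡ-≤ (suc k) (begin
      suc k * (B * (Y * c⁻)) ≡⟨ e₂ (suc k) B Y c⁻ ⟩
      (B * Y) * suc k * c⁻ ≤⟨ *-monoˡ-≤ c⁻ (*-monoˡ-≤ (suc k) (m≤m+n (B * Y) 1)) ⟩
      (B * Y + 1) * suc k * c⁻ ≤⟨ *-monoˡ-≤ c⁻ h ⟩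
      suc (m + l) * c⁻ ≡⟨ absorption (m + l) k ⟨
      suc k * c ∎)
      where e₂ : ∀ k B y c → k * (B * (y * c)) ≡ (B * y) * k * c
            e₂ = solve-∀

-- Powers, binomial coefficients and exponentials.

^-distribʳ-* : ∀ m n k → (m * n) ^ k ≡ m ^ k * n ^ k
^-distribʳ-* m n zero = refl
^-distribʳ-* m n (suc k) = trans (cong (m * n *_) (^-distribʳ-* m n k)) (e' m n (m ^ k) (n ^ k))
  where e' : ∀ a b c d → a * b * (c * d) ≡ a * c * (b * d)
        e' = solve-∀

^≤!*C : ∀ m k → m ^ k ≤ k ! * ((m + k) C k)
^≤!*C m zero = ≤-reflexive (sym (trans (*-identityˡ _) (nC0≡1 (m + 0))))
^≤!*C m (suc k) = begin
  m * m ^ k ≤⟨ *-mono-≤ (m≤n⇒m≤1+n (m≤m+n m k)) (^≤!*C m k) ⟩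
  suc (m + k) * (k ! * ((m + k) C k)) ≡⟨ e' (suc (m + k)) (k !) _ ⟩
  k ! * (suc (m + k) * ((m + k) C k)) ≡⟨ cong (k ! *_) (absorption (m + k) k) ⟨
  k ! * (suc k * (suc (m + k) C suc k)) ≡⟨ e'' (k !) (suc k) _ ⟩
  suc k ! * (suc (m + k) C suc k) ≡⟨ cong (λ z → suc k ! * (z C suc k)) (+-suc m k) ⟨
  suc k ! * ((m + suc k) C suc k) ∎
  where
  open ≤-Reasoning
  e' : ∀ a b c → a * (b * c) ≡ b * (a * c)
  e' = solve-∀
  e'' : ∀ a b c → a * (b * c) ≡ b * a * c
  e'' = solve-∀

C≤^ : ∀ m k → m C k ≤ m ^ k
C≤^ m zero = ≤-reflexive (nC0≡1 m)
C≤^ zero (suc k) = z≤n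
C≤^ (suc m) (suc k) = begin
  suc m C suc k ≤⟨ m≤m+n _ _ ⟩
  suc k * (suc m C suc k) ≡⟨ absorption m k ⟩
  suc m * (m C k) ≤⟨ *-monoʳ-≤ (suc m) (≤-trans (C≤^ m k) (^-monoˡ-≤ k (n≤1+n m))) ⟩
  suc m ^ suc k ∎
  where open ≤-Reasoning

^≤C : ∀ n c m k → k ≤ m → n ≤ c * (m ∸ k) → n ^ k ≤ c ^ k * k ! * (m C k)
^≤C n c m k k≤m n≤ = begin
  n ^ k ≤⟨ ^-monoˡ-≤ k n≤ ⟩
  (c * (m ∸ k)) ^ k ≡⟨ ^-distribʳ-* c (m ∸ k) k ⟩
  c ^ k * (m ∸ k) ^ k ≤⟨ *-monoʳ-≤ (c ^ k) (^≤!*C (m ∸ k) k) ⟩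
  c ^ k * (k ! * ((m ∸ k + k) C k)) ≡⟨ *-assoc (c ^ k) (k !) _ ⟨
  c ^ k * k ! * ((m ∸ k + k) C k) ≡⟨ cong (λ z → c ^ k * k ! * (z C k)) (m∸n+n≡m k≤m) ⟩
  c ^ k * k ! * (m C k) ∎
  where open ≤-Reasoning

minimum : ∀ (f : ℕ → ℕ) r → ∃ λ j → j ≤ r × (∀ i → i ≤ r → f j ≤ f i)
minimum f zero = 0 , z≤n , λ { .0 z≤n → ≤-refl }
minimum f (suc r) with minimum f r
... | j , j≤r , min with f j ≤? f (suc r)
...   | yes le = j , m≤n⇒m≤1+n j≤r , λ i i≤ → case-≤ i i≤
  where
  case-≤ : ∀ i → i ≤ suc r → f j ≤ f i
  case-≤ i i≤ with m≤n⇒m<n∨m≡n i≤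
  ... | inj₁ (s≤s i≤r) = min i i≤r
  ... | inj₂ refl = le
...   | no gt = suc r , ≤-refl , λ i i≤ → case-≤ i i≤
  where
  case-≤ : ∀ i → i ≤ suc r → f (suc r) ≤ f i
  case-≤ i i≤ with m≤n⇒m<n∨m≡n i≤
  ... | inj₁ (s≤s i≤r) = ≤-trans (<⇒≤ (≰⇒> gt)) (min i i≤r)
  ... | inj₂ refl = ≤-refl

-- With n = 2r + g and X as in Contraction: n^E ≤ c₁ C(g+i,E), D ≤ c₂ n^E, n^r ≤ c₃ N, n ≤ c₄ X, while c₅ replaces c₁ for
-- both exponents E and E − 1. The last three are the constants of ϕ-upper, ϕ-lower and ϕ-supermult′.
module Constants (s e : ℕ) where
  r₀ K₀ c₁ c₂ c₃ c₄ c₅ cA cB cC : ℕ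
  r₀ = s + suc e
  K₀ = suc (2 * r₀ * r₀ * r₀)
  c₁ = 4 ^ suc e * suc e !
  c₂ = r₀ C s
  c₃ = 2 ^ r₀ * r₀ !
  c₄ = K₀ + 2 * r₀
  c₅ = c₁ + 4 ^ e * e !
  cA = c₄ ^ s * c₁ * (2 + c₂ * c₃)
  cB = c₂ ^ suc (suc s) * c₃ * c₅ ^ suc s
  cC = c₁ * ((c₂ * c₁) * (c₂ * c₁))

-- C(d,k) p^(d-k) is one term of the binomial expansion of (p + 1)^d; the factor p^k avoids the
-- exponent d - k.
C*^≤^*^ : ∀ p k d → (d C k) * p ^ d ≤ p ^ k * suc p ^ d
C*^≤^*^ p zero d = subst (λ z → z * p ^ d ≤ 1 * suc p ^ d) (sym (nC0≡1 d)) (*-monoʳ-≤ 1 (^-monoˡ-≤ d (n≤1+n p)))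
C*^≤^*^ p (suc k) zero = z≤n
C*^≤^*^ p (suc k) (suc d) = begin
  (suc d C suc k) * (p * p ^ d) ≡⟨ cong (_* (p * p ^ d)) (nCk+nC[k+1]≡[n+1]C[k+1] d k) ⟨
  (d C k + d C suc k) * (p * p ^ d) ≡⟨ e₁ (d C k) (d C suc k) p (p ^ d) ⟩
  p * ((d C k) * p ^ d) + p * ((d C suc k) * p ^ d)
    ≤⟨ +-mono-≤ (*-monoʳ-≤ p (C*^≤^*^ p k d)) (*-monoʳ-≤ p (C*^≤^*^ p (suc k) d)) ⟩
  p * (p ^ k * suc p ^ d) + p * (p * p ^ k * suc p ^ d) ≡⟨ e₂ p (p ^ k) (suc p ^ d) ⟩
  p ^ suc k * suc p ^ suc d ∎
  where
  open ≤-Reasoning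
  e₁ : ∀ a b p x → (a + b) * (p * x) ≡ p * (a * x) + p * (b * x)
  e₁ = solve-∀
  e₂ : ∀ p x y → p * (x * y) + p * (p * x * y) ≡ p * x * (suc p * y)
  e₂ = solve-∀

-- The power d^(m+1) is at most a constant times C(d,m+1), hence is controlled by a single binomial
-- term; the surplus factor d outgrows the constant c.
poly≤exp : ∀ p m → ∃ λ d₀ → ∀ d → d₀ ≤ d → d ^ m * p ^ d ≤ suc p ^ d
poly≤exp p m = suc (2 * k + c) , bound
  where
  open ≤-Reasoning
  k = suc m
  c = 2 ^ k * k ! * p ^ k
  bound : ∀ d → suc (2 * k + c) ≤ d → d ^ m * p ^ d ≤ suc p ^ d
  bound d@(suc d-1) d₀≤d = *-cancelˡ-≤ d (begin
    d * (d ^ m * p ^ d) ≡⟨ *-assoc d (d ^ m) (p ^ d) ⟨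
    d ^ k * p ^ d ≤⟨ *-monoˡ-≤ (p ^ d) (^≤C d 2 d k k≤d d≤) ⟩
    2 ^ k * k ! * (d C k) * p ^ d ≡⟨ *-assoc (2 ^ k * k !) (d C k) (p ^ d) ⟩
    2 ^ k * k ! * ((d C k) * p ^ d) ≤⟨ *-monoʳ-≤ (2 ^ k * k !) (C*^≤^*^ p k d) ⟩
    2 ^ k * k ! * (p ^ k * suc p ^ d) ≡⟨ *-assoc (2 ^ k * k !) (p ^ k) (suc p ^ d) ⟨
    c * suc p ^ d ≤⟨ *-monoˡ-≤ (suc p ^ d) (≤-trans (≤-trans (m≤n+m c (2 * k)) (n≤1+n _)) d₀≤d) ⟩
    d * suc p ^ d ∎)
    where
    2k≤d : 2 * k ≤ d
    2k≤d = ≤-trans (≤-trans (m≤m+n (2 * k) c) (n≤1+n _)) d₀≤d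
    k≤d : k ≤ d
    k≤d = ≤-trans (m≤n*m k 2) 2k≤d
    d≤ : d ≤ 2 * (d ∸ k)
    d≤ = +-cancelʳ-≤ (2 * k) _ _ (begin
      d + 2 * k ≤⟨ +-monoʳ-≤ d 2k≤d ⟩
      d + d ≡⟨ e₁ d ⟩
      2 * d ≡⟨ cong (2 *_) (m∸n+n≡m k≤d) ⟨
      2 * (d ∸ k + k) ≡⟨ *-distribˡ-+ 2 (d ∸ k) k ⟩
      2 * (d ∸ k) + 2 * k ∎)
      where e₁ : ∀ d → d + d ≡ 2 * d
            e₁ = solve-∀

-- It is applied when n ≤ K τ² and τ ≤ 2 d + 4. The r-th power then bounds N, so the conclusion
-- gives N (p/(p+1))^d ≤ 1.
quadratic-poly≤exp : ∀ K r p → ∃ λ d₀ → ∀ d → d₀ ≤ d → (K * ((d + d + 4) * (d + d + 4))) ^ r * p ^ d ≤ suc p ^ d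
quadratic-poly≤exp K r p = d₁ + (K + 9) , bound
  where
  open ≤-Reasoning
  d₁ = proj₁ (poly≤exp p (4 * r))
  bound : ∀ d → d₁ + (K + 9) ≤ d → (K * ((d + d + 4) * (d + d + 4))) ^ r * p ^ d ≤ suc p ^ d
  bound d h = begin
    (K * ((d + d + 4) * (d + d + 4))) ^ r * p ^ d ≤⟨ *-monoˡ-≤ (p ^ d) (^-monoˡ-≤ r le) ⟩
    (d ^ 4) ^ r * p ^ d ≡⟨ cong (_* p ^ d) (^-*-assoc d 4 r) ⟩
    d ^ (4 * r) * p ^ d ≤⟨ proj₂ (poly≤exp p (4 * r)) d (≤-trans (m≤m+n d₁ _) h) ⟩
    suc p ^ d ∎
    where
    K≤d : K ≤ d
    K≤d = ≤-trans (≤-trans (m≤m+n K 9) (m≤n+m (K + 9) d₁)) h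
    9≤d : 9 ≤ d
    9≤d = ≤-trans (≤-trans (m≤n+m 9 K) (m≤n+m (K + 9) d₁)) h
    d+d+4≤ : d + d + 4 ≤ d * 3
    d+d+4≤ = ≤-trans (+-monoʳ-≤ (d + d) (≤-trans (m≤n+m 4 5) 9≤d)) (≤-reflexive (e₁ d))
      where e₁ : ∀ d → d + d + d ≡ d * 3
            e₁ = solve-∀
    le : K * ((d + d + 4) * (d + d + 4)) ≤ d ^ 4
    le = begin
      K * ((d + d + 4) * (d + d + 4)) ≤⟨ *-mono-≤ K≤d (*-mono-≤ d+d+4≤ d+d+4≤) ⟩
      d * (d * 3 * (d * 3)) ≡⟨ e₂ d ⟩
      9 * (d * (d * (d * 1))) ≤⟨ *-monoˡ-≤ (d * (d * (d * 1))) 9≤d ⟩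
      d ^ 4 ∎
      where e₂ : ∀ d → d * (d * 3 * (d * 3)) ≡ 9 * (d * (d * (d * 1)))
            e₂ = solve-∀

-- The powers of p/q sum to at most 1/(1 - p/q), which is q because q = p + 1.
geometric-sum : ∀ p (b : ℕ → ℕ) u v T → (∀ d → d < T → suc p ^ d * b d ≤ suc p ^ d * u + p ^ d * v) →
  ∑< T b ≤ T * u + suc p * v
geometric-sum p b u v T h = *-cancelˡ-≤ (q ^ T) {{m^n≢0 q T}} (≤-trans (m≤m+n _ _) (partial T ≤-refl))
  where
  open ≤-Reasoning
  q = suc p
  e₁ : ∀ q x y z → q * x * (y + z) ≡ q * (x * y) + q * (x * z)
  e₁ = solve-∀
  e₂ : ∀ p x s y v w → suc p * (x * s) + suc p * (y * v + w) + suc p * (p * y) * v ≡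
       suc p * (x * s + suc p * y * v) + suc p * w
  e₂ = solve-∀
  e₃ : ∀ q x T u v → q * (x * (T * u + q * v)) + q * (x * u) ≡ q * x * (u + T * u + q * v)
  e₃ = solve-∀
  -- The tail q (p/q)^k v of the series stays on the left, so that the induction closes.
  partial : ∀ k → k ≤ T → q ^ k * ∑< k b + q * p ^ k * v ≤ q ^ k * (k * u + q * v)
  partial zero _ = ≤-reflexive (e₅ q v)
    where e₅ : ∀ q v → 1 * 0 + q * 1 * v ≡ 1 * (q * v)
          e₅ = solve-∀
  partial (suc k) k<T = begin
    q ^ suc k * ∑< (suc k) b + q * p ^ suc k * v
      ≡⟨ cong (_+ q * p ^ suc k * v) (trans (cong (q ^ suc k *_) (∑<-last k b)) (e₁ q (q ^ k) (∑< k b) (b k))) ⟩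
    q * (q ^ k * ∑< k b) + q * (q ^ k * b k) + q * p ^ suc k * v
      ≤⟨ +-monoˡ-≤ (q * p ^ suc k * v) (+-monoʳ-≤ (q * (q ^ k * ∑< k b)) (*-monoʳ-≤ q
           (≤-trans (h k k<T) (≤-reflexive (+-comm (q ^ k * u) _))))) ⟩
    q * (q ^ k * ∑< k b) + q * (p ^ k * v + q ^ k * u) + q * p ^ suc k * v
      ≡⟨ e₂ p (q ^ k) (∑< k b) (p ^ k) v (q ^ k * u) ⟩
    q * (q ^ k * ∑< k b + q * p ^ k * v) + q * (q ^ k * u)
      ≤⟨ +-monoˡ-≤ (q * (q ^ k * u)) (*-monoʳ-≤ q (partial k (<⇒≤ k<T))) ⟩
    q * (q ^ k * (k * u + q * v)) + q * (q ^ k * u)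
      ≡⟨ e₃ q (q ^ k) k u v ⟩
    q ^ suc k * (suc k * u + q * v) ∎

-- Return counts under exponential mixing.

module ReturnBounds (p N D a : ℕ) {{N≢0 : NonZero N}} {{D≢0 : NonZero D}} (ϕ : ℕ → ℕ) (ϕ-0 : ϕ 0 ≡ 0)
  (upper : ∀ d → D * (suc p ^ d * (N * ϕ (suc d))) ≤ a * (D ^ suc (suc d) * (suc p ^ d * D + p ^ d * N))) where

  private
    q = suc p

  -- Divided by D q^d N, `upper` reads ϕ(d+1) ≤ a D^(d+2) (1/N + (p/q)^d / D), for closed walks with
  -- d + 2 edges. Under the hypothesis the second summand is at most 1/N too.
  ϕ-mixed : ∀ d → N * p ^ d ≤ q ^ d → N * ϕ (suc d) ≤ 2 * a * D ^ suc (suc d)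
  ϕ-mixed d mix = *-cancelˡ-≤ (q ^ d) {{m^n≢0 q d}} (*-cancelˡ-≤ D (begin
    D * (q ^ d * (N * ϕ (suc d))) ≤⟨ upper d ⟩
    a * (D ^ suc (suc d) * (q ^ d * D + p ^ d * N))
      ≤⟨ *-monoʳ-≤ a (*-monoʳ-≤ (D ^ suc (suc d)) (+-monoʳ-≤ (q ^ d * D)
           (≤-trans (≤-reflexive (*-comm (p ^ d) N)) (≤-trans mix (m≤m*n (q ^ d) D))))) ⟩
    a * (D ^ suc (suc d) * (q ^ d * D + q ^ d * D)) ≡⟨ e₁ a (D ^ suc (suc d)) (q ^ d) D ⟩
    D * (q ^ d * (2 * a * D ^ suc (suc d))) ∎))
    where
    open ≤-Reasoning
    e₁ : ∀ a x y D → a * (x * (y * D + y * D)) ≡ D * (y * (2 * a * x))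
    e₁ = solve-∀

  -- The longer of the two closed walks has at least half the total length, so it is mixed and
  -- contributes 2 a / N times a power of D. The other one is summed by `geometric-sum`, which
  -- produces L/N + q/D.
  convolution-bound : ∀ L → (∀ d → L ≤ d + d + 2 → N * p ^ d ≤ q ^ d) →
    D * (N * (N * ∑< (suc L) (λ i → ϕ i * ϕ (L ∸ i)))) ≤ 4 * a * a * (D ^ suc (suc L) * (L * D + q * N))
  convolution-bound L mix = begin
    D * (N * (N * ∑< (suc L) (λ i → ϕ i * ϕ (L ∸ i)))) ≤⟨ *-monoʳ-≤ D (*-monoʳ-≤ N split) ⟩
    D * (N * (4 * a * ∑< L (G ∘ suc))) ≡⟨ e₁ D N (4 * a) _ ⟩
    4 * a * (D * N * ∑< L (G ∘ suc)) ≡⟨ cong (4 * a *_) (∑<-*ˡ L (D * N) (G ∘ suc)) ⟨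
    4 * a * ∑< L (λ d → D * N * G (suc d)) ≤⟨ *-monoʳ-≤ (4 * a) (geometric-sum p _ (a * D ^ suc (suc L) * D) (a * D ^ suc (suc L) * N) L term) ⟩
    4 * a * (L * (a * D ^ suc (suc L) * D) + q * (a * D ^ suc (suc L) * N)) ≡⟨ e₂ a L (D ^ suc (suc L)) D q N ⟩
    4 * a * a * (D ^ suc (suc L) * (L * D + q * N)) ∎
    where
    open ≤-Reasoning
    e₁ : ∀ D N a g → D * (N * (a * g)) ≡ a * (D * N * g)
    e₁ = solve-∀
    e₂ : ∀ a L x D q N → 4 * a * (L * (a * x * D) + q * (a * x * N)) ≡ 4 * a * a * (x * (L * D + q * N))
    e₂ = solve-∀
    G : ℕ → ℕ
    G i = D ^ suc (L ∸ i) * ϕ i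
    big : ∀ i j → i + j ≡ L → L ≤ i + i → N * (ϕ i * ϕ j) ≤ 2 * a * G j
    big zero j i+j L≤ rewrite ϕ-0 | *-zeroʳ N = z≤n
    big (suc d) j refl L≤ = begin
      N * (ϕ (suc d) * ϕ j) ≡⟨ *-assoc N (ϕ (suc d)) (ϕ j) ⟨
      N * ϕ (suc d) * ϕ j ≤⟨ *-monoˡ-≤ (ϕ j) (ϕ-mixed d (mix d (≤-trans L≤ (≤-reflexive (e₃ d))))) ⟩
      2 * a * D ^ suc (suc d) * ϕ j ≡⟨ *-assoc (2 * a) (D ^ suc (suc d)) (ϕ j) ⟩
      2 * a * (D ^ suc (suc d) * ϕ j) ≡⟨ cong (λ z → 2 * a * (D ^ suc z * ϕ j)) (m+n∸n≡m (suc d) j) ⟨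
      2 * a * G j ∎
      where e₃ : ∀ d → suc d + suc d ≡ d + d + 2
            e₃ = solve-∀
    -- Taking the sum of the bounds for both cases avoids splitting the range at L/2. It only costs
    -- a factor 2, since `G (L ∸ i)` runs through `G i` in reverse.
    pair : ∀ i → i < suc L → N * (ϕ i * ϕ (L ∸ i)) ≤ 2 * a * (G i + G (L ∸ i))
    pair i (s≤s i≤L) with L ≤? i + i
    ... | yes L≤ = ≤-trans (big i (L ∸ i) (m+[n∸m]≡n i≤L) L≤) (*-monoʳ-≤ (2 * a) (m≤n+m (G (L ∸ i)) (G i)))
    ... | no L≰ = ≤-trans (≤-reflexive (cong (N *_) (*-comm (ϕ i) _)))
                    (≤-trans (big (L ∸ i) i (m∸n+n≡m i≤L) (begin
                        L ≡⟨ m+[n∸m]≡n i≤L ⟨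
                        i + (L ∸ i) ≤⟨ +-monoˡ-≤ (L ∸ i) (+-cancelˡ-≤ i _ _ (≤-trans (<⇒≤ (≰⇒> L≰)) (≤-reflexive (sym (m+[n∸m]≡n i≤L))))) ⟩
                        L ∸ i + (L ∸ i) ∎)) (*-monoʳ-≤ (2 * a) (m≤m+n (G i) (G (L ∸ i)))))
    split : N * ∑< (suc L) (λ i → ϕ i * ϕ (L ∸ i)) ≤ 4 * a * ∑< L (G ∘ suc)
    split = begin
      N * ∑< (suc L) (λ i → ϕ i * ϕ (L ∸ i)) ≡⟨ ∑<-*ˡ (suc L) N (λ i → ϕ i * ϕ (L ∸ i)) ⟨
      ∑< (suc L) (λ i → N * (ϕ i * ϕ (L ∸ i))) ≤⟨ ∑<-mono (suc L) pair ⟩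
      ∑< (suc L) (λ i → 2 * a * (G i + G (L ∸ i))) ≡⟨ ∑<-*ˡ (suc L) (2 * a) (λ i → G i + G (L ∸ i)) ⟩
      2 * a * ∑< (suc L) (λ i → G i + G (L ∸ i))
        ≡⟨ cong (2 * a *_) (trans (∑<-+ (suc L) G (λ i → G (L ∸ i))) (cong (∑< (suc L) G +_) (∑<-reverse (suc L) G))) ⟩
      2 * a * (∑< (suc L) G + ∑< (suc L) G) ≡⟨ e₄ a (∑< (suc L) G) ⟩
      4 * a * ∑< (suc L) G ≡⟨ cong (λ z → 4 * a * (z + ∑< L (G ∘ suc))) (trans (cong (D ^ suc L *_) ϕ-0) (*-zeroʳ (D ^ suc L))) ⟩
      4 * a * ∑< L (G ∘ suc) ∎
      where e₄ : ∀ a g → 2 * a * (g + g) ≡ 4 * a * g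
            e₄ = solve-∀
    term : ∀ d → d < L → q ^ d * (D * N * G (suc d)) ≤ q ^ d * (a * D ^ suc (suc L) * D) + p ^ d * (a * D ^ suc (suc L) * N)
    term d d<L = begin
      q ^ d * (D * N * (D ^ suc (L ∸ suc d) * ϕ (suc d))) ≡⟨ e₅ (q ^ d) D N (D ^ suc (L ∸ suc d)) (ϕ (suc d)) ⟩
      D ^ suc (L ∸ suc d) * (D * (q ^ d * (N * ϕ (suc d)))) ≤⟨ *-monoʳ-≤ (D ^ suc (L ∸ suc d)) (upper d) ⟩
      D ^ suc (L ∸ suc d) * (a * (D ^ suc (suc d) * (q ^ d * D + p ^ d * N))) ≡⟨ e₆ (D ^ suc (L ∸ suc d)) a (D ^ suc (suc d)) (q ^ d) D (p ^ d) N ⟩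
      q ^ d * (a * (D ^ suc (L ∸ suc d) * D ^ suc (suc d)) * D) + p ^ d * (a * (D ^ suc (L ∸ suc d) * D ^ suc (suc d)) * N)
        ≡⟨ cong (λ z → q ^ d * (a * z * D) + p ^ d * (a * z * N)) (trans (sym (^-distribˡ-+-* D (suc (L ∸ suc d)) (suc (suc d))))
             (cong (D ^_) (trans (e₇ (L ∸ suc d) d) (cong (λ z → suc (suc z)) (m∸n+n≡m d<L))))) ⟩
      q ^ d * (a * D ^ suc (suc L) * D) + p ^ d * (a * D ^ suc (suc L) * N) ∎
      where
      e₅ : ∀ q D N x f → q * (D * N * (x * f)) ≡ x * (D * (q * (N * f)))
      e₅ = solve-∀
      e₆ : ∀ x a y q D p N → x * (a * (y * (q * D + p * N))) ≡ q * (a * (x * y) * D) + p * (a * (x * y) * N)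
      e₆ = solve-∀
      e₇ : ∀ x d → suc x + suc (suc d) ≡ suc (suc (x + suc d))
      e₇ = solve-∀

-- (1 - P/Q)^J (1 + J P/Q) ≤ 1, cleared of denominators.
decay : ∀ Q P R (u : ℕ → ℕ) {{_ : NonZero Q}} → (∀ j → Q * u (suc j) + P * R * u j ≤ Q * R * u j) →
  ∀ J → (Q + J * P) * u J ≤ Q * R ^ J * u 0
decay Q P R u h zero = ≤-reflexive (e₁ Q (u 0))
  where e₁ : ∀ Q x → (Q + 0) * x ≡ Q * 1 * x
        e₁ = solve-∀
decay Q P R u h (suc J) = *-cancelˡ-≤ Q (+-cancelʳ-≤ (Q * (P * R * u J)) _ _ (begin
  Q * ((Q + suc J * P) * u (suc J)) + Q * (P * R * u J)
    ≤⟨ +-monoʳ-≤ (Q * ((Q + suc J * P) * u (suc J))) (*-monoˡ-≤ (P * R * u J) (m≤m+n Q (suc J * P))) ⟩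
  Q * ((Q + suc J * P) * u (suc J)) + (Q + suc J * P) * (P * R * u J)
    ≡⟨ e₁ Q (Q + suc J * P) (u (suc J)) (P * R * u J) ⟩
  (Q + suc J * P) * (Q * u (suc J) + P * R * u J)
    ≤⟨ *-monoʳ-≤ (Q + suc J * P) (h J) ⟩
  (Q + suc J * P) * (Q * R * u J)
    ≡⟨ e₂ Q J P R (u J) ⟩
  Q * (R * ((Q + J * P) * u J)) + Q * (P * R * u J)
    ≤⟨ +-monoˡ-≤ (Q * (P * R * u J)) (*-monoʳ-≤ Q (*-monoʳ-≤ R (decay Q P R u h J))) ⟩
  Q * (R * (Q * R ^ J * u 0)) + Q * (P * R * u J)
    ≡⟨ cong (λ z → Q * z + Q * (P * R * u J)) (e₃ R Q (R ^ J) (u 0)) ⟩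
  Q * (Q * R ^ suc J * u 0) + Q * (P * R * u J) ∎))
  where
  open ≤-Reasoning
  e₁ : ∀ Q x y z → Q * (x * y) + x * z ≡ x * (Q * y + z)
  e₁ = solve-∀
  e₂ : ∀ Q J P R u → (Q + suc J * P) * (Q * R * u) ≡ Q * (R * ((Q + J * P) * u)) + Q * (P * R * u)
  e₂ = solve-∀
  e₃ : ∀ R Q x u → R * (Q * x * u) ≡ Q * (R * x) * u
  e₃ = solve-∀

-- S/tot is at most Q/(Q + Z), hence at most w/(w + 1) once Z ≥ Q/w. This converts `decay` into a
-- fixed positive proportion of walks that meet themselves.
fraction : ∀ Q Z S tot w {{_ : NonZero Q}} → (Q + Z) * S ≤ Q * tot → Q ≤ w * Z → suc w * S ≤ w * tot
fraction Q Z S tot w h Q≤ = *-cancelˡ-≤ Q (begin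
  Q * (suc w * S) ≡⟨ e₁ Q w S ⟩
  S * (w * Q + Q) ≤⟨ *-monoʳ-≤ S (+-monoʳ-≤ (w * Q) Q≤) ⟩
  S * (w * Q + w * Z) ≡⟨ e₂ S w Q Z ⟩
  w * ((Q + Z) * S) ≤⟨ *-monoʳ-≤ w h ⟩
  w * (Q * tot) ≡⟨ e₃ w Q tot ⟩
  Q * (w * tot) ∎)
  where
  open ≤-Reasoning
  e₁ : ∀ Q w S → Q * (suc w * S) ≡ S * (w * Q + Q)
  e₁ = solve-∀
  e₂ : ∀ S w Q Z → S * (w * Q + w * Z) ≡ w * ((Q + Z) * S)
  e₂ = solve-∀
  e₃ : ∀ w Q t → w * (Q * t) ≡ Q * (w * t)
  e₃ = solve-∀

-- At least a proportion 1/(w + 1) of the `tot` free walks meets itself, and each of these accounts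
-- for κ closed walks that are missing from `mono`.
gap : ∀ w κ mono hom S tot → mono + κ * tot ≤ hom + κ * S → suc w * S ≤ w * tot → κ * tot ≤ suc w * (hom ∸ mono)
gap w κ mono hom S tot h S≤ = begin
  κ * tot ≤⟨ m+n≤o⇒n≤o∸m (+-cancelʳ-≤ (κ * (w * tot)) _ _ (begin
    suc w * mono + κ * tot + κ * (w * tot) ≡⟨ e₁ w mono κ tot ⟩
    suc w * (mono + κ * tot) ≤⟨ *-monoʳ-≤ (suc w) h ⟩
    suc w * (hom + κ * S) ≡⟨ e₂ w hom κ S ⟩
    suc w * hom + κ * (suc w * S) ≤⟨ +-monoʳ-≤ (suc w * hom) (*-monoʳ-≤ κ S≤) ⟩
    suc w * hom + κ * (w * tot) ∎)) ⟩
  suc w * hom ∸ suc w * mono ≡⟨ *-distribˡ-∸ (suc w) hom mono ⟨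
  suc w * (hom ∸ mono) ∎
  where
  open ≤-Reasoning
  m+n≤o⇒n≤o∸m : ∀ {x y z} → x + y ≤ z → y ≤ z ∸ x
  m+n≤o⇒n≤o∸m {x} {y} le = ≤-trans (≤-reflexive (sym (m+n∸m≡n x y))) (∸-monoˡ-≤ x le)
  e₁ : ∀ w m κ t → suc w * m + κ * t + κ * (w * t) ≡ suc w * (m + κ * t)
  e₁ = solve-∀
  e₂ : ∀ w h κ S → suc w * (h + κ * S) ≡ suc w * h + κ * (suc w * S)
  e₂ = solve-∀

square-cancel-< : ∀ A {x y} → A * (x * x) < A * (y * y) → x ≤ y
square-cancel-< A h = ≮⇒≥ (λ y<x → <⇒≱ h (*-monoʳ-≤ A (*-mono-≤ (<⇒≤ y<x) (<⇒≤ y<x))))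

^2≡* : ∀ x → x ^ 2 ≡ x * x
^2≡* x = cong (x *_) (*-identityʳ x)

-- Here `Dτ` stands for D^τ. The first three bounds give coin ≤ 4 a a b (τ²/N + q τ/D) hom, and K
-- makes each of the two terms at most hom/(2 k).
collision-arith : ∀ k a b q-1 N D L Dτ hom Σϕ coin {{_ : NonZero N}} {{_ : NonZero D}} →
  let q = suc q-1; τ = suc (suc L); K = suc (8 * k * a * a * b * q) in
  D * (N * (N * Σϕ)) ≤ 4 * a * a * (Dτ * (L * D + q * N)) → Dτ ≤ b * hom → coin ≤ N * (τ * Σϕ) →
  K * τ ≤ D → (K * τ) ^ 2 ≤ N → k * coin ≤ hom
collision-arith k a b q-1 N D L Dτ hom Σϕ coin conv low coin≤ Kτ≤D Kτ²≤N = *-cancelˡ-≤ (2 * (D * N)) {{m*n≢0 2 (D * N) {{_}} {{m*n≢0 D N}}}} (begin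
  2 * (D * N) * (k * coin) ≤⟨ *-monoʳ-≤ (2 * (D * N)) (*-monoʳ-≤ k coin≤) ⟩
  2 * (D * N) * (k * (N * (τ * Σϕ))) ≡⟨ e₁ D N k τ Σϕ ⟩
  2 * (k * τ) * (D * (N * (N * Σϕ))) ≤⟨ *-monoʳ-≤ (2 * (k * τ)) conv ⟩
  2 * (k * τ) * (4 * a * a * (Dτ * (L * D + q * N)))
    ≤⟨ *-monoʳ-≤ (2 * (k * τ)) (*-monoʳ-≤ (4 * a * a) (*-mono-≤ low (+-monoˡ-≤ (q * N) (*-monoˡ-≤ D (≤-trans (n≤1+n L) (n≤1+n _)))))) ⟩
  2 * (k * τ) * (4 * a * a * (b * hom * (τ * D + q * N))) ≡⟨ e₂ k τ a b hom D q N ⟩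
  hom * (w * (τ * τ) * D + w * q * τ * N) ≤⟨ *-monoʳ-≤ hom (+-mono-≤ term₁ (*-monoˡ-≤ N (≤-trans (*-monoˡ-≤ τ (n≤1+n (w * q))) Kτ≤D))) ⟩
  hom * (D * N + D * N) ≡⟨ e₃ hom (D * N) ⟩
  2 * (D * N) * hom ∎)
  where
  open ≤-Reasoning
  q = suc q-1
  τ = suc (suc L)
  w = 8 * k * a * a * b
  K = suc (w * q)
  e₁ : ∀ D N k τ S → 2 * (D * N) * (k * (N * (τ * S))) ≡ 2 * (k * τ) * (D * (N * (N * S)))
  e₁ = solve-∀
  e₂ : ∀ k τ a b h D q N → 2 * (k * τ) * (4 * a * a * (b * h * (τ * D + q * N))) ≡
       h * (8 * k * a * a * b * (τ * τ) * D + 8 * k * a * a * b * q * τ * N)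
  e₂ = solve-∀
  e₃ : ∀ h x → h * (x + x) ≡ 2 * x * h
  e₃ = solve-∀
  term₁ : w * (τ * τ) * D ≤ D * N
  term₁ = begin
    w * (τ * τ) * D ≤⟨ *-monoˡ-≤ D (*-monoˡ-≤ (τ * τ) (≤-trans (m≤m*n w q) (n≤1+n _))) ⟩
    K * (τ * τ) * D ≤⟨ *-monoˡ-≤ D (*-monoˡ-≤ (τ * τ) (m≤m*n K K)) ⟩
    K * K * (τ * τ) * D ≡⟨ cong (_* D) (e₄ K τ) ⟩
    (K * τ) * (K * τ) * D ≤⟨ *-monoˡ-≤ D (≤-trans (≤-reflexive (sym (^2≡* (K * τ)))) Kτ²≤N) ⟩
    N * D ≡⟨ *-comm N D ⟩
    D * N ∎
    where e₄ : ∀ K τ → K * K * (τ * τ) ≡ (K * τ) * (K * τ)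
          e₄ = solve-∀

-- The graph G(n,r,s) with r = s + 1 + e and n = 2r + g; D is its degree N₁.
module Johnson (s e g : ℕ) where

  -- Neighbour sums in the generalized Johnson graph.

  E r n D N : ℕ
  E = suc e
  r = s + E
  n = r + r + g
  D = (r C s) * ((r + g) C E)
  N = n C r

  -- T h i = Σ h(|w ∩ v|) over the neighbours w of u, where |u ∩ v| = i; a, b, c, d are the numbers of elements that w has in
  -- u ∩ v, u ∖ v, v ∖ u and outside u ∪ v.
  T : (ℕ → ℕ) → ℕ → ℕ
  T h i = ∑C i (λ a → ∑C (r ∸ i) (λ b → δ (a + b) s *
            ∑C (r ∸ i) (λ c → ∑C (g + i) (λ d → δ (c + d) E * h (a + c)))))

  n∸r : n ∸ r ≡ r + g
  n∸r = trans (cong (_∸ r) (+-assoc r r g)) (m+n∸m≡n r (r + g))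

  N₁≡D : N₁ n r s ≡ D
  N₁≡D = cong₂ (λ x y → (r C s) * (x C y)) n∸r (m+n∸m≡n s E)

  s≤r : s ≤ r
  s≤r = m≤m+n s E

  T-ext : ∀ {h k} i → (∀ a → h a ≡ k a) → T h i ≡ T k i
  T-ext i eq = ∑C-ext i (λ a → ∑C-ext (r ∸ i) (λ b → cong (δ (a + b) s *_)
    (∑C-ext (r ∸ i) (λ c → ∑C-ext (g + i) (λ d → cong (δ (c + d) E *_) (eq (a + c)))))))

  T-mono : ∀ {h k} i → i ≤ r → (∀ a → a ≤ r → h a ≤ k a) → T h i ≤ T k i
  T-mono i i≤r le = ∑C-mono i (λ a a≤i → ∑C-mono (r ∸ i) (λ b _ → *-monoʳ-≤ (δ (a + b) s)
    (∑C-mono (r ∸ i) (λ c c≤ → ∑C-mono (g + i) (λ d _ → *-monoʳ-≤ (δ (c + d) E)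
      (le (a + c) (≤-trans (+-mono-≤ a≤i c≤) (≤-reflexive (m+[n∸m]≡n i≤r)))))))))

  T-+ : ∀ h k i → T (λ a → h a + k a) i ≡ T h i + T k i
  T-+ h k i = trans (∑C-ext i (λ a → trans (∑C-ext (r ∸ i) (λ b → trans (cong (δ (a + b) s *_)
      (trans (∑C-ext (r ∸ i) (λ c → trans (∑C-ext (g + i) (λ d → *-distribˡ-+ (δ (c + d) E) (h (a + c)) (k (a + c))))
        (∑C-+ (g + i) _ _))) (∑C-+ (r ∸ i) _ _))) (*-distribˡ-+ (δ (a + b) s) _ _))) (∑C-+ (r ∸ i) _ _))) (∑C-+ i _ _)

  T-*ˡ : ∀ x h i → T (λ a → x * h a) i ≡ x * T h i
  T-*ˡ x h i = trans (∑C-ext i (λ a → trans (∑C-ext (r ∸ i) (λ b → trans (cong (δ (a + b) s *_)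
      (trans (∑C-ext (r ∸ i) (λ c → trans (∑C-ext (g + i) (λ d → sw (δ (c + d) E) (h (a + c))))
        (∑C-*ˡ (g + i) x _))) (∑C-*ˡ (r ∸ i) x _))) (sw (δ (a + b) s) _))) (∑C-*ˡ (r ∸ i) x _))) (∑C-*ˡ i x _)
    where sw : ∀ y z → y * (x * z) ≡ x * (y * z)
          sw = e' x
            where e' : ∀ x y z → y * (x * z) ≡ x * (y * z)
                  e' = solve-∀

  -- X^(a+c) = X^a X^c, and the kept elements of u and the new elements outside u are chosen
  -- independently.
  T-^ : ∀ X i → T (X ^_) i ≡ el X i (r ∸ i) s * el X (r ∸ i) (g + i) E
  T-^ X i = trans (∑C-ext i (λ a → trans (∑C-ext (r ∸ i) (λ b → trans (cong (δ (a + b) s *_) (inner a))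
      (sym (*-assoc (δ (a + b) s) (X ^ a) Q)))) (∑C-*ʳ (r ∸ i) Q _))) (∑C-*ʳ i Q _)
    where
    Q = el X (r ∸ i) (g + i) E
    e' : ∀ x y z → x * (y * z) ≡ y * (x * z)
    e' = solve-∀
    inner : ∀ a → ∑C (r ∸ i) (λ c → ∑C (g + i) (λ d → δ (c + d) E * X ^ (a + c))) ≡ X ^ a * Q
    inner a = trans (∑C-ext (r ∸ i) (λ c → trans (∑C-ext (g + i) (λ d →
        trans (cong (δ (c + d) E *_) (^-distribˡ-+-* X a c)) (e' (δ (c + d) E) (X ^ a) (X ^ c))))
        (∑C-*ˡ (g + i) (X ^ a) _))) (∑C-*ˡ (r ∸ i) (X ^ a) _)

  el-1 : ∀ p q k → el 1 p q k ≡ (p + q) C k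
  el-1 p q k = trans (∑C-ext p (λ a → ∑C-ext q (λ b → trans (cong (δ (a + b) k *_) (^-zeroˡ a)) (*-identityʳ _)))) (∑C-δ+ p q k)

  r∸i+g+i : ∀ i → i ≤ r → r ∸ i + (g + i) ≡ r + g
  r∸i+g+i i i≤r = trans (e' (r ∸ i) g i) (cong (_+ g) (m∸n+n≡m i≤r))
    where e' : ∀ x g i → x + (g + i) ≡ x + i + g
          e' = solve-∀

  T-1 : ∀ i → i ≤ r → T (λ _ → 1) i ≡ D
  T-1 i i≤r = trans (T-ext i (λ a → sym (^-zeroˡ a))) (trans (T-^ 1 i) (cong₂ _*_
    (trans (el-1 i (r ∸ i) s) (cong (_C s) (m+[n∸m]≡n i≤r)))
    (trans (el-1 (r ∸ i) (g + i) E) (cong (_C E) (r∸i+g+i i i≤r)))))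

  T-const : ∀ x i → i ≤ r → T (λ _ → x) i ≡ x * D
  T-const x i i≤r = trans (T-ext i (λ a → sym (*-identityʳ x))) (trans (T-*ˡ x (λ _ → 1) i) (cong (x *_) (T-1 i i≤r)))

  δ-subst : ∀ a k (h : ℕ → ℕ) → δ a k * h a ≡ δ a k * h k
  δ-subst a k h with ⟦⟧-bit (a ≟ k)
  ... | inj₁ eq rewrite eq = refl
  ... | inj₂ (eq , refl) = refl

  T-r : ∀ h → T h r ≡ D * h s
  T-r h rewrite n∸n≡0 r = begin
    ∑C r (λ a → δ (a + 0) s * ∑C (g + r) (λ d → δ d E * h (a + 0)))
      ≡⟨ ∑C-ext r (λ a → trans (cong (λ z → δ z s * ∑C (g + r) (λ d → δ d E * h z)) (+-identityʳ a))
           (trans (δ-subst a s (λ z → ∑C (g + r) (λ d → δ d E * h z)))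
             (cong (δ a s *_) (trans (∑C-*ʳ (g + r) (h s) _) (cong (_* h s) (∑C-δ (g + r) E)))))) ⟩
    ∑C r (λ a → δ a s * (((g + r) C E) * h s))
      ≡⟨ ∑C-*ʳ r _ _ ⟩
    ∑C r (λ a → δ a s) * (((g + r) C E) * h s)
      ≡⟨ cong₂ (λ x y → x * ((y C E) * h s)) (∑C-δ r s) (+-comm g r) ⟩
    (r C s) * (((r + g) C E) * h s)
      ≡⟨ *-assoc (r C s) _ _ ⟨
    D * h s ∎
    where open ≡-Reasoning

  -- Only neighbours with the given counts are kept, and in three of the regions only one choice of
  -- them; the region outside u ∪ v keeps its full binomial coefficient, which carries the power of
  -- n.
  T-≥ : ∀ h i a b c d → a ≤ i → b ≤ r ∸ i → c ≤ r ∸ i → a + b ≡ s → c + d ≡ E →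
        ((g + i) C d) * h (a + c) ≤ T h i
  T-≥ h i a b c d a≤ b≤ c≤ a+b≡s c+d≡E = begin
    ((g + i) C d) * h (a + c) ≡⟨ cong (_* h (a + c)) (∑C-δ (g + i) d) ⟨
    ∑C (g + i) (λ d' → δ d' d) * h (a + c) ≡⟨ ∑C-*ʳ (g + i) (h (a + c)) _ ⟨
    ∑C (g + i) (λ d' → δ d' d * h (a + c))
      ≡⟨ ∑C-ext (g + i) (λ d' → cong (_* h (a + c)) (⟦⟧-iff (d' ≟ d) (c + d' ≟ E)
           (λ { refl → c+d≡E }) (λ eq → +-cancelˡ-≡ c d' d (trans eq (sym c+d≡E))))) ⟩
    ∑C (g + i) (λ d' → δ (c + d') E * h (a + c)) ≤⟨ ∑C-≥ (r ∸ i) c _ c≤ ⟩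
    ∑C (r ∸ i) (λ c → ∑C (g + i) (λ d → δ (c + d) E * h (a + c))) ≡⟨ +-identityʳ _ ⟨
    1 * ∑C (r ∸ i) (λ c → ∑C (g + i) (λ d → δ (c + d) E * h (a + c)))
      ≡⟨ cong (_* _) (⟦⟧-yes (a + b ≟ s) a+b≡s) ⟨
    δ (a + b) s * ∑C (r ∸ i) (λ c → ∑C (g + i) (λ d → δ (c + d) E * h (a + c)))
      ≤⟨ ∑C-≥ (r ∸ i) b (λ b → δ (a + b) s * ∑C (r ∸ i) (λ c → ∑C (g + i) (λ d → δ (c + d) E * h (a + c)))) b≤ ⟩
    _ ≤⟨ ∑C-≥ i a (λ a → ∑C (r ∸ i) (λ b → δ (a + b) s * ∑C (r ∸ i) (λ c → ∑C (g + i) (λ d → δ (c + d) E * h (a + c))))) a≤ ⟩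
    T h i ∎
    where open ≤-Reasoning

  V : List (Subset n)
  V = JVertices n r

  ∈V⇒card : ∀ {u} → u ∈ V → ∣ u ∣ ≡ r
  ∈V⇒card {u} u∈V = proj₂ (∈-filter⁻ (λ x → ∣ x ∣ ≟ r) {u} {allSubsets n} u∈V)

  ∑V : ∀ (G : Subset n → ℕ) → ∑ V G ≡ ∑ (allSubsets n) (λ w → δ (∣ w ∣) r * G w)
  ∑V G = ∑-filter (λ x → ∣ x ∣ ≟ r) (allSubsets n) G

  adj : Subset n → Subset n → ℕ
  adj u w = δ (∣ u ∩ w ∣) s

  -- With p = |u ∩ v|, the other regions have r - p, r - p and g + p elements; once a + b = s, the
  -- condition |w| = r becomes c + d = E.
  ∑V-adj : ∀ h {u v} → u ∈ V → v ∈ V → ∑ V (λ w → adj u w * h (∣ w ∩ v ∣)) ≡ T h (∣ u ∩ v ∣)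
  ∑V-adj h {u} {v} u∈ v∈ = trans (∑V _)
    (trans (∑-allSubsets n u v (λ x y z → δ x r * (δ y s * h z)))
    (trans (cong₂ (λ q l → ∑C p (λ a → ∑C q (λ b → ∑C (∣ ∁ u ∩ v ∣) (λ c → ∑C l (λ d → M a b c d))))) q≡ l≡)
    (trans (cong (λ m → ∑C p (λ a → ∑C (r ∸ p) (λ b → ∑C m (λ c → ∑C (g + p) (λ d → M a b c d))))) m≡)
    (∑C-ext p (λ a → ∑C-ext (r ∸ p) (λ b → trans (∑C-ext (r ∸ p) (λ c → trans (∑C-ext (g + p) (λ d → δδ a b c d))
       (∑C-*ˡ (g + p) (δ (a + b) s) _))) (∑C-*ˡ (r ∸ p) (δ (a + b) s) _)))))))
    where
    p = ∣ u ∩ v ∣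
    M : ℕ → ℕ → ℕ → ℕ → ℕ
    M a b c d = δ (a + b + c + d) r * (δ (a + b) s * h (a + c))
    q≡ : ∣ u ∩ ∁ v ∣ ≡ r ∸ p
    q≡ = trans (sym (m+n∸m≡n p _)) (cong (_∸ p) (trans (∣u∩v∣+∣u∩∁v∣ u v) (∈V⇒card u∈)))
    p+m : p + ∣ ∁ u ∩ v ∣ ≡ r
    p+m = trans (cong₂ _+_ (∩-comm-card u v) (∩-comm-card (∁ u) v)) (trans (∣u∩v∣+∣u∩∁v∣ v u) (∈V⇒card v∈))
    m≡ : ∣ ∁ u ∩ v ∣ ≡ r ∸ p
    m≡ = trans (sym (m+n∸m≡n p _)) (cong (_∸ p) p+m)
    ∁u : ∣ ∁ u ∣ ≡ r + g
    ∁u = +-cancelˡ-≡ r _ _ (trans (cong (_+ ∣ ∁ u ∣) (sym (∈V⇒card u∈))) (trans (∣u∣+∣∁u∣ u) (+-assoc r r g)))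
    l≡ : ∣ ∁ u ∩ ∁ v ∣ ≡ g + p
    l≡ = +-cancelˡ-≡ (∣ ∁ u ∩ v ∣) _ _ (trans (∣u∩v∣+∣u∩∁v∣ (∁ u) v) (trans ∁u
           (trans (cong (_+ g) (sym p+m)) (e' p (∣ ∁ u ∩ v ∣) g))))
      where e' : ∀ p m g → p + m + g ≡ m + (g + p)
            e' = solve-∀
    δδ : ∀ a b c d → M a b c d ≡ δ (a + b) s * (δ (c + d) E * h (a + c))
    δδ a b c d with ⟦⟧-bit (a + b ≟ s)
    ... | inj₁ eq rewrite eq = *-zeroʳ (δ (a + b + c + d) r)
    ... | inj₂ (eq , ab) rewrite eq = trans (cong₂ _*_ (⟦⟧-iff (a + b + c + d ≟ r) (c + d ≟ E) to from) (*-identityˡ _)) (sym (*-identityˡ _))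
      where
      to : a + b + c + d ≡ r → c + d ≡ E
      to p = +-cancelˡ-≡ (a + b) _ _ (trans (sym (+-assoc (a + b) c d)) (trans p (cong (_+ E) (sym ab))))
      from : c + d ≡ E → a + b + c + d ≡ r
      from p = trans (+-assoc (a + b) c d) (cong₂ _+_ ab p)

  ∣V∣ : length V ≡ N
  ∣V∣ = trans (length-filter-∑ (λ x → ∣ x ∣ ≟ r) (allSubsets n)) (count n r)
    where
    count : ∀ n r → ∑ (allSubsets n) (λ x → δ (∣ x ∣) r) ≡ n C r
    count zero zero = refl
    count zero (suc r) = refl
    count (suc n) zero = trans (∑-allSubsets-suc n _) (trans (cong₂ _+_ (count n zero)
      (trans (∑-ext (allSubsets n) (λ _ → refl)) (∑-0 (allSubsets n)))) (trans (+-identityʳ _) (trans (nC0≡1 n) (sym (nC0≡1 (suc n))))))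
    count (suc n) (suc r) = trans (∑-allSubsets-suc n _) (trans (cong₂ _+_ (count n (suc r))
      (trans (∑-ext (allSubsets n) (λ x → δ-suc (∣ x ∣) r)) (count n r))) (trans (+-comm (n C suc r) _) (nCk+nC[k+1]≡[n+1]C[k+1] n r)))

  ∣∩∣≤r : ∀ {u v} → u ∈ V → ∣ u ∩ v ∣ ≤ r
  ∣∩∣≤r {u} {v} u∈ = ≤-trans (m≤m+n _ _) (≤-reflexive (trans (∣u∩v∣+∣u∩∁v∣ u v) (∈V⇒card u∈)))

  ∣u∩u∣ : ∀ {u} → u ∈ V → ∣ u ∩ u ∣ ≡ r
  ∣u∩u∣ {u} u∈ = trans (∩-idem-card u) (∈V⇒card u∈)

  adj-bit : ∀ x y → adj x y ≡ 0 ⊎ adj x y ≡ 1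
  adj-bit x y with ⟦⟧-bit (∣ x ∩ y ∣ ≟ s)
  ... | inj₁ p = inj₁ p
  ... | inj₂ (p , _) = inj₂ p

  adj-sym : ∀ x y → adj x y ≡ adj y x
  adj-sym x y = cong (λ z → δ z s) (∩-comm-card x y)

  adj⇒ : ∀ x y → adj x y ≡ 1 → ∣ x ∩ y ∣ ≡ s
  adj⇒ x y p with ⟦⟧-bit (∣ x ∩ y ∣ ≟ s)
  ... | inj₁ q = contradiction (trans (sym p) q) λ ()
  ... | inj₂ (_ , q) = q

  degree-V : ∀ {x} → x ∈ V → ∑ V (adj x) ≡ D
  degree-V {x} x∈ = trans (∑-ext V (λ w → sym (*-identityʳ (adj x w))))
    (trans (∑V-adj (λ _ → 1) x∈ x∈) (T-1 _ (∣∩∣≤r x∈)))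

  pick-V : ∀ {y} → y ∈ V → (G : Subset n → ℕ) → ∑ V (λ w → ⟦ y ≟ₛ w ⟧ * G w) ≡ G y
  pick-V {y} y∈ G = trans (∑V _) (trans (∑-ext (allSubsets n) (λ w → e' (δ (∣ w ∣) r) ⟦ y ≟ₛ w ⟧ (G w)))
    (trans (∑-pick-allSubsets y (λ w → δ (∣ w ∣) r * G w))
      (trans (cong (_* G y) (⟦⟧-yes (∣ y ∣ ≟ r) (∈V⇒card y∈))) (*-identityˡ _))))
    where e' : ∀ a b c → a * (b * c) ≡ b * (a * c)
          e' = solve-∀

  open Walks _≟ₛ_ V adj D adj-bit adj-sym degree-V pick-V

  -- F d i counts the walks with d + 1 edges between two vertices u, v with |u ∩ v| = i, and ϕ d the closed ones at a vertex.
  F : ℕ → ℕ → ℕ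
  F zero i = δ i s
  F (suc d) i = T (F d) i

  wlk≡F : ∀ d {x z} → x ∈ V → z ∈ V → wlk d x z ≡ F d (∣ x ∩ z ∣)
  wlk≡F zero x∈ z∈ = refl
  wlk≡F (suc d) {x} {z} x∈ z∈ =
    trans (∑-cong V (λ {y} y∈ → cong (adj x y *_) (wlk≡F d y∈ z∈))) (∑V-adj (F d) x∈ z∈)

  ϕ : ℕ → ℕ
  ϕ d = F d r

  wlk-diag : ∀ d {x} → x ∈ V → wlk d x x ≡ ϕ d
  wlk-diag d x∈ = trans (wlk≡F d x∈ x∈) (cong (F d) (∣u∩u∣ x∈))

  -- Cycle homomorphisms as closed walks.

  Chain : ∀ {m} → Subset n → Vec (Subset n) m → Subset n → Set
  Chain {m} x φ z = (∀ i j → suc (toℕ i) ≡ toℕ j → JAdj s (lookup (x ∷ φ) i) (lookup (x ∷ φ) j))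
                  × (∀ i → toℕ i ≡ m → JAdj s (lookup (x ∷ φ) i) z)

  -- The end z is left free for the induction; for z = x the two halves of `Chain` are the two
  -- alternatives of `Next`.
  ch⇒Chain : ∀ {m} x (φ : Vec (Subset n) m) z → ch x φ z ≡ 1 → Chain x φ z
  ch⇒Chain x [] z p = (λ { zero zero () ; zero (suc ()) _ }) , λ { zero _ → adj⇒ x z p }
  ch⇒Chain x (y ∷ φ) z p with ch⇒Chain y φ z (m*n≡1⇒n≡1 (adj x y) _ p)
  ... | c₁ , c₂ = (λ { zero zero () ; zero (suc zero) _ → adj⇒ x y (m*n≡1⇒m≡1 (adj x y) _ p)
                     ; zero (suc (suc j)) () ; (suc i) zero () ; (suc i) (suc j) q → c₁ i j (suc-injective q) })
                , λ { zero () ; (suc i) q → c₂ i (suc-injective q) }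

  Chain⇒ch : ∀ {m} x (φ : Vec (Subset n) m) z → Chain x φ z → ch x φ z ≡ 1
  Chain⇒ch x [] z (_ , c₂) = ⟦⟧-yes (∣ x ∩ z ∣ ≟ s) (c₂ zero refl)
  Chain⇒ch x (y ∷ φ) z (c₁ , c₂) = cong₂ _*_ (⟦⟧-yes (∣ x ∩ y ∣ ≟ s) (c₁ zero (suc zero) refl))
    (Chain⇒ch y φ z ((λ i j q → c₁ (suc i) (suc j) (cong suc q)) , λ i q → c₂ (suc i) (cong suc q)))

  ch-bit : ∀ {m} x (φ : Vec (Subset n) m) z → IsBit (ch x φ z)
  ch-bit x [] z = adj-bit x z
  ch-bit x (y ∷ φ) z = *-bit (adj-bit x y) (ch-bit y φ z)

  isHom-ch : ∀ {L} x (φ : Vec (Subset n) L) → ⟦ isHom? n s (suc L) (x ∷ φ) ⟧ ≡ ch x φ x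
  isHom-ch {L} x φ = ⟦⟧-bit-≡ (isHom? n s (suc L) (x ∷ φ)) (ch-bit x φ x)
    (λ h → Chain⇒ch x φ x ((λ i j q → h i j (inj₁ (inj₁ q))) , λ i q → h i zero (inj₁ (inj₂ (cong suc q , refl)))))
    (λ p → from (ch⇒Chain x φ x p))
    where
    from : Chain x φ x → IsHom n s (suc L) (x ∷ φ)
    from (c₁ , c₂) = λ { i j (inj₁ q) → next i j q
                       ; i j (inj₂ q) → trans (∩-comm-card (lookup (x ∷ φ) i) (lookup (x ∷ φ) j)) (next j i q) }
      where
      next : ∀ i j → Next (suc L) i j → JAdj s (lookup (x ∷ φ) i) (lookup (x ∷ φ) j)
      next i j (inj₁ q) = c₁ i j q
      next i zero (inj₂ (q , _)) = c₂ i (suc-injective q)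
      next i (suc j) (inj₂ (_ , ()))

  ni⇒ : ∀ {m} x (φ : Vec (Subset n) m) → ni x φ ≡ 1 → ∀ i → x ≢ lookup φ i
  ni⇒ x (y ∷ φ) p zero x≡y = contradiction (trans (sym (m*n≡1⇒m≡1 (1 ∸ eq x y) _ p)) (cong (1 ∸_) (⟦⟧-yes (x ≟ₛ y) x≡y))) λ ()
  ni⇒ x (y ∷ φ) p (suc i) = ni⇒ x φ (m*n≡1⇒n≡1 (1 ∸ eq x y) _ p) i

  ⇒ni : ∀ {m} x (φ : Vec (Subset n) m) → (∀ i → x ≢ lookup φ i) → ni x φ ≡ 1
  ⇒ni x [] h = refl
  ⇒ni x (y ∷ φ) h = cong₂ _*_ (cong (1 ∸_) (⟦⟧-no (x ≟ₛ y) (h zero))) (⇒ni x φ (h ∘ suc))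

  nd⇒ : ∀ {m} (φ : Vec (Subset n) m) → nd φ ≡ 1 → IsInjective φ
  nd⇒ (x ∷ φ) p zero zero _ = refl
  nd⇒ (x ∷ φ) p zero (suc j) q = contradiction q (ni⇒ x φ (m*n≡1⇒m≡1 (ni x φ) _ p) j)
  nd⇒ (x ∷ φ) p (suc i) zero q = contradiction (sym q) (ni⇒ x φ (m*n≡1⇒m≡1 (ni x φ) _ p) i)
  nd⇒ (x ∷ φ) p (suc i) (suc j) q = cong suc (nd⇒ φ (m*n≡1⇒n≡1 (ni x φ) _ p) i j q)

  ⇒nd : ∀ {m} (φ : Vec (Subset n) m) → IsInjective φ → nd φ ≡ 1
  ⇒nd [] h = refl
  ⇒nd (x ∷ φ) h = cong₂ _*_ (⇒ni x φ (λ i q → contradiction (h zero (suc i) q) λ ()))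
    (⇒nd φ (λ i j q → sucF-injective (h (suc i) (suc j) q)))

  homC≡homS : ∀ L → homC (suc L) n r s ≡ homS L
  homC≡homS L = trans (length-filter-∑ (isHom? n s (suc L)) (allVecs V (suc L)))
    (trans (∑-allVecs-suc V L (λ φ → ⟦ isHom? n s (suc L) φ ⟧))
    (∑-ext V (λ x → ∑-ext (allVecs V L) (λ φ → isHom-ch x φ))))

  monoC≡monoS : ∀ L → monoC (suc L) n r s ≡ monoS L
  monoC≡monoS L = trans (length-filter-∑ (λ φ → isHom? n s (suc L) φ ×-dec isInjective? φ) (allVecs V (suc L)))
    (trans (∑-allVecs-suc V L (λ φ → ⟦ isHom? n s (suc L) φ ×-dec isInjective? φ ⟧))
    (∑-ext V (λ x → ∑-ext (allVecs V L) (λ φ → trans (⟦×⟧ (isHom? n s (suc L) (x ∷ φ)) (isInjective? (x ∷ φ)))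
      (cong₂ _*_ (isHom-ch x φ) (⟦⟧-bit-≡ (isInjective? (x ∷ φ)) (nd-bit (x ∷ φ)) (⇒nd (x ∷ φ)) (nd⇒ (x ∷ φ))))))))

  homS≡Nϕ : ∀ L → homS L ≡ N * ϕ L
  homS≡Nϕ L = trans (homS≡ L) (trans (∑-cong V (λ x∈ → wlk-diag L x∈)) (trans (∑-const V (ϕ L)) (cong (_* ϕ L) ∣V∣)))

  coinS-bound : ∀ L → coinS L ≤ N * (suc L * ∑< L (λ i → ϕ i * ϕ (L ∸ suc i)))
  coinS-bound L = ≤-trans (coinS≤ ϕ wlk-diag L) (≤-reflexive (cong (_* (suc L * ∑< L (λ i → ϕ i * ϕ (L ∸ suc i)))) ∣V∣))

  ϕ-suc : ∀ d → ϕ (suc d) ≡ D * F d s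
  ϕ-suc d = T-r (F d)

  ϕ-0 : ϕ 0 ≡ 0
  ϕ-0 = ⟦⟧-no (r ≟ s) (λ q → m+1+n≢m s q)

  -- p/q is the contraction rate. The kept elements contribute (1 + (r-1) X^i)/r, the new ones at
  -- most 2r/(2r-1), and the product is (2 + p X^i)/q. The second factor has to be this close to 1
  -- to leave a rate below 1.
  p q : ℕ
  p = 2 * (s + e)
  q = suc p

  r≡ : r ≡ suc (s + e)
  r≡ = +-suc s e

  -- Contraction of the walk operator.

  module Contraction (B : ℕ) (flat : (B * (2 * r * r) + 1) * E ≤ r + g) where

    X : ℕ
    X = suc B

    T-contract : ∀ i → i ≤ r → q * T (X ^_) i ≤ D * (2 + p * X ^ i)
    T-contract i i≤r = *-cancelˡ-≤ (suc (s + e)) (begin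
      suc (s + e) * (q * T (X ^_) i)
        ≡⟨ cong (λ z → suc (s + e) * (q * z)) (T-^ X i) ⟩
      suc (s + e) * (q * (el₁ * el₂))
        ≡⟨ e₁ (suc (s + e)) q el₁ el₂ ⟩
      (suc (s + e) * el₁) * (q * el₂)
        ≤⟨ *-mono-≤ h₁ h₂ ⟩
      (suc (s + e) C s) * (1 + (s + e) * X ^ i) * (2 * r * ((r + g) C E))
        ≡⟨ cong₂ (λ y z → (y C s) * (1 + (s + e) * X ^ i) * (2 * z * ((r + g) C E))) (sym r≡) r≡ ⟩
      (r C s) * (1 + (s + e) * X ^ i) * (2 * suc (s + e) * ((r + g) C E))
        ≡⟨ e₂ (r C s) (s + e) (X ^ i) ((r + g) C E) ⟩
      suc (s + e) * (D * (2 + p * X ^ i)) ∎)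
      where
      open ≤-Reasoning
      el₁ = el X i (r ∸ i) s
      el₂ = el X (r ∸ i) (g + i) E
      e₁ : ∀ r q x y → r * (q * (x * y)) ≡ (r * x) * (q * y)
      e₁ = solve-∀
      e₂ : ∀ c t x d → c * (1 + t * x) * (2 * suc t * d) ≡ suc t * (c * d * (2 + 2 * t * x))
      e₂ = solve-∀
      h₁ : suc (s + e) * el₁ ≤ (suc (s + e) C s) * (1 + (s + e) * X ^ i)
      h₁ = el-contract B s e i (r ∸ i) (trans (m+[n∸m]≡n i≤r) r≡)
      -- With Y = 2 r² one has z = Y - m ≥ 2 r² - r = r q, so the factor Y/z of `el-flat` is at most
      -- 2 r/q.
      Y = 2 * r * r
      m = r ∸ i
      r≤Y : r ≤ Y
      r≤Y = subst (λ r → r ≤ 2 * r * r) (sym r≡) (m≤n*m (suc (s + e)) (2 * suc (s + e)))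
      z = Y ∸ m
      m+z : m + z ≡ Y
      m+z = m+[n∸m]≡n (≤-trans (m∸n≤m r i) r≤Y)
      rq≤z : r * q ≤ z
      rq≤z = +-cancelˡ-≤ m _ _ (begin
        m + r * q ≤⟨ +-monoˡ-≤ (r * q) (m∸n≤m r i) ⟩
        r + r * q ≡⟨ cong (λ r → r + r * q) r≡ ⟩
        suc (s + e) + suc (s + e) * q ≡⟨ e₃ (s + e) ⟩
        2 * suc (s + e) * suc (s + e) ≡⟨ cong (λ r → 2 * r * r) r≡ ⟨
        Y ≡⟨ m+z ⟨
        m + z ∎)
        where e₃ : ∀ t → suc t + suc t * suc (2 * t) ≡ 2 * suc t * suc t
              e₃ = solve-∀
      h₂ : q * el₂ ≤ 2 * r * ((r + g) C E)
      h₂ = *-cancelˡ-≤ (suc (s + e)) (begin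
        suc (s + e) * (q * el₂) ≡⟨ cong (_* (q * el₂)) r≡ ⟨
        r * (q * el₂) ≡⟨ *-assoc r q el₂ ⟨
        r * q * el₂ ≤⟨ *-monoˡ-≤ el₂ rq≤z ⟩
        z * el₂ ≤⟨ el-flat B m z (g + i) E (subst₂ (λ y w → (B * y + 1) * E ≤ w) (sym m+z) (sym (r∸i+g+i i i≤r)) flat) ⟩
        (m + z) * ((m + (g + i)) C E) ≡⟨ cong₂ (λ y w → y * (w C E)) m+z (r∸i+g+i i i≤r) ⟩
        2 * r * r * ((r + g) C E) ≡⟨ e₄ r ((r + g) C E) ⟩
        r * (2 * r * ((r + g) C E)) ≡⟨ cong (_* (2 * r * ((r + g) C E))) r≡ ⟩
        suc (s + e) * (2 * r * ((r + g) C E)) ∎)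
        where e₄ : ∀ r c → 2 * r * r * c ≡ r * (2 * r * c)
              e₄ = solve-∀

    -- The fixed point of x ↦ (2 + p x)/q is 2, so the excess of (2 + X^i) over it shrinks by p/q at every step.
    F-decay : ∀ d i → i ≤ r → q ^ d * (X ^ s * F d i) + 2 * (p ^ d * D ^ d) ≤ D ^ d * (2 * q ^ d + p ^ d * X ^ i)
    F-decay zero i i≤r = subst₂ _≤_ (e₁ (X ^ s * δ i s)) (e₂ (X ^ i)) (+-monoˡ-≤ 2 start)
      where
      start : X ^ s * δ i s ≤ X ^ i
      start with ⟦⟧-bit (i ≟ s)
      ... | inj₁ eq rewrite eq | *-zeroʳ (X ^ s) = z≤n
      ... | inj₂ (eq , refl) rewrite eq = ≤-reflexive (*-identityʳ _)
      e₁ : ∀ x → x + 2 ≡ 1 * x + 2 * (1 * 1)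
      e₁ = solve-∀
      e₂ : ∀ x → x + 2 ≡ 1 * (2 * 1 + 1 * x)
      e₂ = solve-∀
    -- The term added on both sides completes 2 p^(d+1) to 2 q p^d, because p + 1 = q; the induction
    -- hypothesis can then be used inside `T`.
    F-decay (suc d) i i≤r = +-cancelʳ-≤ (2 * (p ^ d * D ^ suc d)) _ _ (begin
      q ^ suc d * (X ^ s * F (suc d) i) + 2 * (p ^ suc d * D ^ suc d) + 2 * (p ^ d * D ^ suc d)
        ≡⟨ e₁ p (q ^ d) (X ^ s) (F (suc d) i) (p ^ d) (D ^ d) D ⟩
      q * (q ^ d * X ^ s * F (suc d) i + 2 * (p ^ d * D ^ d) * D)
        ≡⟨ cong (q *_) (trans (cong₂ _+_ (sym (T-*ˡ (q ^ d * X ^ s) (F d) i)) (sym (T-const (2 * (p ^ d * D ^ d)) i i≤r)))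
             (sym (T-+ (λ a → q ^ d * X ^ s * F d a) (λ _ → 2 * (p ^ d * D ^ d)) i))) ⟩
      q * T (λ a → q ^ d * X ^ s * F d a + 2 * (p ^ d * D ^ d)) i
        ≤⟨ *-monoʳ-≤ q (T-mono i i≤r (λ a a≤r → subst₂ _≤_
             (cong (_+ 2 * (p ^ d * D ^ d)) (sym (*-assoc (q ^ d) (X ^ s) (F d a))))
             (e₂ (D ^ d) (2 * q ^ d) (p ^ d) (X ^ a)) (F-decay d a a≤r))) ⟩
      q * T (λ a → D ^ d * (2 * q ^ d) + D ^ d * p ^ d * X ^ a) i
        ≡⟨ cong (q *_) (trans (T-+ (λ _ → D ^ d * (2 * q ^ d)) (λ a → D ^ d * p ^ d * X ^ a) i) (cong₂ _+_ (T-const (D ^ d * (2 * q ^ d)) i i≤r) (T-*ˡ (D ^ d * p ^ d) (X ^_) i))) ⟩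
      q * (D ^ d * (2 * q ^ d) * D + D ^ d * p ^ d * T (X ^_) i)
        ≡⟨ e₃ q (D ^ d) (q ^ d) D (p ^ d) (T (X ^_) i) ⟩
      D ^ suc d * (2 * q ^ suc d) + D ^ d * p ^ d * (q * T (X ^_) i)
        ≤⟨ +-monoʳ-≤ (D ^ suc d * (2 * q ^ suc d)) (*-monoʳ-≤ (D ^ d * p ^ d) (T-contract i i≤r)) ⟩
      D ^ suc d * (2 * q ^ suc d) + D ^ d * p ^ d * (D * (2 + p * X ^ i))
        ≡⟨ e₄ (D ^ d) D (q ^ suc d) (p ^ d) p (X ^ i) ⟩
      D ^ suc d * (2 * q ^ suc d + p ^ suc d * X ^ i) + 2 * (p ^ d * D ^ suc d) ∎)
      where
      open ≤-Reasoning
      e₁ : ∀ p qd xs f pd Dd D → suc p * qd * (xs * f) + 2 * (p * pd * (D * Dd)) + 2 * (pd * (D * Dd)) ≡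
                               suc p * (qd * xs * f + 2 * (pd * Dd) * D)
      e₁ = solve-∀
      e₂ : ∀ D x y z → D * (x + y * z) ≡ D * x + D * y * z
      e₂ = solve-∀
      e₃ : ∀ q Dd qd D pd t → q * (Dd * (2 * qd) * D + Dd * pd * t) ≡ D * Dd * (2 * (q * qd)) + Dd * pd * (q * t)
      e₃ = solve-∀
      e₄ : ∀ Dd D q' pd p x → D * Dd * (2 * q') + Dd * pd * (D * (2 + p * x)) ≡ D * Dd * (2 * q' + p * pd * x) + 2 * (pd * (D * Dd))
      e₄ = solve-∀

    -- `F-decay` at i = r would leave X^r. The first step of a closed walk always leads to an
    -- intersection of size s, and starting there saves X^(r-s), which has the order of D.
    ϕ-decay : ∀ d → q ^ d * (X ^ s * ϕ (suc d)) ≤ D ^ suc d * (2 * q ^ d + p ^ d * X ^ s)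
    ϕ-decay d = begin
      q ^ d * (X ^ s * ϕ (suc d)) ≡⟨ cong (λ z → q ^ d * (X ^ s * z)) (ϕ-suc d) ⟩
      q ^ d * (X ^ s * (D * F d s)) ≡⟨ e₁ (q ^ d) (X ^ s) D (F d s) ⟩
      D * (q ^ d * (X ^ s * F d s)) ≤⟨ *-monoʳ-≤ D (≤-trans (m≤m+n _ _) (F-decay d s s≤r)) ⟩
      D * (D ^ d * (2 * q ^ d + p ^ d * X ^ s)) ≡⟨ *-assoc D (D ^ d) _ ⟨
      D ^ suc d * (2 * q ^ d + p ^ d * X ^ s) ∎
      where
      open ≤-Reasoning
      e₁ : ∀ q x D f → q * (x * (D * f)) ≡ D * (q * (x * f))
      e₁ = solve-∀

  -- Products of return counts.

  Q : ℕ
  Q = (g + s) C E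

  -- A neighbour w of u that keeps exactly u ∩ v and takes its E new elements outside u ∪ v still
  -- meets v in s elements, and there are Q of these.
  F-s-step : ∀ d → Q * F d s ≤ F (suc d) s
  F-s-step d = ≤-trans (≤-reflexive (cong (λ z → Q * F d z) (sym (+-identityʳ s))))
    (T-≥ (F d) s s 0 0 E ≤-refl z≤n z≤n (+-identityʳ s) refl)

  -- Of the closed walks from x, only those whose vertex after i + 1 steps is a neighbour of x are
  -- kept.
  ϕ-glue : ∀ i j {x} → x ∈ V → D * (F i s * F j s) ≤ ϕ (suc (i + j))
  ϕ-glue i j {x} x∈ = begin
    D * (F i s * F j s) ≡⟨ cong (_* (F i s * F j s)) (degree-V x∈) ⟨
    ∑ V (adj x) * (F i s * F j s) ≡⟨ ∑-*ʳ V _ _ ⟨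
    ∑ V (λ y → adj x y * (F i s * F j s)) ≤⟨ ∑-mono V le ⟩
    ∑ V (λ y → wlk i x y * wlk j y x) ≡⟨ wlk-++ i j x x ⟨
    wlk (suc (i + j)) x x ≡⟨ wlk-diag (suc (i + j)) x∈ ⟩
    ϕ (suc (i + j)) ∎
    where
    open ≤-Reasoning
    le : ∀ {y} → y ∈ V → adj x y * (F i s * F j s) ≤ wlk i x y * wlk j y x
    le {y} y∈ with ⟦⟧-bit (∣ x ∩ y ∣ ≟ s)
    ... | inj₁ h rewrite h = z≤n
    ... | inj₂ (h , xy) rewrite h = ≤-reflexive (trans (*-identityˡ _) (sym (cong₂ _*_
           (trans (wlk≡F i x∈ y∈) (cong (F i) xy))
           (trans (wlk≡F j y∈ x∈) (cong (F j) (trans (∩-comm-card y x) xy))))))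

  -- Two closed walks from x meet again at x after i + 1 steps. Moving that meeting point to any of
  -- the D neighbours of x costs a factor D/Q for either walk, and Q will turn out to have the order
  -- of D; the gain is therefore of order D.
  ϕ-supermult : ∀ i j {x} → x ∈ V → Q * Q * (ϕ i * ϕ j) ≤ D * ϕ (suc (i + j))
  ϕ-supermult zero j x∈ = subst (λ z → Q * Q * (z * ϕ j) ≤ D * ϕ (suc j)) (sym ϕ-0) (≤-trans (≤-reflexive (*-zeroʳ (Q * Q))) z≤n)
  ϕ-supermult (suc i) zero x∈ = subst (λ z → Q * Q * (ϕ (suc i) * z) ≤ D * ϕ (suc (suc i + 0))) (sym ϕ-0)
    (≤-trans (≤-reflexive (trans (cong (Q * Q *_) (*-zeroʳ (ϕ (suc i)))) (*-zeroʳ (Q * Q)))) z≤n)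
  ϕ-supermult (suc i) (suc j) x∈ = begin
    Q * Q * (ϕ (suc i) * ϕ (suc j)) ≡⟨ cong₂ (λ y z → Q * Q * (y * z)) (ϕ-suc i) (ϕ-suc j) ⟩
    Q * Q * (D * F i s * (D * F j s)) ≡⟨ e₁ Q D (F i s) (F j s) ⟩
    D * (D * (Q * F i s * (Q * F j s))) ≤⟨ *-monoʳ-≤ D (*-monoʳ-≤ D (*-mono-≤ (F-s-step i) (F-s-step j))) ⟩
    D * (D * (F (suc i) s * F (suc j) s)) ≤⟨ *-monoʳ-≤ D (ϕ-glue (suc i) (suc j) x∈) ⟩
    D * ϕ (suc (suc i + suc j)) ∎
    where
    open ≤-Reasoning
    e₁ : ∀ Q D x y → Q * Q * (D * x * (D * y)) ≡ D * (D * (Q * x * (Q * y)))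
    e₁ = solve-∀

  -- Orders of magnitude for large n.

  module Estimates (large : 6 * r ≤ g) where

    open Constants s e

    E≤r : E ≤ r
    E≤r = m≤n+m E s

    1≤r : 1 ≤ r
    1≤r = ≤-trans (s≤s z≤n) E≤r

    n≤4[g+i∸k] : ∀ i k → k ≤ E → n ≤ 4 * (g + i ∸ k)
    n≤4[g+i∸k] i k k≤E = begin
      n ≤⟨ +-cancelʳ-≤ (4 * r) n (4 * (g ∸ r)) (begin
        r + r + g + 4 * r ≡⟨ e₁ r g ⟩
        6 * r + g ≤⟨ +-mono-≤ large (m≤n+m g (g + g)) ⟩
        g + (g + g + g) ≡⟨ e₂ g ⟩
        4 * g ≡⟨ cong (4 *_) (m∸n+n≡m r≤g) ⟨
        4 * (g ∸ r + r) ≡⟨ *-distribˡ-+ 4 (g ∸ r) r ⟩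
        4 * (g ∸ r) + 4 * r ∎) ⟩
      4 * (g ∸ r) ≤⟨ *-monoʳ-≤ 4 (∸-mono (m≤m+n g i) (≤-trans k≤E E≤r)) ⟩
      4 * (g + i ∸ k) ∎
      where
      open ≤-Reasoning
      r≤g : r ≤ g
      r≤g = ≤-trans (m≤n*m r 6) large
      e₁ : ∀ r g → r + r + g + 4 * r ≡ 6 * r + g
      e₁ = solve-∀
      e₂ : ∀ g → g + (g + g + g) ≡ 4 * g
      e₂ = solve-∀

    E≤g+i : ∀ i → E ≤ g + i
    E≤g+i i = ≤-trans E≤r (≤-trans (≤-trans (m≤n*m r 6) large) (m≤m+n g i))

    n^E≤ : ∀ i → n ^ E ≤ c₁ * ((g + i) C E)
    n^E≤ i = ^≤C n 4 (g + i) E (E≤g+i i) (n≤4[g+i∸k] i E ≤-refl)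

    n^e≤ : ∀ i → n ^ e ≤ 4 ^ e * e ! * ((g + i) C e)
    n^e≤ i = ^≤C n 4 (g + i) e (≤-trans (n≤1+n e) (E≤g+i i)) (n≤4[g+i∸k] i e (n≤1+n e))

    1≤c₂ : 1 ≤ c₂
    1≤c₂ = factor-pos (r C s) (^≤C 1 1 r s s≤r (≤-trans (m<n⇒0<n∸m (s<r)) (≤-reflexive (sym (*-identityˡ _)))))
      where
      s<r : s < r
      s<r = m<m+n s (s≤s z≤n)
      factor-pos : ∀ x → 1 ^ s ≤ 1 ^ s * s ! * x → 1 ≤ x
      factor-pos zero h = contradiction (subst₂ _≤_ (^-zeroˡ s) (*-zeroʳ (1 ^ s * s !)) h) λ ()
      factor-pos (suc x) _ = s≤s z≤n

    n^E≤D : n ^ E ≤ c₁ * D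
    n^E≤D = ≤-trans (n^E≤ r) (*-monoʳ-≤ c₁ (≤-trans (≤-reflexive (trans (cong (_C E) (+-comm g r)) (sym (*-identityˡ _))))
      (*-monoˡ-≤ ((r + g) C E) 1≤c₂)))

    D≤n^E : D ≤ c₂ * n ^ E
    D≤n^E = *-monoʳ-≤ c₂ (≤-trans (C≤^ (r + g) E) (^-monoˡ-≤ E (+-monoˡ-≤ g (m≤m+n r r))))

    D≤Q : D ≤ (c₂ * c₁) * Q
    D≤Q = ≤-trans D≤n^E (≤-trans (*-monoʳ-≤ c₂ (n^E≤ s)) (≤-reflexive (sym (*-assoc c₂ c₁ _))))

    1≤n : 1 ≤ n
    1≤n = ≤-trans 1≤r (≤-trans (m≤m+n r r) (m≤m+n (r + r) g))

    instance
      n≢0 : NonZero n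
      n≢0 = >-nonZero 1≤n

    n≤n^ : ∀ k → 1 ≤ k → n ≤ n ^ k
    n≤n^ k 1≤k = ≤-trans (≤-reflexive (sym (^-identityʳ n))) (^-monoʳ-≤ n 1≤k)

    n≤D : n ≤ c₁ * D
    n≤D = ≤-trans (n≤n^ E (s≤s z≤n)) n^E≤D

    pos-factor : ∀ c {x y} → 1 ≤ x → x ≤ c * y → 1 ≤ y
    pos-factor c {y = zero} 1≤x h = contradiction (≤-trans 1≤x (≤-trans h (≤-reflexive (*-zeroʳ c)))) λ ()
    pos-factor c {y = suc y} _ _ = s≤s z≤n

    1≤D : 1 ≤ D
    1≤D = pos-factor c₁ 1≤n n≤D

    instance
      D≢0 : NonZero D
      D≢0 = >-nonZero 1≤D

    n^r≤N : n ^ r ≤ c₃ * N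
    n^r≤N = ^≤C n 2 n r (≤-trans (m≤m+n r r) (m≤m+n (r + r) g)) (begin
      r + r + g ≤⟨ +-monoʳ-≤ (r + r) (m≤m+n g g) ⟩
      r + r + (g + g) ≡⟨ e₁ r g ⟩
      2 * (r + g) ≡⟨ cong (2 *_) n∸r ⟨
      2 * (n ∸ r) ∎)
      where
      open ≤-Reasoning
      e₁ : ∀ r g → r + r + (g + g) ≡ 2 * (r + g)
      e₁ = solve-∀

    N≤n^r : N ≤ n ^ r
    N≤n^r = C≤^ n r

    n≤N : n ≤ c₃ * N
    n≤N = ≤-trans (n≤n^ r 1≤r) n^r≤N

    1≤N : 1 ≤ N
    1≤N = pos-factor c₃ 1≤n n≤N

    instance
      N≢0 : NonZero N
      N≢0 = >-nonZero 1≤N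

    vertex : ∃ λ x → x ∈ V
    vertex with V | ∣V∣
    ... | [] | eq = contradiction (≤-trans 1≤N (≤-reflexive (sym eq))) λ ()
    ... | x ∷ _ | _ = x , here refl

    ϕ-supermult′ : ∀ i j → n * (ϕ i * ϕ j) ≤ cC * ϕ (suc (i + j))
    ϕ-supermult′ i j = begin
      n * z ≤⟨ *-monoˡ-≤ z n≤D ⟩
      c₁ * D * z ≡⟨ *-assoc c₁ D z ⟩
      c₁ * (D * z) ≤⟨ *-monoʳ-≤ c₁ main ⟩
      c₁ * (c * c * ϕ (suc (i + j))) ≡⟨ *-assoc c₁ (c * c) _ ⟨
      cC * ϕ (suc (i + j)) ∎
      where
      open ≤-Reasoning
      z = ϕ i * ϕ j
      c = c₂ * c₁
      e₁ : ∀ c Q z → c * Q * (c * Q) * z ≡ c * c * (Q * Q * z)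
      e₁ = solve-∀
      e₂ : ∀ c D x → c * (D * x) ≡ D * (c * x)
      e₂ = solve-∀
      main : D * z ≤ c * c * ϕ (suc (i + j))
      main = *-cancelˡ-≤ D (begin
        D * (D * z) ≡⟨ *-assoc D D z ⟨
        D * D * z ≤⟨ *-monoˡ-≤ z (*-mono-≤ D≤Q D≤Q) ⟩
        c * Q * (c * Q) * z ≡⟨ e₁ c Q z ⟩
        c * c * (Q * Q * z) ≤⟨ *-monoʳ-≤ (c * c) (ϕ-supermult i j (proj₂ vertex)) ⟩
        c * c * (D * ϕ (suc (i + j))) ≡⟨ e₂ (c * c) D _ ⟩
        D * (c * c * ϕ (suc (i + j))) ∎)

    -- X should be of order n, but `Contraction` requires roughly B · 2 r² · E ≤ g. As E ≤ r,
    -- dividing g by `K₀` = 2 r³ + 1 achieves both.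
    B₀ : ℕ
    B₀ = g / K₀

    flat₀ : (B₀ * (2 * r * r) + 1) * E ≤ r + g
    flat₀ = begin
      (B₀ * (2 * r * r) + 1) * E ≤⟨ *-monoʳ-≤ (B₀ * (2 * r * r) + 1) E≤r ⟩
      (B₀ * (2 * r * r) + 1) * r ≡⟨ e₁ B₀ r ⟩
      r + B₀ * (2 * r * r * r) ≤⟨ +-monoʳ-≤ r (≤-trans (*-monoʳ-≤ B₀ (n≤1+n (2 * r * r * r))) (m/n*n≤m g K₀)) ⟩
      r + g ∎
      where
      open ≤-Reasoning
      e₁ : ∀ B r → (B * (2 * r * r) + 1) * r ≡ r + B * (2 * r * r * r)
      e₁ = solve-∀

    open Contraction B₀ flat₀

    n≤X : n ≤ c₄ * X
    n≤X = begin
      r + r + g ≤⟨ +-monoʳ-≤ (r + r) g≤ ⟩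
      r + r + K₀ * X ≤⟨ +-monoˡ-≤ (K₀ * X) (≤-trans (≤-reflexive (e₁ r)) (m≤m*n (2 * r) X)) ⟩
      2 * r * X + K₀ * X ≡⟨ *-distribʳ-+ X (2 * r) K₀ ⟨
      (2 * r + K₀) * X ≡⟨ cong (_* X) (+-comm (2 * r) K₀) ⟩
      c₄ * X ∎
      where
      open ≤-Reasoning
      g≤ : g ≤ K₀ * X
      g≤ = begin
        g ≡⟨ m≡m%n+[m/n]*n g K₀ ⟩
        g % K₀ + B₀ * K₀ ≤⟨ +-monoˡ-≤ (B₀ * K₀) (<⇒≤ (m%n<n g K₀)) ⟩
        X * K₀ ≡⟨ *-comm X K₀ ⟩
        K₀ * X ∎
      e₁ : ∀ r → r + r ≡ 2 * r
      e₁ = solve-∀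

    X≤n : X ≤ n
    X≤n = begin
      suc B₀ ≤⟨ s≤s (≤-trans (m≤m*n B₀ K₀) (m/n*n≤m g K₀)) ⟩
      suc g ≤⟨ +-monoˡ-≤ g (≤-trans 1≤r (m≤m+n r r)) ⟩
      n ∎
      where open ≤-Reasoning

    -- X^s D and N both have the order n^r, so that the term 1/X^s that comes from `ϕ-decay` can be
    -- replaced by a multiple of D/N.
    ϕ-upper : ∀ d → D * (q ^ d * (N * ϕ (suc d))) ≤ cA * (D ^ suc (suc d) * (q ^ d * D + p ^ d * N))
    ϕ-upper d = begin
      D * (qd * (N * f)) ≡⟨ e₁ D qd N f ⟩
      N * (D * (qd * f)) ≤⟨ *-monoˡ-≤ (D * (qd * f)) N≤ ⟩
      c₄ ^ s * c₁ * (X ^ s * D) * (D * (qd * f)) ≡⟨ e₂ (c₄ ^ s * c₁) (X ^ s) D qd f ⟩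
      c₄ ^ s * c₁ * (D * D * (qd * (X ^ s * f))) ≤⟨ *-monoʳ-≤ (c₄ ^ s * c₁) (*-monoʳ-≤ (D * D) (ϕ-decay d)) ⟩
      c₄ ^ s * c₁ * (D * D * (D ^ suc d * (2 * qd + pd * X ^ s))) ≡⟨ e₃ (c₄ ^ s * c₁) D (D ^ suc d) qd pd (X ^ s) ⟩
      c₄ ^ s * c₁ * (D ^ suc (suc d) * (2 * (qd * D) + pd * (X ^ s * D)))
        ≤⟨ *-monoʳ-≤ (c₄ ^ s * c₁) (*-monoʳ-≤ (D ^ suc (suc d)) (+-monoʳ-≤ (2 * (qd * D)) (*-monoʳ-≤ pd X^sD≤))) ⟩
      c₄ ^ s * c₁ * (D ^ suc (suc d) * (2 * (qd * D) + pd * (c₂ * c₃ * N)))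
        ≤⟨ *-monoʳ-≤ (c₄ ^ s * c₁) (*-monoʳ-≤ (D ^ suc (suc d)) mix) ⟩
      c₄ ^ s * c₁ * (D ^ suc (suc d) * ((2 + c₂ * c₃) * (qd * D + pd * N)))
        ≡⟨ e₅ (c₄ ^ s * c₁) (D ^ suc (suc d)) (2 + c₂ * c₃) _ ⟩
      cA * (D ^ suc (suc d) * (qd * D + pd * N)) ∎
      where
      open ≤-Reasoning
      qd = q ^ d
      pd = p ^ d
      f = ϕ (suc d)
      e₁ : ∀ D q N f → D * (q * (N * f)) ≡ N * (D * (q * f))
      e₁ = solve-∀
      e₂ : ∀ c x D q f → c * (x * D) * (D * (q * f)) ≡ c * (D * D * (q * (x * f)))
      e₂ = solve-∀
      e₃ : ∀ c D d q p x → c * (D * D * (d * (2 * q + p * x))) ≡ c * (D * d * (2 * (q * D) + p * (x * D)))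
      e₃ = solve-∀
      e₄ : ∀ u w x → (2 + w) * (u + x) ≡ 2 * u + w * x + (w * u + 2 * x)
      e₄ = solve-∀
      e₅ : ∀ a b c d → a * (b * (c * d)) ≡ a * c * (b * d)
      e₅ = solve-∀
      e₆ : ∀ p w N → p * (w * N) ≡ w * (p * N)
      e₆ = solve-∀
      mix : 2 * (qd * D) + pd * (c₂ * c₃ * N) ≤ (2 + c₂ * c₃) * (qd * D + pd * N)
      mix = begin
        2 * (qd * D) + pd * (c₂ * c₃ * N) ≡⟨ cong (2 * (qd * D) +_) (e₆ pd (c₂ * c₃) N) ⟩
        2 * (qd * D) + c₂ * c₃ * (pd * N) ≤⟨ m≤m+n _ _ ⟩
        2 * (qd * D) + c₂ * c₃ * (pd * N) + (c₂ * c₃ * (qd * D) + 2 * (pd * N)) ≡⟨ e₄ (qd * D) (c₂ * c₃) (pd * N) ⟨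
        (2 + c₂ * c₃) * (qd * D + pd * N) ∎
      N≤ : N ≤ c₄ ^ s * c₁ * (X ^ s * D)
      N≤ = begin
        N ≤⟨ N≤n^r ⟩
        n ^ (s + E) ≡⟨ ^-distribˡ-+-* n s E ⟩
        n ^ s * n ^ E ≤⟨ *-mono-≤ (≤-trans (^-monoˡ-≤ s n≤X) (≤-reflexive (^-distribʳ-* c₄ X s))) n^E≤D ⟩
        c₄ ^ s * X ^ s * (c₁ * D) ≡⟨ e₇ (c₄ ^ s) (X ^ s) c₁ D ⟩
        c₄ ^ s * c₁ * (X ^ s * D) ∎
        where e₇ : ∀ a b c d → a * b * (c * d) ≡ a * c * (b * d)
              e₇ = solve-∀
      X^sD≤ : X ^ s * D ≤ c₂ * c₃ * N
      X^sD≤ = begin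
        X ^ s * D ≤⟨ *-mono-≤ (^-monoˡ-≤ s X≤n) D≤n^E ⟩
        n ^ s * (c₂ * n ^ E) ≡⟨ e₈ (n ^ s) c₂ (n ^ E) ⟩
        c₂ * (n ^ s * n ^ E) ≡⟨ cong (c₂ *_) (^-distribˡ-+-* n s E) ⟨
        c₂ * n ^ r ≤⟨ *-monoʳ-≤ c₂ n^r≤N ⟩
        c₂ * (c₃ * N) ≡⟨ *-assoc c₂ c₃ N ⟨
        c₂ * c₃ * N ∎
        where e₈ : ∀ a b c → a * (b * c) ≡ b * (a * c)
              e₈ = solve-∀

    -- Lower bounds for walk counts.

    n^E≤′ : ∀ i → n ^ E ≤ c₅ * ((g + i) C E)
    n^E≤′ i = ≤-trans (n^E≤ i) (*-monoˡ-≤ ((g + i) C E) (m≤m+n c₁ _))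

    n^e≤′ : ∀ i → n ^ e ≤ c₅ * ((g + i) C e)
    n^e≤′ i = ≤-trans (n^e≤ i) (*-monoˡ-≤ ((g + i) C e) (m≤n+m _ c₁))

    -- One step gains at most one common element with the target, at the cost of a factor n.
    F-lower : ∀ k i → i ≤ r → s ≤ i + k → n ^ (E + k * e) ≤ c₅ ^ suc k * F (suc k) i
    F-lower zero i i≤r s≤i = begin
      n ^ (E + 0) ≡⟨ cong (n ^_) (+-identityʳ E) ⟩
      n ^ E ≤⟨ n^E≤′ i ⟩
      c₅ * ((g + i) C E) ≡⟨ cong₂ _*_ (sym (*-identityʳ c₅)) (trans (sym (*-identityʳ _)) (cong (((g + i) C E) *_)
          (sym (⟦⟧-yes (s + 0 ≟ s) (+-identityʳ s))))) ⟩
      c₅ ^ 1 * (((g + i) C E) * F 0 (s + 0)) ≤⟨ *-monoʳ-≤ (c₅ ^ 1) (T-≥ (F 0) i s 0 0 E (≤-trans s≤i (≤-reflexive (+-identityʳ i))) z≤n z≤n (+-identityʳ s) refl) ⟩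
      c₅ ^ 1 * F 1 i ∎
      where open ≤-Reasoning
    F-lower (suc k) i i≤r s≤i+k = begin
      n ^ (E + (e + k * e)) ≡⟨ cong (n ^_) (e₁ E e (k * e)) ⟩
      n ^ (e + (E + k * e)) ≡⟨ ^-distribˡ-+-* n e (E + k * e) ⟩
      n ^ e * n ^ (E + k * e) ≤⟨ step ⟩
      c₅ ^ suc (suc k) * F (suc (suc k)) i ∎
      where
      open ≤-Reasoning
      e₁ : ∀ E e x → E + (e + x) ≡ e + (E + x)
      e₁ = solve-∀
      e₂ : ∀ c x c' y → c * x * (c' * y) ≡ c * c' * (x * y)
      e₂ = solve-∀
      combine : ∀ d a b c → n ^ e ≤ c₅ * ((g + i) C d) → a ≤ i → b ≤ r ∸ i → c ≤ r ∸ i → a + b ≡ s → c + d ≡ E →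
        a + c ≤ r → s ≤ a + c + k → n ^ e * n ^ (E + k * e) ≤ c₅ ^ suc (suc k) * F (suc (suc k)) i
      combine d a b c h a≤ b≤ c≤ ab cd ac≤ s≤ = begin
        n ^ e * n ^ (E + k * e) ≤⟨ *-mono-≤ h (F-lower k (a + c) ac≤ s≤) ⟩
        c₅ * ((g + i) C d) * (c₅ ^ suc k * F (suc k) (a + c)) ≡⟨ e₂ c₅ _ (c₅ ^ suc k) _ ⟩
        c₅ ^ suc (suc k) * (((g + i) C d) * F (suc k) (a + c)) ≤⟨ *-monoʳ-≤ (c₅ ^ suc (suc k)) (T-≥ (F (suc k)) i a b c d a≤ b≤ c≤ ab cd) ⟩
        c₅ ^ suc (suc k) * F (suc (suc k)) i ∎
      step : n ^ e * n ^ (E + k * e) ≤ c₅ ^ suc (suc k) * F (suc (suc k)) i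
      -- If s ≤ i, the walk moves to a vertex that shares s elements with the target. Otherwise it
      -- keeps all of u ∩ v and s - i other elements of u, and takes one new element of v, which
      -- leaves e free ones.
      step with s ≤? i
      ... | yes s≤i = combine E s 0 0 (≤-trans (^-monoʳ-≤ n (n≤1+n e)) (n^E≤′ i)) s≤i z≤n z≤n (+-identityʳ s) refl
                        (≤-trans (≤-reflexive (+-identityʳ s)) s≤r) (≤-trans (≤-reflexive (sym (+-identityʳ s))) (m≤m+n (s + 0) k))
      ... | no s≰i = combine e i (s ∸ i) 1 (n^e≤′ i) ≤-refl (∸-monoˡ-≤ i s≤r) (m<n⇒0<n∸m i<r) (m+[n∸m]≡n (<⇒≤ i<s)) refl
                        (≤-trans (≤-reflexive (+-comm i 1)) i<r) (≤-trans s≤i+k (≤-reflexive (e₃ i k)))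
        where
        i<s : i < s
        i<s = ≰⇒> s≰i
        i<r : i < r
        i<r = ≤-trans i<s s≤r
        e₃ : ∀ i k → i + suc k ≡ i + 1 + k
        e₃ = solve-∀

    -- κ/D^(s+2) is the Doeblin constant: s + 2 steps reach every vertex with probability at least that, which is of order 1/N.
    κ : ℕ
    κ = F (suc s) (proj₁ (minimum (F (suc s)) r))

    κ≤F : ∀ i → i ≤ r → κ ≤ F (suc s) i
    κ≤F = proj₂ (proj₂ (minimum (F (suc s)) r))

    κ-lower : D ^ suc (suc s) ≤ cB * (N * κ)
    κ-lower = begin
      D ^ suc (suc s) ≤⟨ ^-monoˡ-≤ (suc (suc s)) D≤n^E ⟩
      (c₂ * n ^ E) ^ suc (suc s) ≡⟨ ^-distribʳ-* c₂ (n ^ E) (suc (suc s)) ⟩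
      c₂ ^ suc (suc s) * (n ^ E) ^ suc (suc s)
        -- E (s + 2) = r + (E + s e): the exponent of `F-lower` at k = s is that of D^(s+2)/N, so
        -- only constants are lost.
        ≡⟨ cong (c₂ ^ suc (suc s) *_) (trans (^-*-assoc n E (suc (suc s))) (trans (cong (n ^_) (e₁ s e)) (^-distribˡ-+-* n r _))) ⟩
      c₂ ^ suc (suc s) * (n ^ r * n ^ (E + s * e))
        ≤⟨ *-monoʳ-≤ (c₂ ^ suc (suc s)) (*-mono-≤ n^r≤N (F-lower s j j≤r (m≤n+m s j))) ⟩
      c₂ ^ suc (suc s) * (c₃ * N * (c₅ ^ suc s * κ)) ≡⟨ e₂ (c₂ ^ suc (suc s)) c₃ N (c₅ ^ suc s) κ ⟩
      cB * (N * κ) ∎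
      where
      open ≤-Reasoning
      j = proj₁ (minimum (F (suc s)) r)
      j≤r = proj₁ (proj₂ (minimum (F (suc s)) r))
      e₁ : ∀ s e → suc e * suc (suc s) ≡ s + suc e + (suc e + s * e)
      e₁ = solve-∀
      e₂ : ∀ a b c d f → a * (b * c * (d * f)) ≡ a * b * d * (c * f)
      e₂ = solve-∀

    -- A lower bound that holds for every i passes through `T`, gaining a factor D per step.
    F-lower-all : ∀ j i → i ≤ r → κ * D ^ j ≤ F (j + suc s) i
    F-lower-all zero i i≤r = ≤-trans (≤-reflexive (*-identityʳ κ)) (κ≤F i i≤r)
    F-lower-all (suc j) i i≤r = begin
      κ * (D * D ^ j) ≡⟨ e₁ κ D (D ^ j) ⟩
      κ * D ^ j * D ≡⟨ T-const (κ * D ^ j) i i≤r ⟨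
      T (λ _ → κ * D ^ j) i ≤⟨ T-mono i i≤r (F-lower-all j) ⟩
      F (suc j + suc s) i ∎
      where
      open ≤-Reasoning
      e₁ : ∀ k D x → k * (D * x) ≡ k * x * D
      e₁ = solve-∀

    ϕ-lower : ∀ j → D ^ (j + suc (suc s)) ≤ cB * (N * ϕ (j + suc s))
    ϕ-lower j = begin
      D ^ (j + suc (suc s)) ≡⟨ ^-distribˡ-+-* D j (suc (suc s)) ⟩
      D ^ j * D ^ suc (suc s) ≤⟨ *-monoʳ-≤ (D ^ j) κ-lower ⟩
      D ^ j * (cB * (N * κ)) ≡⟨ e₁ (D ^ j) cB N κ ⟩
      cB * (N * (κ * D ^ j)) ≤⟨ *-monoʳ-≤ cB (*-monoʳ-≤ N (F-lower-all j r ≤-refl)) ⟩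
      cB * (N * ϕ (j + suc s)) ∎
      where
      open ≤-Reasoning
      e₁ : ∀ a b c d → a * (b * (c * d)) ≡ b * (c * (d * a))
      e₁ = solve-∀

    κ≤wlk : ∀ {x z} → x ∈ V → z ∈ V → κ ≤ wlk (suc s) x z
    κ≤wlk x∈ z∈ = ≤-trans (κ≤F _ (∣∩∣≤r x∈)) (≤-reflexive (sym (wlk≡F (suc s) x∈ z∈)))

    -- Proportion of free walks that meet themselves.

    M : ℕ
    M = suc (suc s)

    SA≤N : ∀ d → SA d ≤ N * D ^ d
    SA≤N d = ≤-trans (SA≤ d) (≤-reflexive (cong (_* D ^ d) ∣V∣))

    -- `decay` with P/Q = 1/D bounds the self-avoiding proportion by D/(D + j). The condition on M
    -- makes j at least half of τ = j + 1 + M, so D ≤ k τ gives D ≤ 2 k j.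
    backtrack-fraction : ∀ k w j → D ≤ k * (suc j + M) → suc (suc M) ≤ suc j → 2 * k ≤ w → suc w * SA (suc j) ≤ w * (N * D ^ suc j)
    backtrack-fraction k w j D≤ M≤j 2k≤w = fraction D j (SA (suc j)) (N * D ^ suc j) w (begin
        (D + j) * SA (suc j) ≡⟨ cong (λ z → (D + z) * SA (suc j)) (*-identityʳ j) ⟨
        (D + j * 1) * SA (suc j) ≤⟨ decay D 1 D (SA ∘ suc) step j ⟩
        D * D ^ j * SA 1 ≤⟨ *-monoʳ-≤ (D * D ^ j) (SA≤N 1) ⟩
        D * D ^ j * (N * (D * 1)) ≡⟨ e₁ D (D ^ j) N ⟩
        D * (N * D ^ suc j) ∎)
      (begin
        D ≤⟨ D≤ ⟩
        k * (suc j + M) ≡⟨ cong (k *_) (+-suc j M) ⟨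
        k * (j + suc M) ≤⟨ *-monoʳ-≤ k (+-monoʳ-≤ j (≤-pred M≤j)) ⟩
        k * (j + j) ≡⟨ e₂ k j ⟩
        2 * k * j ≤⟨ *-monoˡ-≤ j 2k≤w ⟩
        w * j ∎)
      where
      open ≤-Reasoning
      e₁ : ∀ D x N → D * x * (N * (D * 1)) ≡ D * (N * (D * x))
      e₁ = solve-∀
      e₂ : ∀ k j → k * (j + j) ≡ 2 * k * j
      e₂ = solve-∀
      e₃ : ∀ D x y → D * x + 1 * D * y ≡ D * (x + y)
      e₃ = solve-∀
      step : ∀ j → D * SA (suc (suc j)) + 1 * D * SA (suc j) ≤ D * D * SA (suc j)
      step j = begin
        D * SA (suc (suc j)) + 1 * D * SA (suc j) ≡⟨ e₃ D (SA (suc (suc j))) (SA (suc j)) ⟩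
        D * (SA (suc (suc j)) + SA (suc j)) ≤⟨ *-monoʳ-≤ D (SA-backtrack j) ⟩
        D * (D * SA (suc j)) ≡⟨ *-assoc D D _ ⟨
        D * D * SA (suc j) ∎

    instance
      cBN≢0 : NonZero (cB * N)
      cBN≢0 = >-nonZero (pos-factor κ (m^n>0 D M) (≤-trans κ-lower (≤-reflexive (trans (sym (*-assoc cB N κ)) (*-comm (cB * N) κ)))))

    -- After ℓ₀ initial steps come J blocks of M steps. Every block has to miss more than ℓ₀ old
    -- vertices, so `decay` applies with P/Q = ℓ₀/(cB N).
    collision-fraction : ∀ w J ℓ₀ → cB * N ≤ w * (J * ℓ₀) → suc w * SA (J * M + ℓ₀) ≤ w * (N * D ^ (J * M + ℓ₀))
    collision-fraction w J ℓ₀ h = fraction (cB * N) (J * ℓ₀) _ _ w (begin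
        (cB * N + J * ℓ₀) * SA (J * M + ℓ₀) ≤⟨ decay (cB * N) ℓ₀ (D ^ M) (λ j → SA (j * M + ℓ₀)) step J ⟩
        cB * N * (D ^ M) ^ J * SA ℓ₀ ≤⟨ *-monoʳ-≤ (cB * N * (D ^ M) ^ J) (SA≤N ℓ₀) ⟩
        cB * N * (D ^ M) ^ J * (N * D ^ ℓ₀) ≡⟨ e₁ (cB * N) ((D ^ M) ^ J) N (D ^ ℓ₀) ⟩
        cB * N * (N * ((D ^ M) ^ J * D ^ ℓ₀)) ≡⟨ cong (λ z → cB * N * (N * z)) (trans (cong (_* D ^ ℓ₀)
            (trans (^-*-assoc D M J) (cong (D ^_) (*-comm M J)))) (sym (^-distribˡ-+-* D (J * M) ℓ₀))) ⟩
        cB * N * (N * D ^ (J * M + ℓ₀)) ∎) h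
      where
      open ≤-Reasoning
      e₁ : ∀ Q x N y → Q * x * (N * y) ≡ Q * (N * (x * y))
      e₁ = solve-∀
      e₂ : ∀ c N κ P u → P * (c * (N * κ)) * u ≡ c * N * (P * κ * u)
      e₂ = solve-∀
      step : ∀ j → cB * N * SA (suc j * M + ℓ₀) + ℓ₀ * D ^ M * SA (j * M + ℓ₀) ≤ cB * N * D ^ M * SA (j * M + ℓ₀)
      step j = begin
        cB * N * SA (suc j * M + ℓ₀) + ℓ₀ * D ^ M * SA d
          ≤⟨ +-mono-≤ (≤-reflexive (cong (λ z → cB * N * SA z) index)) (begin
             ℓ₀ * D ^ M * SA d ≤⟨ *-monoˡ-≤ (SA d) (*-mono-≤ (≤-trans (m≤n+m ℓ₀ (j * M)) (n≤1+n d)) κ-lower) ⟩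
             suc d * (cB * (N * κ)) * SA d ≡⟨ e₂ cB N κ (suc d) (SA d) ⟩
             cB * N * (suc d * κ * SA d) ∎) ⟩
        cB * N * SA (suc s + suc d) + cB * N * (suc d * κ * SA d) ≡⟨ *-distribˡ-+ (cB * N) _ _ ⟨
        cB * N * (SA (suc s + suc d) + suc d * κ * SA d) ≤⟨ *-monoʳ-≤ (cB * N) (SA-collision (suc s) d κ κ≤wlk) ⟩
        cB * N * (D ^ M * SA d) ≡⟨ *-assoc (cB * N) (D ^ M) (SA d) ⟨
        cB * N * D ^ M * SA d ∎
        where
        d = j * M + ℓ₀
        index : suc j * M + ℓ₀ ≡ suc s + suc d
        index = trans (+-assoc M (j * M) ℓ₀) (sym (cong suc (+-suc s d)))

    -- At most a quarter of the length goes into blocks: J is still at least τ/(8 M), while ℓ₀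
    -- remains at least τ/2. Hence J ℓ₀ ≥ τ²/(16 M), which explains the constant 16 M.
    birthday-fraction : ∀ k w ℓ → N ≤ (k * (ℓ + M)) ^ 2 → 8 * M ≤ ℓ + M → 16 * M * cB * (k * k) ≤ w →
      suc w * SA ℓ ≤ w * (N * D ^ ℓ)
    birthday-fraction k w ℓ N≤ 8M≤τ w≥ = subst (λ z → suc w * SA z ≤ w * (N * D ^ z)) (m+[n∸m]≡n JM≤ℓ)
      (collision-fraction w J ℓ₀ (begin
        cB * N ≤⟨ *-monoʳ-≤ cB (≤-trans N≤ (≤-reflexive (^2≡* (k * τ)))) ⟩
        cB * (k * τ * (k * τ)) ≡⟨ e₁ cB k τ ⟩
        cB * (k * k) * (τ * τ) ≤⟨ *-monoʳ-≤ (cB * (k * k)) (*-mono-≤ τ≤J τ≤ℓ₀) ⟩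
        cB * (k * k) * (8 * M * J * (2 * ℓ₀)) ≡⟨ e₂ cB k M J ℓ₀ ⟩
        16 * M * cB * (k * k) * (J * ℓ₀) ≤⟨ *-monoˡ-≤ (J * ℓ₀) w≥ ⟩
        w * (J * ℓ₀) ∎))
      where
      open ≤-Reasoning
      τ = ℓ + M
      J = τ / (4 * M)
      ℓ₀ = ℓ ∸ J * M
      e₁ : ∀ c k t → c * (k * t * (k * t)) ≡ c * (k * k) * (t * t)
      e₁ = solve-∀
      e₂ : ∀ c k M J l → c * (k * k) * (8 * M * J * (2 * l)) ≡ 16 * M * c * (k * k) * (J * l)
      e₂ = solve-∀
      4JM≤τ : 4 * (J * M) ≤ τ
      4JM≤τ = ≤-trans (≤-reflexive (e₃ J M)) (m/n*n≤m τ (4 * M))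
        where e₃ : ∀ J M → 4 * (J * M) ≡ J * (4 * M)
              e₃ = solve-∀
      τ≤J : τ ≤ 8 * M * J
      τ≤J = +-cancelʳ-≤ τ _ _ (begin
        τ + τ ≤⟨ +-mono-≤ le le ⟩
        4 * M + J * (4 * M) + (4 * M + J * (4 * M)) ≡⟨ e₄ M J ⟩
        8 * M * J + 8 * M ≤⟨ +-monoʳ-≤ (8 * M * J) 8M≤τ ⟩
        8 * M * J + τ ∎)
        where
        e₄ : ∀ M J → 4 * M + J * (4 * M) + (4 * M + J * (4 * M)) ≡ 8 * M * J + 8 * M
        e₄ = solve-∀
        le : τ ≤ 4 * M + J * (4 * M)
        le = ≤-trans (≤-reflexive (m≡m%n+[m/n]*n τ (4 * M))) (+-monoˡ-≤ (J * (4 * M)) (<⇒≤ (m%n<n τ (4 * M))))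
      rest : 8 * (J * M) + 8 * M + 4 * τ ≤ 8 * ℓ + 8 * M
      rest = begin
        8 * (J * M) + 8 * M + 4 * τ ≡⟨ e₅ (J * M) M τ ⟩
        2 * (4 * (J * M)) + 8 * M + 4 * τ ≤⟨ +-monoˡ-≤ (4 * τ) (+-mono-≤ (*-monoʳ-≤ 2 4JM≤τ) 8M≤τ) ⟩
        2 * τ + τ + 4 * τ ≤⟨ m≤m+n _ τ ⟩
        2 * τ + τ + 4 * τ + τ ≡⟨ e₆ ℓ M ⟩
        8 * ℓ + 8 * M ∎
        where
        e₅ : ∀ x M τ → 8 * x + 8 * M + 4 * τ ≡ 2 * (4 * x) + 8 * M + 4 * τ
        e₅ = solve-∀
        e₆ : ∀ ℓ M → 2 * (ℓ + M) + (ℓ + M) + 4 * (ℓ + M) + (ℓ + M) ≡ 8 * ℓ + 8 * M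
        e₆ = solve-∀
      JM+τ/2≤ℓ : 2 * (J * M) + τ ≤ 2 * ℓ
      JM+τ/2≤ℓ = *-cancelˡ-≤ 4 (+-cancelʳ-≤ (8 * M) _ _ (≤-trans (≤-reflexive (e₇ (J * M) M τ)) (≤-trans rest (≤-reflexive (e₈ ℓ M)))))
        where
        e₇ : ∀ x M τ → 4 * (2 * x + τ) + 8 * M ≡ 8 * x + 8 * M + 4 * τ
        e₇ = solve-∀
        e₈ : ∀ ℓ M → 8 * ℓ + 8 * M ≡ 4 * (2 * ℓ) + 8 * M
        e₈ = solve-∀
      JM≤ℓ : J * M ≤ ℓ
      JM≤ℓ = *-cancelˡ-≤ 2 (≤-trans (m≤m+n _ τ) JM+τ/2≤ℓ)
      τ≤ℓ₀ : τ ≤ 2 * ℓ₀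
      τ≤ℓ₀ = +-cancelˡ-≤ (2 * (J * M)) _ _ (≤-trans JM+τ/2≤ℓ (≤-reflexive (trans (cong (2 *_) (sym (m+[n∸m]≡n JM≤ℓ)))
        (*-distribˡ-+ 2 (J * M) ℓ₀))))

    -- Both directions for a fixed n.

    ∣mono-hom∣ : ∀ L → ∣ monoC (suc L) n r s - homC (suc L) n r s ∣ ≡ homS L ∸ monoS L
    ∣mono-hom∣ L = trans (cong₂ ∣_-_∣ (monoC≡monoS L) (homC≡homS L)) (m≤n⇒∣m-n∣≡n∸m (monoS≤homS L))

    -- Once n is bounded by a multiple of t², the walk is long enough to be mixed.
    mixed : ∀ A d₀ τ → (∀ d → d₀ ≤ d → (A * ((d + d + 4) * (d + d + 4))) ^ r * p ^ d ≤ q ^ d) →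
      n ≤ A * (τ * τ) → ∀ d → d₀ ≤ d → τ ≤ d + d + 4 → N * p ^ d ≤ q ^ d
    mixed A d₀ τ exp n≤ d d₀≤d τ≤ = ≤-trans (*-monoˡ-≤ (p ^ d)
      (≤-trans N≤n^r (^-monoˡ-≤ r (≤-trans n≤ (*-monoʳ-≤ A (*-mono-≤ τ≤ τ≤)))))) (exp d d₀≤d)

    open ReturnBounds p N D cA ϕ ϕ-0 ϕ-upper

    -- Each of at most τ² coincidences accounts for at most a proportion cC/n of all closed walks,
    -- by `ϕ-supermult′`.
    collisions-short : ∀ k L → k * cC * (suc (suc L) * suc (suc L)) ≤ n → k * coinS (suc L) ≤ N * ϕ (suc L)
    collisions-short k L short = *-cancelˡ-≤ n (begin
      n * (k * coinS (suc L)) ≤⟨ *-monoʳ-≤ n (*-monoʳ-≤ k (coinS-bound (suc L))) ⟩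
      n * (k * (N * (τ * Σϕ))) ≡⟨ e₁ n k N τ Σϕ ⟩
      k * (N * (τ * (n * Σϕ))) ≤⟨ *-monoʳ-≤ k (*-monoʳ-≤ N (*-monoʳ-≤ τ nΣ≤)) ⟩
      k * (N * (τ * (τ * (cC * ϕ (suc L))))) ≡⟨ e₂ k N τ cC (ϕ (suc L)) ⟩
      k * cC * (τ * τ) * (N * ϕ (suc L)) ≤⟨ *-monoˡ-≤ (N * ϕ (suc L)) short ⟩
      n * (N * ϕ (suc L)) ∎)
      where
      open ≤-Reasoning
      τ = suc (suc L)
      Σϕ = ∑< (suc L) (λ i → ϕ i * ϕ (L ∸ i))
      e₁ : ∀ n k N τ S → n * (k * (N * (τ * S))) ≡ k * (N * (τ * (n * S)))
      e₁ = solve-∀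
      e₂ : ∀ k N τ c f → k * (N * (τ * (τ * (c * f)))) ≡ k * c * (τ * τ) * (N * f)
      e₂ = solve-∀
      nΣ≤ : n * Σϕ ≤ τ * (cC * ϕ (suc L))
      nΣ≤ = begin
        n * Σϕ ≡⟨ ∑<-*ˡ (suc L) n (λ i → ϕ i * ϕ (L ∸ i)) ⟨
        ∑< (suc L) (λ i → n * (ϕ i * ϕ (L ∸ i)))
          ≤⟨ ∑<-mono (suc L) (λ { i (s≤s i≤L) → ≤-trans (ϕ-supermult′ i (L ∸ i))
               (≤-reflexive (cong (λ z → cC * ϕ (suc z)) (m+[n∸m]≡n i≤L))) }) ⟩
        ∑< (suc L) (λ _ → cC * ϕ (suc L)) ≡⟨ ∑<-const (suc L) (cC * ϕ (suc L)) ⟩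
        suc L * (cC * ϕ (suc L)) ≤⟨ *-monoˡ-≤ (cC * ϕ (suc L)) (n≤1+n (suc L)) ⟩
        τ * (cC * ϕ (suc L)) ∎

    collisions-long : ∀ k A d₀ L → (∀ d → d₀ ≤ d → (A * ((d + d + 4) * (d + d + 4))) ^ r * p ^ d ≤ q ^ d) →
      n ≤ A * (suc (suc L) * suc (suc L)) → d₀ + d₀ + 4 ≤ suc (suc L) → s + 2 ≤ suc (suc L) →
      suc (8 * k * cA * cA * cB * q) * suc (suc L) ≤ D → (suc (8 * k * cA * cA * cB * q) * suc (suc L)) ^ 2 ≤ N →
      k * coinS (suc L) ≤ N * ϕ (suc L)
    collisions-long k A d₀ L exp n≤ y₀≤τ M≤τ Kτ≤ Kτ²≤ =
      collision-arith k cA cB p N D L (D ^ τ) (N * ϕ (suc L)) (∑< (suc L) (λ i → ϕ i * ϕ (L ∸ i))) (coinS (suc L))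
        (convolution-bound L mix) low (coinS-bound (suc L)) Kτ≤ Kτ²≤
      where
      τ = suc (suc L)
      mix : ∀ d → L ≤ d + d + 2 → N * p ^ d ≤ q ^ d
      mix d L≤ = mixed A d₀ τ exp n≤ d d₀≤d τ≤
        where
        e₃ : ∀ d → suc (suc (d + d + 2)) ≡ d + d + 4
        e₃ = solve-∀
        τ≤ : τ ≤ d + d + 4
        τ≤ = ≤-trans (s≤s (s≤s L≤)) (≤-reflexive (e₃ d))
        d₀≤d : d₀ ≤ d
        d₀≤d = ≮⇒≥ (λ d<d₀ → <⇒≱ (+-monoˡ-< 4 (+-mono-< d<d₀ d<d₀)) (≤-trans y₀≤τ τ≤))
      s≤L : s ≤ L
      s≤L = ≤-pred (≤-pred (≤-trans (≤-reflexive (+-comm 2 s)) M≤τ))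
      low : D ^ τ ≤ cB * (N * ϕ (suc L))
      low = subst₂ (λ x y → D ^ x ≤ cB * (N * ϕ y))
        (trans (+-suc (L ∸ s) (suc s)) (cong suc (trans (+-suc (L ∸ s) s) (cong suc (m∸n+n≡m s≤L)))))
        (trans (+-suc (L ∸ s) s) (cong suc (m∸n+n≡m s≤L))) (ϕ-lower (L ∸ s))

    -- The two strict inequalities are thresholds for the long case: together with n ≤ k cC τ² they
    -- force τ ≥ 2 d₀ + 4 and τ ≥ s + 2, as `collisions-long` requires.
    mono-close : ∀ k d₀ τ → 3 ≤ τ →
      (∀ d → d₀ ≤ d → (k * cC * ((d + d + 4) * (d + d + 4))) ^ r * p ^ d ≤ q ^ d) →
      k * cC * ((d₀ + d₀ + 4) * (d₀ + d₀ + 4)) < n → k * cC * ((s + 2) * (s + 2)) < n →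
      suc (8 * k * cA * cA * cB * q) * τ ≤ N₁ n r s → (suc (8 * k * cA * cA * cB * q) * τ) ^ 2 ≤ Nv n r →
      k * ∣ monoC τ n r s - homC τ n r s ∣ ≤ homC τ n r s
    mono-close k d₀ (suc zero) (s≤s ())
    mono-close k d₀ (suc (suc L)) _ exp y₀<n M<n Kτ≤ Kτ²≤ = begin
      k * ∣ monoC τ n r s - homC τ n r s ∣ ≡⟨ cong (k *_) (∣mono-hom∣ (suc L)) ⟩
      k * (homS (suc L) ∸ monoS (suc L)) ≤⟨ *-monoʳ-≤ k (m≤n+o⇒m∸n≤o (homS (suc L)) (monoS (suc L)) (homS≤ (suc L))) ⟩
      k * coinS (suc L) ≤⟨ collisions (≤-total (A * (τ * τ)) n) ⟩
      N * ϕ (suc L) ≡⟨ homS≡Nϕ (suc L) ⟨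
      homS (suc L) ≡⟨ homC≡homS (suc L) ⟨
      homC τ n r s ∎
      where
      open ≤-Reasoning
      τ = suc (suc L)
      A = k * cC
      collisions : A * (τ * τ) ≤ n ⊎ n ≤ A * (τ * τ) → k * coinS (suc L) ≤ N * ϕ (suc L)
      collisions (inj₁ short) = collisions-short k L short
      collisions (inj₂ n≤) = collisions-long k A d₀ L exp n≤ (square-cancel-< A (≤-trans y₀<n n≤)) (square-cancel-< A (≤-trans M<n n≤))
        (≤-trans Kτ≤ (≤-reflexive N₁≡D)) Kτ²≤

    -- Here Δ = hom - mono is at least D^τ/(cB (w + 1)) by `gap`, while hom is at most 2 cA D^τ by
    -- mixing. So Δ is a fixed proportion of hom, which contradicts closeness with the stated
    -- factor.
    mono-far : ∀ w d ℓ → ℓ + M ≡ suc (suc d) → N * p ^ d ≤ q ^ d → suc w * SA ℓ ≤ w * (N * D ^ ℓ) →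
      suc (4 * cA * cB * suc w) * ∣ monoC (suc (suc d)) n r s - homC (suc (suc d)) n r s ∣ ≤ homC (suc (suc d)) n r s → ⊥
    mono-far w d ℓ ℓ+M mix frac close = <⇒≱ (m^n>0 D τ) (begin
      D ^ τ ≤⟨ Dτ≤ ⟩
      cB * suc w * Δ ≡⟨ cong (cB * suc w *_) (n≤0⇒n≡0 (≤-trans (m≤m+n Δ hom) Δ+hom≤0)) ⟩
      cB * suc w * 0 ≡⟨ *-zeroʳ (cB * suc w) ⟩
      0 ∎)
      where
      open ≤-Reasoning
      τ = suc (suc d)
      hom Δ tot : ℕ
      hom = homS (suc d)
      Δ = hom ∸ monoS (suc d)
      tot = N * D ^ ℓ
      ℓ+m : ℓ + suc s ≡ suc d
      ℓ+m = suc-injective (trans (sym (+-suc ℓ (suc s))) ℓ+M)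
      κtot≤ : κ * tot ≤ suc w * Δ
      κtot≤ = gap w κ (monoS (suc d)) (homS (suc d)) (SA ℓ) tot
        (subst₂ _≤_ (cong₂ (λ x y → monoS x + κ * (y * D ^ ℓ)) ℓ+m ∣V∣) (cong (λ x → homS x + κ * SA ℓ) ℓ+m)
          (monoS+SA ℓ (suc s) κ κ≤wlk)) frac
      e₁ : ∀ x c N κ → x * (c * (N * κ)) ≡ c * (κ * (N * x))
      e₁ = solve-∀
      Dτ≤ : D ^ τ ≤ cB * suc w * Δ
      Dτ≤ = begin
        D ^ τ ≡⟨ trans (cong (D ^_) (sym ℓ+M)) (^-distribˡ-+-* D ℓ M) ⟩
        D ^ ℓ * D ^ M ≤⟨ *-monoʳ-≤ (D ^ ℓ) κ-lower ⟩
        D ^ ℓ * (cB * (N * κ)) ≡⟨ e₁ (D ^ ℓ) cB N κ ⟩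
        cB * (κ * tot) ≤⟨ *-monoʳ-≤ cB κtot≤ ⟩
        cB * (suc w * Δ) ≡⟨ *-assoc cB (suc w) Δ ⟨
        cB * suc w * Δ ∎
      hom≤ : hom ≤ 2 * cA * (cB * suc w * Δ)
      hom≤ = ≤-trans (≤-reflexive (homS≡Nϕ (suc d))) (≤-trans (ϕ-mixed d mix) (*-monoʳ-≤ (2 * cA) Dτ≤))
      e₂ : ∀ a b w x → x + (2 * a * (b * w * x) + 2 * a * (b * w * x)) ≡ suc (4 * a * b * w) * x
      e₂ = solve-∀
      -- The bound on hom is used twice, which gives the 4 in the factor; the `suc` leaves one Δ
      -- over and excludes Δ = hom = 0 afterwards, as D^τ is positive.
      Δ+hom≤0 : Δ + hom ≤ 0
      Δ+hom≤0 = +-cancelʳ-≤ hom (Δ + hom) 0 (begin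
        Δ + hom + hom ≡⟨ +-assoc Δ hom hom ⟩
        Δ + (hom + hom) ≤⟨ +-monoʳ-≤ Δ (+-mono-≤ hom≤ hom≤) ⟩
        Δ + (2 * cA * (cB * suc w * Δ) + 2 * cA * (cB * suc w * Δ)) ≡⟨ e₂ cA cB (suc w) Δ ⟩
        suc (4 * cA * cB * suc w) * Δ ≡⟨ cong (suc (4 * cA * cB * suc w) *_) (∣mono-hom∣ (suc d)) ⟨
        suc (4 * cA * cB * suc w) * ∣ monoC τ n r s - homC τ n r s ∣ ≤⟨ close ⟩
        homC τ n r s ≡⟨ homC≡homS (suc d) ⟩
        hom ∎)

    -- If a conclusion fails, D < k τ or N < (k τ)², and as n ≤ c₁ D and n ≤ c₃ N, either gives n ≤
    -- A τ². The threshold T₀ then ensures mixing and τ ≥ 8 M. The two summands of w serve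
    -- `backtrack-fraction` and `birthday-fraction`.
    mono-close⇒small : ∀ k d₀ τ → let A = c₁ * k + c₃ * (k * k)
                                      w = 2 * k + 16 * M * cB * (k * k)
                                      T₀ = d₀ + 8 * M + 2 in
      3 ≤ τ → (∀ d → d₀ ≤ d → (A * ((d + d + 4) * (d + d + 4))) ^ r * p ^ d ≤ q ^ d) → A * (T₀ * T₀) < n →
      suc (4 * cA * cB * suc w) * ∣ monoC τ n r s - homC τ n r s ∣ ≤ homC τ n r s →
      k * τ ≤ N₁ n r s × (k * τ) ^ 2 ≤ Nv n r
    mono-close⇒small k d₀ (suc zero) (s≤s ())
    mono-close⇒small k d₀ (suc (suc d)) _ exp T₀<n close =
      decidable-stable (k * τ ≤? N₁ n r s) (λ h →
        let D≤ = ≤-trans (≤-reflexive (sym N₁≡D)) (<⇒≤ (≰⇒> h)) in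
        far (n≤₁ D≤) (backtracks ℓ refl (long (n≤₁ D≤)) D≤)) ,
      decidable-stable ((k * τ) ^ 2 ≤? Nv n r) (λ h →
        let N≤ = <⇒≤ (≰⇒> h) in
        far (n≤₂ N≤) (birthday-fraction k w ℓ
          (≤-trans N≤ (≤-reflexive (cong (λ z → (k * z) ^ 2) (sym (ℓ+M (long (n≤₂ N≤)))))))
          (≤-trans (long (n≤₂ N≤)) (≤-reflexive (sym (ℓ+M (long (n≤₂ N≤)))))) (m≤n+m _ (2 * k))))
      where
      open ≤-Reasoning
      A w T₀ τ ℓ : ℕ
      A = c₁ * k + c₃ * (k * k)
      w = 2 * k + 16 * M * cB * (k * k)
      T₀ = d₀ + 8 * M + 2
      τ = suc (suc d)
      ℓ = τ ∸ M
      T₀≤τ : n ≤ A * (τ * τ) → T₀ ≤ τ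
      T₀≤τ n≤ = square-cancel-< A (≤-trans T₀<n n≤)
      long : n ≤ A * (τ * τ) → 8 * M ≤ τ
      long n≤ = ≤-trans (≤-trans (m≤n+m (8 * M) d₀) (m≤m+n (d₀ + 8 * M) 2)) (T₀≤τ n≤)
      ℓ+M : 8 * M ≤ τ → ℓ + M ≡ τ
      ℓ+M h = m∸n+n≡m (≤-trans (m≤n*m M 8) h)
      far : n ≤ A * (τ * τ) → suc w * SA ℓ ≤ w * (N * D ^ ℓ) → ⊥
      far n≤ frac = mono-far w d ℓ (ℓ+M (long n≤)) (mixed A d₀ τ exp n≤ d d₀≤d τ≤) frac close
        where
        d₀≤d : d₀ ≤ d
        d₀≤d = ≤-pred (≤-pred (≤-trans (≤-reflexive (+-comm 2 d₀)) (≤-trans (+-monoˡ-≤ 2 (m≤m+n d₀ (8 * M))) (T₀≤τ n≤))))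
        τ≤ : τ ≤ d + d + 4
        τ≤ = ≤-trans (≤-reflexive (+-comm 2 d)) (+-mono-≤ (m≤m+n d d) (m≤n+m 2 2))
      n≤₁ : D ≤ k * τ → n ≤ A * (τ * τ)
      n≤₁ D≤ = begin
        n ≤⟨ ≤-trans n≤D (*-monoʳ-≤ c₁ D≤) ⟩
        c₁ * (k * τ) ≡⟨ *-assoc c₁ k τ ⟨
        c₁ * k * τ ≤⟨ *-mono-≤ (m≤m+n (c₁ * k) _) (m≤m*n τ τ) ⟩
        A * (τ * τ) ∎
      e₅ : ∀ c k τ → c * (k * τ * (k * τ)) ≡ c * (k * k) * (τ * τ)
      e₅ = solve-∀
      n≤₂ : N ≤ (k * τ) ^ 2 → n ≤ A * (τ * τ)
      n≤₂ N≤ = begin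
        n ≤⟨ ≤-trans n≤N (*-monoʳ-≤ c₃ (≤-trans N≤ (≤-reflexive (^2≡* (k * τ))))) ⟩
        c₃ * (k * τ * (k * τ)) ≡⟨ e₅ c₃ k τ ⟩
        c₃ * (k * k) * (τ * τ) ≤⟨ *-monoˡ-≤ (τ * τ) (m≤n+m _ (c₁ * k)) ⟩
        A * (τ * τ) ∎
      e₃ : ∀ s → suc (suc (suc (suc s))) + suc (suc s) + (6 * suc s + 4) ≡ 8 * suc (suc s)
      e₃ = solve-∀
      backtracks : ∀ x → ℓ ≡ x → 8 * M ≤ τ → D ≤ k * τ → suc w * SA ℓ ≤ w * (N * D ^ ℓ)
      backtracks zero eq 8M≤ D≤ = ⊥-elim (<⇒≱ (m<m+n M (s≤s z≤n))
        (≤-trans 8M≤ (≤-reflexive (trans (sym (ℓ+M 8M≤)) (cong (_+ M) eq)))))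
      backtracks (suc j) eq 8M≤ D≤ = subst (λ x → suc w * SA x ≤ w * (N * D ^ x)) (sym eq)
        (backtrack-fraction k w j (≤-trans D≤ (≤-reflexive (cong (k *_) τ≡)))
          (+-cancelʳ-≤ M _ _ (≤-trans (≤-trans (m≤m+n _ (6 * suc s + 4)) (≤-reflexive (e₃ s))) (≤-trans 8M≤ (≤-reflexive τ≡))))
          (m≤m+n (2 * k) _))
        where
        τ≡ : τ ≡ suc j + M
        τ≡ = trans (sym (ℓ+M 8M≤)) (cong (_+ M) eq)

-- Passage to the limit.

as-order : ∀ r n → 8 * r ≤ n → ∃ λ g → 6 * r ≤ g × r + r + g ≡ n
as-order r n h = n ∸ (r + r) , 6r≤ , m+[n∸m]≡n (≤-trans (≤-trans (m≤m+n (r + r) (6 * r)) (≤-reflexive (e₁ r))) h)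
  where
  e₁ : ∀ r → r + r + 6 * r ≡ 8 * r
  e₁ = solve-∀
  6r≤ : 6 * r ≤ n ∸ (r + r)
  6r≤ = ≤-trans (≤-reflexive (sym (trans (cong (_∸ (r + r)) (sym (e₁ r))) (m+n∸m≡n (r + r) (6 * r))))) (∸-monoˡ-≤ (r + r) h)

module Asymptotics (s e : ℕ) (t : ℕ → ℕ) (3≤t : ∀ n → 3 ≤ t n) where

  open Constants s e

  p₀ : ℕ
  p₀ = 2 * (s + e)

  eventually : ∀ {P : ℕ → Set} m → (∀ g → 6 * r₀ ≤ g → m ≤ r₀ + r₀ + g → P (r₀ + r₀ + g)) → Eventually P
  eventually {P} m h = m + 8 * r₀ , λ n n≥ → go n n≥ (as-order r₀ n (≤-trans (m≤n+m (8 * r₀) m) n≥))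
    where
    go : ∀ n → m + 8 * r₀ ≤ n → (∃ λ g → 6 * r₀ ≤ g × r₀ + r₀ + g ≡ n) → P n
    go _ n≥ (g , large , refl) = h g large (≤-trans (m≤m+n m _) n≥)

  mono∼hom⇒little-o : ((λ n → monoC (t n) n r₀ s) ∼ (λ n → homC (t n) n r₀ s)) → LittleOMinSqrtN-N₁ r₀ s t
  mono∼hom⇒little-o mono∼hom k _ =
    let d₀ , exp = quadratic-poly≤exp (c₁ * k + c₃ * (k * k)) r₀ p₀
        T₀ = d₀ + 8 * suc (suc s) + 2
        n₁ , close = mono∼hom (suc (4 * cA * cB * suc (2 * k + 16 * suc (suc s) * cB * (k * k)))) (s≤s z≤n)
    in eventually (suc ((c₁ * k + c₃ * (k * k)) * (T₀ * T₀)) + n₁) (λ g large n≥ →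
         Johnson.Estimates.mono-close⇒small s e g large k d₀ _ (3≤t _) exp (≤-trans (m≤m+n _ n₁) n≥)
           (close _ (≤-trans (m≤n+m n₁ _) n≥)))

  little-o⇒mono∼hom : LittleOMinSqrtN-N₁ r₀ s t → (λ n → monoC (t n) n r₀ s) ∼ (λ n → homC (t n) n r₀ s)
  little-o⇒mono∼hom little-o k _ =
    let d₀ , exp = quadratic-poly≤exp (k * cC) r₀ p₀
        x₀ = suc (k * cC * ((d₀ + d₀ + 4) * (d₀ + d₀ + 4)))
        x₁ = suc (k * cC * ((s + 2) * (s + 2)))
        n₁ , small = little-o (suc (8 * k * cA * cA * cB * suc p₀)) (s≤s z≤n)
    in eventually (x₀ + x₁ + n₁) (λ g large n≥ →
         let Kt≤ , Kt²≤ = small _ (≤-trans (m≤n+m n₁ (x₀ + x₁)) n≥)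
         in Johnson.Estimates.mono-close s e g large k d₀ _ (3≤t _) exp
              (≤-trans (≤-trans (m≤m+n x₀ x₁) (m≤m+n _ n₁)) n≥) (≤-trans (≤-trans (m≤n+m x₁ x₀) (m≤m+n _ n₁)) n≥) Kt≤ Kt²≤)

<⇒∃ : ∀ {m n} → m < n → ∃ λ o → m + suc o ≡ n
<⇒∃ {m} m<n = let o , eq = m≤n⇒∃[o]m+o≡n m<n in o , trans (+-suc m o) eq

theorem2 : (r s : ℕ) → s < r → (t : ℕ → ℕ) → (∀ n → 3 ≤ t n) →
    ((λ n → monoC (t n) n r s) ∼ (λ n → homC (t n) n r s)) ⇔ LittleOMinSqrtN-N₁ r s t
theorem2 r s s<r t 3≤t = from-gap (<⇒∃ s<r)
  where
  from-gap : ∀ {r} → (∃ λ e → s + suc e ≡ r) →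
    ((λ n → monoC (t n) n r s) ∼ (λ n → homC (t n) n r s)) ⇔ LittleOMinSqrtN-N₁ r s t
  from-gap (e , refl) = mk⇔ mono∼hom⇒little-o little-o⇒mono∼hom
    where open Asymptotics s e t 3≤t
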